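{- Fix an integer $q \geq 3$. For positive integers $f, m$ with $(q-1)m < f < qm$, let $N(f,m)$ denote the number of numerical semigroups with multiplicity $m$ and Frobenius number $f$, and put $\alpha := f/m - (q-1) \in (0,1)$. Then, as $(f,m)$ varies subject to $(q-1)m < f < qm$, \[N(f,m) = \left(c_q^{\alpha}\, c_{q-1}^{1-\alpha}\right)^{m + o(m)},\] where $o(m)$ denotes a quantity $E(f,m)$ with $E(f,m)/m \to 0$ as $m \to \infty$ (uniformly over the admissible $f$).
   Context: A numerical semigroup is a subset $\Lambda \subseteq \mathbb{N}_0$ containing $0$, closed under addition, with finite complement. Its multiplicity is $m(\Lambda) = \min(\Lambda \setminus \{0\})$, its conductor $c(\Lambda)$ is the least $c \in \mathbb{N}_0$ with $c + \mathbb{N}_0 \subseteq \Lambda$, and its Frobenius number is $f(\Lambda) = c(\Lambda) - 1$. For $q \geq 1$, $c_q := \sqrt{\lfloor (q+2)^2/4 \rfloor}$. -}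

module Defs where

open import Level using (0ℓ) renaming (suc to lsuc)
open import Data.Fin.Base using (Fin)
open import Data.Integer.Base using (+_; -[1+_])
open import Data.List.Base using (List)
import Data.List.Membership.Propositional as List
open import Data.Nat.Base as ℕ using (ℕ; suc; NonZero)
import Data.Nat.DivMod as ℕ
open import Data.Product.Base using (Σ; _×_; ∃; ∃₂; proj₁)
open import Data.Rational.Base using (ℚ; mkℚ; 0ℚ; 1ℚ; _<_; _≤_; _+_; _-_; _*_; -_; _/_; +-*-rawSemiring)
open import Data.Sum.Base using (_⊎_)
open import Function.Bundles using (Inverse; _⇔_)
open import Relation.Binary.Bundles using (Setoid)
import Relation.Binary.Construct.On as On
open import Relation.Binary.PropositionalEquality.Core using (_≢_)
import Relation.Binary.PropositionalEquality.Properties as ≡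
open import Relation.Nullary.Negation.Core using (¬_)
open import Relation.Unary using (Pred; Decidable; _∈_; _∉_)
open import Relation.Unary.Relation.Binary.Equality using (≐-setoid)
open import Algebra.Definitions.RawSemiring +-*-rawSemiring using (_^_)

record NumericalSemigroup : Set₁ where
  field
    carrier           : Pred ℕ 0ℓ
    mem?              : Decidable carrier
    0-mem             : 0 ∈ carrier
    +-closed          : ∀ {x y} → x ∈ carrier → y ∈ carrier → x ℕ.+ y ∈ carrier
    finite-complement : ∃ λ (gaps : List ℕ) → ∀ {n} → n ∉ carrier → n List.∈ gaps

open NumericalSemigroup public using (carrier)

IsMultiplicity : NumericalSemigroup → ℕ → Set
IsMultiplicity Λ m =
  m ∈ carrier Λ × m ≢ 0 × (∀ n → n ∈ carrier Λ → n ≢ 0 → m ℕ.≤ n)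

IsConductor : NumericalSemigroup → ℕ → Set
IsConductor Λ c =
  (∀ n → c ℕ.+ n ∈ carrier Λ) ×
  (∀ c′ → (∀ n → c′ ℕ.+ n ∈ carrier Λ) → c ℕ.≤ c′)

-- f = c − 1.  The value f = −1, taken only by Λ = ℕ, is not represented.
IsFrobenius : NumericalSemigroup → ℕ → Set
IsFrobenius Λ f = IsConductor Λ (suc f)

-- Equality is extensional equality of the underlying subsets of ℕ.
semigroups : (f m : ℕ) → Setoid (lsuc 0ℓ) 0ℓ
semigroups f m = On.setoid (≐-setoid ℕ 0ℓ) underlying
  where
  underlying : (Σ NumericalSemigroup λ Λ → IsMultiplicity Λ m × IsFrobenius Λ f) → Pred ℕ 0ℓ
  underlying Λ = carrier (proj₁ Λ)

HasCardinality : Setoid (lsuc 0ℓ) 0ℓ → ℕ → Set₁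
HasCardinality S n = Inverse S (≡.setoid (Fin n))

-- Dedekind cuts: below x = { p ∣ p < x } and above x = { p ∣ x < p }.  The
-- operations are given on bare pairs of sets of rationals; IsReal singles out
-- the pairs that are real numbers.
record Cut : Set₁ where
  constructor mkCut
  field
    below : Pred ℚ 0ℓ
    above : Pred ℚ 0ℓ

open Cut public

record IsReal (x : Cut) : Set where
  field
    below-inhabited : ∃ λ p → p ∈ below x
    above-inhabited : ∃ λ p → p ∈ above x
    below-rounded   : ∀ p → p ∈ below x ⇔ (∃ λ p′ → p < p′ × p′ ∈ below x)
    above-rounded   : ∀ p → p ∈ above x ⇔ (∃ λ p′ → p′ < p × p′ ∈ above x)
    disjoint        : ∀ p → ¬ (p ∈ below x × p ∈ above x)
    located         : ∀ {p p′} → p < p′ → p ∈ below x ⊎ p′ ∈ above x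

record ℝ : Set₁ where
  constructor mkℝ
  field
    cut    : Cut
    isReal : IsReal cut

open ℝ public using (cut)

infix 4 _≃ᵣ_
_≃ᵣ_ : Cut → Cut → Set
x ≃ᵣ y = ∀ p → (p ∈ below x ⇔ p ∈ below y) × (p ∈ above x ⇔ p ∈ above y)

fromℚ : ℚ → Cut
fromℚ r = mkCut (λ p → p < r) (λ p → r < p)

fromℕ : ℕ → Cut
fromℕ n = fromℚ (+ n / 1)

infixl 6 _+ᵣ_
_+ᵣ_ : Cut → Cut → Cut
x +ᵣ y = mkCut
  (λ p → ∃₂ λ s t → s ∈ below x × t ∈ below y × p < s + t)
  (λ p → ∃₂ λ s t → s ∈ above x × t ∈ above y × s + t < p)

-- For s < x < s′ and t < y < t′ the product x y lies between the least and the
-- greatest of s t, s t′, s′ t, s′ t′.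
infixl 7 _*ᵣ_
_*ᵣ_ : Cut → Cut → Cut
x *ᵣ y = mkCut
  (λ p → ∃₂ λ s s′ → ∃₂ λ t t′ →
    s ∈ below x × s′ ∈ above x × t ∈ below y × t′ ∈ above y ×
    p < s * t × p < s * t′ × p < s′ * t × p < s′ * t′)
  (λ p → ∃₂ λ s s′ → ∃₂ λ t t′ →
    s ∈ below x × s′ ∈ above x × t ∈ below y × t′ ∈ above y ×
    s * t < p × s * t′ < p × s′ * t < p × s′ * t′ < p)

infixl 7 _÷ᵣ_
_÷ᵣ_ : Cut → (m : ℕ) .{{_ : NonZero m}} → Cut
x ÷ᵣ m = mkCut (λ p → p * (+ m / 1) ∈ below x) (λ p → p * (+ m / 1) ∈ above x)

√_ : ℕ → Cut
√ n = mkCut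
  (λ p → p < 0ℚ ⊎ p * p < + n / 1)
  (λ p → 0ℚ < p × + n / 1 < p * p)

∣_∣<_ : Cut → ℚ → Set
∣ x ∣< ε = (- ε) ∈ below x × ε ∈ above x

-- For rationals p, t > 0 and r = n/d:  p < t ^ r  iff  p ^ d < t ^ n.
BelowPow : (p t r : ℚ) → Set
BelowPow p t (mkℚ (+ n) d-1 _)    = p ^ suc d-1 < t ^ n
BelowPow p t (mkℚ -[1+ n ] d-1 _) = p ^ suc d-1 * t ^ suc n < 1ℚ

AbovePow : (p t r : ℚ) → Set
AbovePow p t (mkℚ (+ n) d-1 _)    = t ^ n < p ^ suc d-1
AbovePow p t (mkℚ -[1+ n ] d-1 _) = 1ℚ < p ^ suc d-1 * t ^ suc n

-- Rational exponent, x > 0.  Since t ↦ t ^ r is monotone on t > 0 (increasing or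
-- decreasing according to the sign of r), x ^ r lies between t ^ r and t′ ^ r
-- whenever 0 < t < x < t′.
infixr 8 _^ℚ_
_^ℚ_ : Cut → ℚ → Cut
x ^ℚ r = mkCut
  (λ p → p ≤ 0ℚ ⊎ (∃₂ λ t t′ →
    0ℚ < t × t ∈ below x × t′ ∈ above x × BelowPow p t r × BelowPow p t′ r))
  (λ p → 0ℚ < p × (∃₂ λ t t′ →
    0ℚ < t × t ∈ below x × t′ ∈ above x × AbovePow p t r × AbovePow p t′ r))

-- Real exponent, x > 0.  Since r ↦ x ^ r is monotone (increasing or decreasing
-- according to whether x ≥ 1 or x ≤ 1), x ^ y lies between x ^ r and x ^ r′
-- whenever r < y < r′.
infixr 8 _^ᵣ_
_^ᵣ_ : Cut → Cut → Cut
x ^ᵣ y = mkCut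
  (λ p → ∃₂ λ r r′ →
    r ∈ below y × r′ ∈ above y × p ∈ below (x ^ℚ r) × p ∈ below (x ^ℚ r′))
  (λ p → ∃₂ λ r r′ →
    r ∈ below y × r′ ∈ above y × p ∈ above (x ^ℚ r) × p ∈ above (x ^ℚ r′))

c : ℕ → Cut
c q = √ (((q ℕ.+ 2) ℕ.^ 2) ℕ./ 4)

Admissible : (q f m : ℕ) → Set
Admissible q f m = (q ℕ.∸ 1) ℕ.* m ℕ.< f × f ℕ.< q ℕ.* m

α : (q f m : ℕ) .{{_ : NonZero m}} → ℚ
α q f m = + f / m - + (q ℕ.∸ 1) / 1

growth : (q f m : ℕ) .{{_ : NonZero m}} → Cut
growth q f m = (c q ^ℚ α q f m) *ᵣ (c (q ℕ.∸ 1) ^ℚ (1ℚ - α q f m))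

{-# OPTIONS --safe #-}

-- A semigroup with multiplicity m and Frobenius number f = (q − 1) m + a is encoded by its Kunz
-- coordinates k : ℤ/m → ℕ, where k i · m + i is its least element congruent to i; they satisfy
-- k (i + j) ≤ k i + k j + carry.  Put A_h = ⌊(h + 2)² / 4⌋ and K = A_q ^ a · A_{q-1} ^ (m - a), so
-- that K is growth ^ (2 m).
--
-- Lower bound: the coordinates whose nonzero Apéry elements all exceed f / 2 can be chosen
-- independently, and pairing i with a - i shows that there are at least √K / C of them.
--
-- Upper bound (a container argument): let D consist of the d residues with the largest Apéry
-- elements.  Reveal coordinates one at a time as long as one of them sharpens at least e of the
-- lower bounds k (s - j) ≥ k s - k j - carry with s in D; the sum of the lower bounds limits the
-- number of steps.  Afterwards some s in D has only few bad pairs {i, s - i}, and on every other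
-- pair outside D the lower bounds add up to at least k s - carry, while both coordinates are at
-- most k s - carry.  So k lies in a box whose pairs of sides multiply to at most A_{k s} or
-- A_{k s - 1}, and with d = e² and e of order m ^ (1/3) there are only exp (o(m)) such boxes.
--
-- As growth ^ (2 m) is an integer, E = log_growth N - m is a logarithm of integers, and both
-- its cut and its comparison with ε m come down to comparing powers of integers.
module Submission where

-- Taken alone, the constraint that a pair of coordinates in 0..h adds up to at least h leaves a
-- triangle of (h + 1) (h + 2) / 2 values, which is too many. The containers replace the triangle by
-- a rectangle inside it: once the coordinates carry lower bounds that already add up to h, the two
-- sides add up to at most h + 2, and A_h is the largest possible product. The lower bound on the
-- count uses such a rectangle as well, with both lower ends about h / 2. Reflection meets every
-- pair twice, so both estimates concern the square of the number of semigroups; fixed points and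
-- representatives of pairs need no separate treatment. A certificate has d + t + 1 + y letters with
-- O(m) choices each. A total slack of at most q m, spent in portions of e, asks for t of order m /
-- e, and averaging over D asks for y of order m e / d. Equating y with m / e gives d = e², and
-- keeping d below m / e gives e = m ^ (1/3). The number of certificates then has a logarithm of
-- order m ^ (2/3) log m.

-- Finite sums and products, and multiplicities in lists

module FiniteSums where

  open import Data.Nat.Base
  open import Data.Nat.Properties
  open import Data.Nat.DivMod
  open import Data.Fin.Base using (Fin; toℕ; fromℕ<) renaming (zero to fzero; suc to fsuc)
  open import Data.Fin.Properties using (toℕ-injective; toℕ-fromℕ<; toℕ<n; toℕ≤n) renaming (_≟_ to _≟ᶠ_)
  open import Data.Fin.Permutation using (Permutation′; permutation)
  open import Data.List.Base using (List; []; _∷_; length; map; filter; tabulate)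
  open import Data.Nat.ListAction using (sum)
  open import Data.List.Membership.Propositional using (_∈_; _∉_)
  open import Data.List.Relation.Unary.Any using (here; there)
  open import Data.List.Relation.Unary.All as All using (All; []; _∷_)
  open import Data.List.Relation.Unary.AllPairs using ([]; _∷_)
  open import Data.List.Relation.Unary.Unique.Propositional using (Unique)
  open import Function.Base using (_∘_)
  open import Level using (Level)
  open import Relation.Binary.PropositionalEquality
  open import Relation.Nullary using (Dec; yes; no; ¬_; contradiction)
  open import Relation.Unary using (Pred; Decidable)
  import Algebra.Properties.CommutativeMonoid.Sum +-0-commutativeMonoid as S
  import Algebra.Properties.CommutativeMonoid.Sum *-1-commutativeMonoid as P

  private variable
    ℓ : Level
    n : ℕ

  ∑ : (Fin n → ℕ) → ℕ
  ∑ = S.sum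

  ∏ : (Fin n → ℕ) → ℕ
  ∏ = P.sum

  ∑-mono : {f g : Fin n → ℕ} → (∀ i → f i ≤ g i) → ∑ f ≤ ∑ g
  ∑-mono {zero}  f≤g = z≤n
  ∑-mono {suc n} f≤g = +-mono-≤ (f≤g fzero) (∑-mono (f≤g ∘ fsuc))

  ∏-mono : {f g : Fin n → ℕ} → (∀ i → f i ≤ g i) → ∏ f ≤ ∏ g
  ∏-mono {zero}  f≤g = ≤-refl
  ∏-mono {suc n} f≤g = *-mono-≤ (f≤g fzero) (∏-mono (f≤g ∘ fsuc))

  ∑-≤-const : {f : Fin n → ℕ} (b : ℕ) → (∀ i → f i ≤ b) → ∑ f ≤ n * b
  ∑-≤-const {zero}  b f≤b = z≤n
  ∑-≤-const {suc n} b f≤b = +-mono-≤ (f≤b fzero) (∑-≤-const b (f≤b ∘ fsuc))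

  ∏-^ : (b : ℕ) (f : Fin n → ℕ) → ∏ (λ i → b ^ f i) ≡ b ^ ∑ f
  ∏-^ {zero}  b f = refl
  ∏-^ {suc n} b f = trans (cong (b ^ f fzero *_) (∏-^ b (f ∘ fsuc)))
                          (sym (^-distribˡ-+-* b (f fzero) (∑ (f ∘ fsuc))))

  ∑-*-constʳ : (f : Fin n → ℕ) (b : ℕ) → ∑ (λ i → f i * b) ≡ ∑ f * b
  ∑-*-constʳ {zero}  f b = refl
  ∑-*-constʳ {suc n} f b = trans (cong (f fzero * b +_) (∑-*-constʳ (f ∘ fsuc) b))
                                 (sym (*-distribʳ-+ b (f fzero) (∑ (f ∘ fsuc))))

  ∑-zero : ∑ {n} (λ _ → 0) ≡ 0
  ∑-zero {n} = S.sum-replicate-zero n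

  ∑-≡0 : {f : Fin n → ℕ} → ∑ f ≡ 0 → ∀ i → f i ≡ 0
  ∑-≡0 {suc n} {f} eq fzero    = m+n≡0⇒m≡0 (f fzero) eq
  ∑-≡0 {suc n} {f} eq (fsuc i) = ∑-≡0 (m+n≡0⇒n≡0 (f fzero) eq) i

  ind : {A : Set ℓ} → Dec A → ℕ
  ind (yes _) = 1
  ind (no _)  = 0

  ind-yes : {A : Set ℓ} (d : Dec A) → A → ind d ≡ 1
  ind-yes (yes _) _ = refl
  ind-yes (no ¬a) a = contradiction a ¬a

  ind-no : {A : Set ℓ} (d : Dec A) → ¬ A → ind d ≡ 0
  ind-no (yes a) ¬a = contradiction a ¬a
  ind-no (no _)  _  = refl

  length-filter-tabulate : {A : Set} {P : Pred A ℓ} (P? : Decidable P) (f : Fin n → A) →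
    length (filter P? (tabulate f)) ≡ ∑ (λ i → ind (P? (f i)))
  length-filter-tabulate {n = zero}  P? f = refl
  length-filter-tabulate {n = suc n} P? f with P? (f fzero)
  ... | yes _ = cong suc (length-filter-tabulate P? (f ∘ fsuc))
  ... | no _  = length-filter-tabulate P? (f ∘ fsuc)

  -- Multiplicity instead of membership: multiplicities sum to exactly the length of the list, so
  -- lists that overlap or repeat entries can be counted without removing duplicates.
  occ : List (Fin n) → Fin n → ℕ
  occ []       i = 0
  occ (x ∷ xs) i = ind (i ≟ᶠ x) + occ xs i

  ∑-ind-* : (x : Fin n) (f : Fin n → ℕ) → ∑ (λ i → ind (i ≟ᶠ x) * f i) ≡ f x
  ∑-ind-* {suc n} fzero    f = trans (cong₂ _+_ (*-identityˡ (f fzero)) (∑-zero {n})) (+-identityʳ (f fzero))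
  ∑-ind-* {suc n} (fsuc x) f =
    trans (S.sum-cong-≗ {n} (λ i → cong (_* f (fsuc i)) (ind-suc i))) (∑-ind-* x (f ∘ fsuc))
    where
    ind-suc : ∀ i → ind (fsuc i ≟ᶠ fsuc x) ≡ ind (i ≟ᶠ x)
    ind-suc i with i ≟ᶠ x
    ... | yes _ = refl
    ... | no _  = refl

  ∑-occ-* : (xs : List (Fin n)) (f : Fin n → ℕ) → ∑ (λ i → occ xs i * f i) ≡ sum (map f xs)
  ∑-occ-* {n} []       f = ∑-zero {n}
  ∑-occ-* {n} (x ∷ xs) f = begin
    ∑ (λ i → (ind (i ≟ᶠ x) + occ xs i) * f i)
      ≡⟨ S.sum-cong-≗ {n} (λ i → *-distribʳ-+ (f i) (ind (i ≟ᶠ x)) (occ xs i)) ⟩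
    ∑ (λ i → ind (i ≟ᶠ x) * f i + occ xs i * f i)
      ≡⟨ S.∑-distrib-+ {n} _ _ ⟩
    ∑ (λ i → ind (i ≟ᶠ x) * f i) + ∑ (λ i → occ xs i * f i)
      ≡⟨ cong₂ _+_ (∑-ind-* x f) (∑-occ-* xs f) ⟩
    f x + sum (map f xs) ∎
    where open ≡-Reasoning

  ∑-occ : (xs : List (Fin n)) → ∑ (occ xs) ≡ length xs
  ∑-occ {n} xs = begin
    ∑ (occ xs)  ≡⟨ S.sum-cong-≗ {n} (λ i → sym (*-identityʳ (occ xs i))) ⟩
    ∑ (λ i → occ xs i * 1)  ≡⟨ ∑-occ-* xs (λ _ → 1) ⟩
    sum (map (λ _ → 1) xs)  ≡⟨ ones xs ⟩
    length xs  ∎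
    where
    open ≡-Reasoning
    ones : (ys : List (Fin n)) → sum (map (λ _ → 1) ys) ≡ length ys
    ones []       = refl
    ones (y ∷ ys) = cong suc (ones ys)

  occ-∈ : {xs : List (Fin n)} {i : Fin n} → i ∈ xs → 1 ≤ occ xs i
  occ-∈ {xs = x ∷ xs} {i} (here i≡x) rewrite ind-yes (i ≟ᶠ x) i≡x = s≤s z≤n
  occ-∈ {xs = x ∷ xs} {i} (there p)  = ≤-trans (occ-∈ p) (m≤n+m _ (ind (i ≟ᶠ x)))

  occ-∉ : {xs : List (Fin n)} {i : Fin n} → i ∉ xs → occ xs i ≡ 0
  occ-∉ {xs = []}     i∉ = refl
  occ-∉ {xs = x ∷ xs} {i} i∉ rewrite ind-no (i ≟ᶠ x) (i∉ ∘ here) = occ-∉ (i∉ ∘ there)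

  occ-≡0 : {xs : List (Fin n)} {i : Fin n} → occ xs i ≡ 0 → i ∉ xs
  occ-≡0 eq i∈ = contradiction (occ-∈ i∈) (<⇒≱ (s≤s (≤-reflexive eq)))

  occ-unique : {xs : List (Fin n)} → Unique xs → ∀ i → occ xs i ≤ 1
  occ-unique []         i = z≤n
  occ-unique {xs = x ∷ xs} (x∉ ∷ u) i with i ≟ᶠ x
  ... | yes refl = s≤s (≤-reflexive (occ-∉ (λ i∈ → All.lookup x∉ i∈ refl)))
  ... | no _     = occ-unique u i

  sum-unique-≤ : {xs : List (Fin n)} → Unique xs → (f : Fin n → ℕ) → sum (map f xs) ≤ ∑ f
  sum-unique-≤ {xs = xs} u f = ≤-trans (≤-reflexive (sym (∑-occ-* xs f)))
    (∑-mono (λ i → ≤-trans (*-monoˡ-≤ (f i) (occ-unique u i)) (≤-reflexive (*-identityˡ (f i)))))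

  -- Addition of residues modulo m, with carries

  module Cyclic (m : ℕ) .{{_ : NonZero m}} where

    infixl 6 _⊕_ _⊖_
    _⊕_ : Fin m → Fin m → Fin m
    i ⊕ j = fromℕ< (m%n<n (toℕ i + toℕ j) m)

    carry : Fin m → Fin m → ℕ
    carry i j = (toℕ i + toℕ j) / m

    _⊖_ : Fin m → Fin m → Fin m
    s ⊖ j = fromℕ< (m%n<n (toℕ s + (m ∸ toℕ j)) m)

    ⊕-carry : ∀ i j → toℕ i + toℕ j ≡ toℕ (i ⊕ j) + carry i j * m
    ⊕-carry i j = trans (m≡m%n+[m/n]*n (toℕ i + toℕ j) m)
      (cong (_+ carry i j * m) (sym (toℕ-fromℕ< (m%n<n (toℕ i + toℕ j) m))))

    ⊕-unique : ∀ i j s x → toℕ i + toℕ j ≡ toℕ s + x * m → i ⊕ j ≡ s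
    ⊕-unique i j s x eq = toℕ-injective (begin
      toℕ (i ⊕ j)  ≡⟨ toℕ-fromℕ< _ ⟩
      (toℕ i + toℕ j) % m  ≡⟨ cong (_% m) eq ⟩
      (toℕ s + x * m) % m  ≡⟨ [m+kn]%n≡m%n (toℕ s) x m ⟩
      toℕ s % m  ≡⟨ m<n⇒m%n≡m (toℕ<n s) ⟩
      toℕ s  ∎)
      where open ≡-Reasoning

    ⊕-comm : ∀ i j → i ⊕ j ≡ j ⊕ i
    ⊕-comm i j = ⊕-unique i j (j ⊕ i) (carry j i) (trans (+-comm (toℕ i) (toℕ j)) (⊕-carry j i))

    carry-comm : ∀ i j → carry i j ≡ carry j i
    carry-comm i j = cong (_/ m) (+-comm (toℕ i) (toℕ j))

    ⊖-⊕ : ∀ s j → (s ⊖ j) ⊕ j ≡ s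
    ⊖-⊕ s j = toℕ-injective (begin
      toℕ ((s ⊖ j) ⊕ j)  ≡⟨ toℕ-fromℕ< _ ⟩
      (toℕ (s ⊖ j) + toℕ j) % m  ≡⟨ cong (λ x → (x + toℕ j) % m) (toℕ-fromℕ< _) ⟩
      (x % m + toℕ j) % m  ≡⟨ %-distribˡ-+ (x % m) (toℕ j) m ⟩
      ((x % m) % m + toℕ j % m) % m  ≡⟨ cong (λ y → (y + toℕ j % m) % m) (m%n%n≡m%n x m) ⟩
      (x % m + toℕ j % m) % m  ≡⟨ %-distribˡ-+ x (toℕ j) m ⟨
      (x + toℕ j) % m  ≡⟨ cong (_% m) lem ⟩
      (toℕ s + 1 * m) % m  ≡⟨ [m+kn]%n≡m%n (toℕ s) 1 m ⟩
      toℕ s % m  ≡⟨ m<n⇒m%n≡m (toℕ<n s) ⟩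
      toℕ s  ∎)
      where
      open ≡-Reasoning
      x : ℕ
      x = toℕ s + (m ∸ toℕ j)
      lem : x + toℕ j ≡ toℕ s + 1 * m
      lem = trans (+-assoc (toℕ s) (m ∸ toℕ j) (toℕ j))
                  (cong (toℕ s +_) (trans (m∸n+n≡m (toℕ≤n j)) (sym (*-identityˡ m))))

    ⊕-⊖ : ∀ i j → (i ⊕ j) ⊖ j ≡ i
    ⊕-⊖ i j = toℕ-injective (begin
      toℕ ((i ⊕ j) ⊖ j)  ≡⟨ toℕ-fromℕ< _ ⟩
      (toℕ (i ⊕ j) + (m ∸ toℕ j)) % m  ≡⟨ cong (λ x → (x + (m ∸ toℕ j)) % m) (toℕ-fromℕ< _) ⟩
      (x % m + (m ∸ toℕ j)) % m  ≡⟨ %-distribˡ-+ (x % m) (m ∸ toℕ j) m ⟩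
      ((x % m) % m + (m ∸ toℕ j) % m) % m  ≡⟨ cong (λ y → (y + (m ∸ toℕ j) % m) % m) (m%n%n≡m%n x m) ⟩
      (x % m + (m ∸ toℕ j) % m) % m  ≡⟨ %-distribˡ-+ x (m ∸ toℕ j) m ⟨
      (x + (m ∸ toℕ j)) % m  ≡⟨ cong (_% m) lem ⟩
      (toℕ i + 1 * m) % m  ≡⟨ [m+kn]%n≡m%n (toℕ i) 1 m ⟩
      toℕ i % m  ≡⟨ m<n⇒m%n≡m (toℕ<n i) ⟩
      toℕ i  ∎)
      where
      open ≡-Reasoning
      x : ℕ
      x = toℕ i + toℕ j
      lem : x + (m ∸ toℕ j) ≡ toℕ i + 1 * m
      lem = trans (+-assoc (toℕ i) (toℕ j) (m ∸ toℕ j))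
                  (cong (toℕ i +_) (trans (m+[n∸m]≡n (toℕ≤n j)) (sym (*-identityˡ m))))

    ⊖-involutive : ∀ s i → s ⊖ (s ⊖ i) ≡ i
    ⊖-involutive s i = begin
      s ⊖ (s ⊖ i)  ≡⟨ cong (_⊖ (s ⊖ i)) (trans (sym (⊖-⊕ s i)) (⊕-comm (s ⊖ i) i)) ⟩
      (i ⊕ (s ⊖ i)) ⊖ (s ⊖ i)  ≡⟨ ⊕-⊖ i (s ⊖ i) ⟩
      i  ∎
      where open ≡-Reasoning

    reflection : Fin m → Permutation′ m
    reflection s = permutation (s ⊖_) (s ⊖_) (⊖-involutive s) (⊖-involutive s)

    translation : Fin m → Permutation′ m
    translation j = permutation (_⊖ j) (_⊕ j) (λ i → ⊕-⊖ i j) (λ s → ⊖-⊕ s j)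

    ∑-translate : ∀ j (f : Fin m → ℕ) → ∑ f ≡ ∑ (λ s → f (s ⊖ j))
    ∑-translate j f = S.∑-permute f (translation j)

    ∑-reflect : ∀ s (f : Fin m → ℕ) → ∑ f ≡ ∑ (λ i → f (s ⊖ i))
    ∑-reflect s f = S.∑-permute f (reflection s)

    -- Every unordered pair {i, s ⊖ i} contributes twice to both sides.
    ∏-reflect : ∀ s (f : Fin m → ℕ) → ∏ f * ∏ f ≡ ∏ (λ i → f i * f (s ⊖ i))
    ∏-reflect s f = trans (cong (∏ f *_) (P.∑-permute f (reflection s)))
                          (sym (P.∑-distrib-+ {m} f (λ i → f (s ⊖ i))))

    carry≤1 : ∀ i j → carry i j ≤ 1
    carry≤1 i j = ≤-pred (m<n*o⇒m/o<n {toℕ i + toℕ j} {2} {m}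
      (subst (toℕ i + toℕ j <_) (cong (m +_) (sym (+-identityʳ m))) (+-mono-< (toℕ<n i) (toℕ<n j))))

    -- Without a carry the sum `s` is at least each summand; a carry takes away `m`, more than the
    -- other summand. So the carry tells on which side of `s` the residue `i` lies.
    carry≡0⇒≤ : ∀ s i → carry (s ⊖ i) i ≡ 0 → toℕ i ≤ toℕ s
    carry≡0⇒≤ s i eq = ≤-trans (m≤n+m (toℕ i) (toℕ (s ⊖ i))) (≤-reflexive (begin
      toℕ (s ⊖ i) + toℕ i  ≡⟨ ⊕-carry (s ⊖ i) i ⟩
      toℕ ((s ⊖ i) ⊕ i) + carry (s ⊖ i) i * m  ≡⟨ cong₂ (λ x y → toℕ x + y * m) (⊖-⊕ s i) eq ⟩
      toℕ s + 0  ≡⟨ +-identityʳ (toℕ s) ⟩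
      toℕ s  ∎))
      where open ≡-Reasoning

    carry≡1⇒> : ∀ s i → carry (s ⊖ i) i ≡ 1 → toℕ s < toℕ i
    carry≡1⇒> s i eq = +-cancelʳ-< m (toℕ s) (toℕ i) (<-≤-trans (s≤s (≤-reflexive (begin
      toℕ s + m  ≡⟨ cong (toℕ s +_) (+-identityʳ m) ⟨
      toℕ s + 1 * m  ≡⟨ cong₂ (λ x y → toℕ x + y * m) (⊖-⊕ s i) eq ⟨
      toℕ ((s ⊖ i) ⊕ i) + carry (s ⊖ i) i * m  ≡⟨ ⊕-carry (s ⊖ i) i ⟨
      toℕ (s ⊖ i) + toℕ i  ≡⟨ +-comm (toℕ (s ⊖ i)) (toℕ i) ⟩
      toℕ i + toℕ (s ⊖ i)  ∎))) (+-monoʳ-< (toℕ i) (toℕ<n (s ⊖ i))))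
      where open ≡-Reasoning

-- Exhaustive lists of words and boxes, and their lengths

module Enumeration where

  open import Data.Nat.Base
  open import Data.Nat.Properties
  open import Data.Fin.Base using (Fin) renaming (zero to fzero; suc to fsuc)
  open import Data.List.Base using (List; []; _∷_; [_]; length; map; _++_; upTo; concatMap; cartesianProductWith)
  open import Data.List.Membership.Propositional using (_∈_; find)
  open import Data.List.Membership.Propositional.Properties
  open import Data.List.Properties using (length-map; length-++; length-upTo)
  open import Data.List.Relation.Unary.Any using (here; there)
  open import Data.List.Relation.Unary.All as All using (All; []; _∷_)
  open import Data.List.Relation.Unary.AllPairs using ([]; _∷_)
  open import Data.List.Relation.Unary.Unique.Propositional using (Unique)
  import Data.List.Relation.Unary.Unique.Propositional.Properties as Unique
  open import Data.Product.Base using (_×_; _,_; ∃)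
  open import Data.Sum.Base using (inj₁; inj₂)
  open import Data.Vec.Base using (Vec; []; _∷_; lookup)
  open import Data.Vec.Properties using (∷-injective)
  open import Function.Base using (_∘_)
  open import Level using (Level)
  open import Relation.Binary.PropositionalEquality hiding ([_])
  open import Relation.Nullary using (yes; no; contradiction)
  open import Relation.Unary using (Decidable)
  open FiniteSums using (∏)

  private variable
    a b c : Level
    A : Set a
    B : Set b
    C : Set c
    n : ℕ

  least : {P : ℕ → Set} → Decidable P → ∀ n → P n → ∃ λ x → P x × (∀ y → P y → x ≤ y)
  least P? zero    p = 0 , p , λ _ _ → z≤n
  least {P} P? (suc n) p with P? 0
  ... | yes p₀ = 0 , p₀ , λ _ _ → z≤n
  ... | no ¬p₀ with least (P? ∘ suc) n p
  ...   | x , px , min = suc x , px , min′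
    where
    min′ : ∀ y → P y → suc x ≤ y
    min′ zero    py = contradiction py ¬p₀
    min′ (suc y) py = s≤s (min y py)

  -- Induction removes one occurrence of the head from `ys`; uniqueness keeps the tail inside what
  -- remains.
  unique-⊆-length : {xs ys : List A} → Unique xs → (∀ {x} → x ∈ xs → x ∈ ys) → length xs ≤ length ys
  unique-⊆-length []       _  = z≤n
  unique-⊆-length {xs = x ∷ xs} {ys} (x∉ ∷ u) xs⊆ys with ∈-∃++ (xs⊆ys (here refl))
  ... | us , vs , refl = begin
    suc (length xs)  ≤⟨ s≤s (unique-⊆-length u rest) ⟩
    suc (length (us ++ vs))  ≡⟨ cong suc (length-++ us) ⟩
    suc (length us + length vs)  ≡⟨ +-suc (length us) (length vs) ⟨
    length us + suc (length vs)  ≡⟨ length-++ us ⟨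
    length (us ++ x ∷ vs)  ∎
    where
    open ≤-Reasoning
    rest : ∀ {y} → y ∈ xs → y ∈ us ++ vs
    rest y∈ with ∈-++⁻ us (xs⊆ys (there y∈))
    ... | inj₁ p           = ∈-++⁺ˡ p
    ... | inj₂ (here refl) = contradiction refl (All.lookup x∉ y∈)
    ... | inj₂ (there p)   = ∈-++⁺ʳ us p

  length-concatMap-≤ : (f : A → List B) (xs : List A) (v : ℕ) →
    (∀ {x} → x ∈ xs → length (f x) ≤ v) → length (concatMap f xs) ≤ length xs * v
  length-concatMap-≤ f []       v f≤v = z≤n
  length-concatMap-≤ f (x ∷ xs) v f≤v = begin
    length (f x ++ concatMap f xs)  ≡⟨ length-++ (f x) ⟩
    length (f x) + length (concatMap f xs)  ≤⟨ +-mono-≤ (f≤v (here refl)) (length-concatMap-≤ f xs v (f≤v ∘ there)) ⟩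
    v + length xs * v  ∎
    where open ≤-Reasoning

  ∈-concatMap-find : {f : A → List B} (xs : List A) {y : B} → y ∈ concatMap f xs → ∃ λ x → x ∈ xs × y ∈ f x
  ∈-concatMap-find {f = f} xs y∈ = find (∈-concatMap⁻ f {xs = xs} y∈)

  length-cartesianProductWith : (f : A → B → C) (xs : List A) (ys : List B) →
    length (cartesianProductWith f xs ys) ≡ length xs * length ys
  length-cartesianProductWith f []       ys = refl
  length-cartesianProductWith f (x ∷ xs) ys = begin
    length (map (f x) ys ++ cartesianProductWith f xs ys)  ≡⟨ length-++ (map (f x) ys) ⟩
    length (map (f x) ys) + length (cartesianProductWith f xs ys) ≡⟨ cong₂ _+_ (length-map (f x) ys) (length-cartesianProductWith f xs ys) ⟩
    length ys + length xs * length ys  ∎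
    where open ≡-Reasoning

  n<K^n : ∀ {K} → 2 ≤ K → ∀ n → n < K ^ n
  n<K^n 2≤K zero    = s≤s z≤n
  n<K^n {K} 2≤K (suc n) = begin-strict
    suc n  ≤⟨ n<K^n 2≤K n ⟩
    K ^ n  <⟨ m<m+n (K ^ n) (m^n>0 K {{>-nonZero (≤-trans (s≤s z≤n) 2≤K)}} n) ⟩
    K ^ n + K ^ n  ≡⟨ cong (K ^ n +_) (+-identityʳ (K ^ n)) ⟨
    2 * K ^ n  ≤⟨ *-monoˡ-≤ (K ^ n) 2≤K ⟩
    K * K ^ n  ∎
    where open ≤-Reasoning

  -- All lengths up to `l` are included, because the lists in a certificate may be shorter than
  -- their bounds. The empty word at each level is what raises the base in `length-words` to one
  -- more than the size of the alphabet.
  words : ℕ → List A → List (List A)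
  words zero    xs = [ [] ]
  words (suc l) xs = [] ∷ cartesianProductWith _∷_ xs (words l xs)

  ∈-words : ∀ {l} {xs : List A} {w} → length w ≤ l → All (_∈ xs) w → w ∈ words l xs
  ∈-words {l = zero}  {w = []}    _         _        = here refl
  ∈-words {l = suc l} {w = []}    _         _        = here refl
  ∈-words {l = suc l} {w = x ∷ w} (s≤s len) (x∈ ∷ p) = there (∈-cartesianProductWith⁺ _∷_ x∈ (∈-words len p))

  ∈-words⁻ : ∀ l {xs : List A} {w} → w ∈ words l xs → length w ≤ l
  ∈-words⁻ zero    (here refl) = z≤n
  ∈-words⁻ (suc l) (here refl) = z≤n
  ∈-words⁻ (suc l) {xs} (there w∈) with ∈-cartesianProductWith⁻ _∷_ xs (words l xs) w∈
  ... | _ , _ , _ , w′∈ , refl = s≤s (∈-words⁻ l w′∈)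

  length-words : ∀ l (xs : List A) → length (words l xs) ≤ suc (length xs) ^ l
  length-words zero    xs = ≤-refl
  length-words (suc l) xs = begin
    suc (length (cartesianProductWith _∷_ xs (words l xs)))  ≡⟨ cong suc (length-cartesianProductWith _∷_ xs (words l xs)) ⟩
    suc (length xs * length (words l xs))  ≤⟨ s≤s (*-monoʳ-≤ (length xs) (length-words l xs)) ⟩
    1 + length xs * suc (length xs) ^ l  ≤⟨ +-monoˡ-≤ _ (m^n>0 (suc (length xs)) l) ⟩
    suc (length xs) * suc (length xs) ^ l  ∎
    where open ≤-Reasoning

  range : ℕ → ℕ → List ℕ
  range lo hi = map (lo +_) (upTo (suc hi ∸ lo))

  length-range : ∀ lo hi → length (range lo hi) ≡ suc hi ∸ lo
  length-range lo hi = trans (length-map (lo +_) (upTo (suc hi ∸ lo))) (length-upTo (suc hi ∸ lo))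

  ∈-range⁺ : ∀ {lo hi x} → lo ≤ x → x ≤ hi → x ∈ range lo hi
  ∈-range⁺ {lo} {hi} {x} lo≤x x≤hi = subst (_∈ range lo hi) (m+[n∸m]≡n lo≤x)
    (∈-map⁺ (lo +_) (∈-upTo⁺ (∸-monoˡ-< (s≤s x≤hi) lo≤x)))

  ∈-range⁻ : ∀ {lo hi x} → x ∈ range lo hi → lo ≤ x × x ≤ hi
  ∈-range⁻ {lo} {hi} x∈ with ∈-map⁻ (lo +_) x∈
  ... | y , y∈ , refl = m≤m+n lo y ,
    ≤-pred (subst₂ _≤_ (+-suc lo y) (m+[n∸m]≡n lo≤) (+-monoʳ-≤ lo y<))
    where
    y< : y < suc hi ∸ lo
    y< = ∈-upTo⁻ y∈
    lo≤ : lo ≤ suc hi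
    lo≤ = <⇒≤ (m∸n≢0⇒n<m {suc hi} {lo} (λ eq → <⇒≱ y< (subst (_≤ y) (sym eq) z≤n)))

  -- Vectors instead of functions: pointwise equal vectors are equal, which the comparison of
  -- duplicate-free lists relies on.
  box : (lo hi : Fin n → ℕ) → List (Vec ℕ n)
  box {zero}  lo hi = [ [] ]
  box {suc n} lo hi = cartesianProductWith _∷_ (range (lo fzero) (hi fzero)) (box (lo ∘ fsuc) (hi ∘ fsuc))

  length-box : (lo hi : Fin n → ℕ) → length (box lo hi) ≡ ∏ (λ i → suc (hi i) ∸ lo i)
  length-box {zero}  lo hi = refl
  length-box {suc n} lo hi = trans
    (length-cartesianProductWith _∷_ (range (lo fzero) (hi fzero)) (box (lo ∘ fsuc) (hi ∘ fsuc)))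
    (cong₂ _*_ (length-range (lo fzero) (hi fzero)) (length-box (lo ∘ fsuc) (hi ∘ fsuc)))

  ∈-box⁺ : {lo hi : Fin n → ℕ} {v : Vec ℕ n} → (∀ i → lo i ≤ lookup v i) → (∀ i → lookup v i ≤ hi i) → v ∈ box lo hi
  ∈-box⁺ {v = []}    _   _   = here refl
  ∈-box⁺ {v = x ∷ v} lo≤ ≤hi = ∈-cartesianProductWith⁺ _∷_ (∈-range⁺ (lo≤ fzero) (≤hi fzero))
                                                           (∈-box⁺ (lo≤ ∘ fsuc) (≤hi ∘ fsuc))

  ∈-box⁻ : {lo hi : Fin n → ℕ} {v : Vec ℕ n} → v ∈ box lo hi → ∀ i → lo i ≤ lookup v i × lookup v i ≤ hi i
  ∈-box⁻ {suc n} {lo} {hi} v∈ i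
    with ∈-cartesianProductWith⁻ _∷_ (range (lo fzero) (hi fzero)) (box (lo ∘ fsuc) (hi ∘ fsuc)) v∈
  ∈-box⁻ {suc n} v∈ fzero    | x , w , x∈ , w∈ , refl = ∈-range⁻ x∈
  ∈-box⁻ {suc n} v∈ (fsuc i) | x , w , x∈ , w∈ , refl = ∈-box⁻ w∈ i

  box-unique : (lo hi : Fin n → ℕ) → Unique (box lo hi)
  box-unique {zero}  lo hi = [] ∷ []
  box-unique {suc n} lo hi = Unique.cartesianProductWith⁺ _∷_ ∷-injective
    (Unique.map⁺ (+-cancelˡ-≡ (lo fzero) _ _) (Unique.upTo⁺ (suc (hi fzero) ∸ lo fzero))) (box-unique (lo ∘ fsuc) (hi ∘ fsuc))

-- Upper bound: rectangles, peaks and averages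

module UpperBounds where

  open import Data.Nat.Base
  open import Data.Nat.Properties
  open import Data.Nat.DivMod
  open import Data.Nat.ListAction using (sum)
  open import Data.Nat.Tactic.RingSolver using (solve-∀)
  open import Data.Fin.Base using (Fin; toℕ)
  open import Data.Fin.Properties using (toℕ-injective; toℕ<n; all?; ¬∀⟶∃¬) renaming (_≟_ to _≟ᶠ_)
  open import Data.List.Base using (List; []; _∷_; length; map; _++_; filter; allFin; concatMap; cartesianProduct; upTo)
  open import Data.List.Extrema.Nat using (argmax; argmax-all; f[xs]≤f[argmax]; f[⊥]≤f[argmax])
  open import Data.List.Membership.Propositional using (_∈_; _∉_; lose)
  open import Data.List.Membership.Propositional.Properties
  open import Data.List.Properties using (length-map; length-++; length-tabulate; length-upTo; length-filter)
  open import Data.List.Relation.Unary.Any using (here; there)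
  open import Data.List.Relation.Unary.All as All using (All; []; _∷_)
  import Data.List.Relation.Unary.All.Properties as All
  open import Data.List.Relation.Unary.AllPairs using ([]; _∷_)
  open import Data.List.Relation.Unary.Unique.Propositional using (Unique)
  import Data.List.Relation.Unary.Unique.Propositional.Properties as Unique
  open import Data.Product.Base using (_×_; _,_; proj₁; proj₂; ∃)
  open import Data.Sum.Base using (inj₁; inj₂)
  open import Data.Vec.Base using (Vec; lookup)
  open import Function.Base using (_∘_; id)
  open import Relation.Binary.PropositionalEquality hiding ([_])
  open import Relation.Nullary using (Dec; yes; no; contradiction; ¬?)
  open import Relation.Unary using (Decidable)
  import Algebra.Properties.CommutativeMonoid.Sum +-0-commutativeMonoid as S
  import Algebra.Properties.CommutativeMonoid.Sum *-1-commutativeMonoid as P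
  open FiniteSums
  open Enumeration

  -- The square of c_h; also the largest product of two natural numbers whose sum is h + 2.
  pairs : ℕ → ℕ
  pairs h = ((h + 2) ^ 2) / 4

  pairs-mono : ∀ {h h′} → h ≤ h′ → pairs h ≤ pairs h′
  pairs-mono h≤h′ = /-monoˡ-≤ 4 (^-monoˡ-≤ 2 (+-monoˡ-≤ 2 h≤h′))

  pairs≤square : ∀ h → pairs h ≤ (h + 2) ^ 2
  pairs≤square h = m/n≤m ((h + 2) ^ 2) 4

  pairs>0 : ∀ h → 1 ≤ pairs h
  pairs>0 h = pairs-mono {0} {h} z≤n

  -- The two sides differ by the square of the difference; ordering `x` and `y` makes that
  -- difference a natural number.
  4xy≤[x+y]² : ∀ x y → x * y * 4 ≤ (x + y) ^ 2
  4xy≤[x+y]² x y with ≤-total x y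
  ... | inj₁ x≤y = subst (λ y → x * y * 4 ≤ (x + y) ^ 2) (m+[n∸m]≡n x≤y) (lem x (y ∸ x))
    where
    lem : ∀ x z → x * (x + z) * 4 ≤ (x + (x + z)) ^ 2
    lem x z = ≤-trans (m≤m+n _ (z * z)) (≤-reflexive (eq x z))
      where
      eq : ∀ x z → x * (x + z) * 4 + z * z ≡ (x + (x + z)) * ((x + (x + z)) * 1)
      eq = solve-∀
  ... | inj₂ y≤x = subst (λ x → x * y * 4 ≤ (x + y) ^ 2) (m+[n∸m]≡n y≤x) (lem y (x ∸ y))
    where
    lem : ∀ y z → (y + z) * y * 4 ≤ (y + z + y) ^ 2
    lem y z = ≤-trans (m≤m+n _ (z * z)) (≤-reflexive (eq y z))
      where
      eq : ∀ y z → (y + z) * y * 4 + z * z ≡ (y + z + y) * ((y + z + y) * 1)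
      eq = solve-∀

  -- The factors are the lengths of the intervals from `a` and from `b` up to `h`. They sum to 2 h +
  -- 2 - (a + b), at most h + 2, and the inequality of arithmetic and geometric means applies. An
  -- end beyond h + 1 makes its factor zero by truncation.
  interval-pair : ∀ h a b → h ≤ a + b → (suc h ∸ a) * (suc h ∸ b) ≤ pairs h
  interval-pair h a b h≤a+b with a ≤? suc h | b ≤? suc h
  ... | no a≰  | _      rewrite m≤n⇒m∸n≡0 (<⇒≤ (≰⇒> a≰)) = z≤n
  ... | yes _  | no b≰  rewrite m≤n⇒m∸n≡0 (<⇒≤ (≰⇒> b≰)) | *-zeroʳ (suc h ∸ a) = z≤n
  ... | yes a≤ | yes b≤ = subst (_≤ pairs h) (m*n/n≡m _ 4) (/-monoˡ-≤ 4
    (≤-trans (4xy≤[x+y]² (suc h ∸ a) (suc h ∸ b)) (^-monoˡ-≤ 2 sum≤)))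
    where
    open ≤-Reasoning
    regroup : ∀ x y a b → x + y + (a + b) ≡ (x + a) + (y + b)
    regroup = solve-∀
    twice : ∀ h → suc h + suc h ≡ (h + 2) + h
    twice = solve-∀
    sum≤ : (suc h ∸ a) + (suc h ∸ b) ≤ h + 2
    sum≤ = +-cancelʳ-≤ h _ _ (begin
      (suc h ∸ a) + (suc h ∸ b) + h  ≤⟨ +-monoʳ-≤ _ h≤a+b ⟩
      (suc h ∸ a) + (suc h ∸ b) + (a + b)  ≡⟨ regroup (suc h ∸ a) (suc h ∸ b) a b ⟩
      (suc h ∸ a + a) + (suc h ∸ b + b)  ≡⟨ cong₂ _+_ (m∸n+n≡m a≤) (m∸n+n≡m b≤) ⟩
      suc h + suc h  ≡⟨ twice h ⟩
      (h + 2) + h  ∎)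

  ∃-below-average : {A : Set} (y : A → ℕ) (x : A) (xs : List A) →
    ∃ λ s → s ∈ x ∷ xs × length (x ∷ xs) * y s ≤ sum (map y (x ∷ xs))
  ∃-below-average y x []        = x , here refl , ≤-refl
  ∃-below-average y x (x′ ∷ xs) with ∃-below-average y x′ xs
  ... | s , s∈ , le with y s ≤? y x
  ...   | yes ys≤ = s , there s∈ , +-mono-≤ ys≤ le
  ...   | no ys≰  = x , here refl , +-monoʳ-≤ (y x)
    (≤-trans (*-monoʳ-≤ (length (x′ ∷ xs)) (<⇒≤ (≰⇒> ys≰))) le)

  module _ {m : ℕ} where
    open import Data.List.Membership.DecPropositional (_≟ᶠ_ {m}) using (_∈?_)

    -- A maximiser of `w` on the complement is added `n` times; by counting, the complement is
    -- nonempty each time.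
    topSet : (w : Fin m → ℕ) (n : ℕ) → n ≤ m → ∃ λ (D : List (Fin m)) →
      Unique D × length D ≡ n × (∀ {s i} → s ∈ D → i ∉ D → w i ≤ w s)
    topSet w zero    _   = [] , [] , refl , λ ()
    topSet w (suc n) n<m with topSet w n (<⇒≤ n<m)
    ... | D , D! , refl , top with filter (λ i → ¬? (i ∈? D)) (allFin m) in eq
    ...   | [] = contradiction (subst (_≤ length D) (length-tabulate id) (unique-⊆-length (Unique.allFin⁺ m) all∈)) (<⇒≱ n<m)
      where
      all∈ : ∀ {i} → i ∈ allFin m → i ∈ D
      all∈ {i} _ with i ∈? D
      ... | yes i∈ = i∈
      ... | no i∉  with () ← subst (i ∈_) eq (∈-filter⁺ (λ i → ¬? (i ∈? D)) (∈-allFin i) i∉)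
    ...   | x ∷ xs = z ∷ D , All.tabulate (λ {y} y∈ z≡y → z∉ (subst (_∈ D) (sym z≡y) y∈)) ∷ D! , refl , top′
      where
      z : Fin m
      z = argmax w x xs
      rest : All (_∉ D) (x ∷ xs)
      rest = subst (All (_∉ D)) eq (All.all-filter (λ i → ¬? (i ∈? D)) (allFin m))
      z∉ : z ∉ D
      z∉ = argmax-all w (All.head rest) (All.tail rest)
      top′ : ∀ {s i} → s ∈ z ∷ D → i ∉ z ∷ D → w i ≤ w s
      top′ {i = i} (here refl) i∉ with subst (i ∈_) eq (∈-filter⁺ (λ i → ¬? (i ∈? D)) (∈-allFin i) (i∉ ∘ there))
      ... | here refl = f[⊥]≤f[argmax] {f = w} x xs
      ... | there i∈  = All.lookup (f[xs]≤f[argmax] {f = w} x xs) i∈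
      top′ (there s∈)  i∉ = top s∈ (i∉ ∘ there)

  ∏-threshold : ∀ n a (A B : ℕ) (f : Fin n → ℕ) → a ≤ n →
    (∀ i → toℕ i < a → f i ≡ A) → (∀ i → a ≤ toℕ i → f i ≡ B) → ∏ f ≡ A ^ a * B ^ (n ∸ a)
  ∏-threshold zero    zero    A B f _   _    _    = refl
  ∏-threshold (suc n) zero    A B f _   low  high = trans
    (cong₂ _*_ (high Fin.zero z≤n)
      (trans (∏-threshold n 0 A B (f ∘ Fin.suc) z≤n (λ _ ()) (λ i _ → high (Fin.suc i) z≤n)) (+-identityʳ (B ^ n))))
    (sym (+-identityʳ (B ^ suc n)))
  ∏-threshold (suc n) (suc a) A B f (s≤s a≤n) low high = trans
    (cong₂ _*_ (low Fin.zero (s≤s z≤n))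
      (∏-threshold n a A B (f ∘ Fin.suc) a≤n (λ i lt → low (Fin.suc i) (s≤s lt)) (λ i le → high (Fin.suc i) (s≤s le))))
    (sym (*-assoc A (A ^ a) (B ^ (n ∸ a))))

  -- Revealing coordinates and drawing the container

  module Containers (m : ℕ) .{{_ : NonZero m}} where

    open Cyclic m

    Revealed : Set
    Revealed = List (Fin m × ℕ)

    -- The default 0 keeps a table of values of `k` below `k` everywhere, and it makes residues
    -- outside the table inert: as `top` they force nothing and are never bad.
    table : Revealed → Fin m → ℕ
    table []            s = 0
    table ((s′ , u) ∷ D) s with s ≟ᶠ s′
    ... | yes _ = u
    ... | no _  = table D s

    -- The lower bound on k i that subadditivity forces once the values in T are known and k ≥ top.
    forced : (top : Fin m → ℕ) → Revealed → Fin m → ℕ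
    forced top []            i = 0
    forced top ((j , v) ∷ T) i = (top (i ⊕ j) ∸ (v + carry i j)) ⊔ forced top T i

    Subadditive : (Fin m → ℕ) → Set
    Subadditive k = ∀ i j → k (i ⊕ j) ≤ k i + k j + carry i j

    module Greedy (k top : Fin m → ℕ) (sub : Subadditive k) (top≤k : ∀ s → top s ≤ k s) where

      Correct : Revealed → Set
      Correct = All (λ (j , v) → v ≡ k j)

      step≤k : ∀ i j → top (i ⊕ j) ∸ (k j + carry i j) ≤ k i
      step≤k i j = m≤n+o⇒m∸o≤n _ _ (≤-trans (top≤k (i ⊕ j)) (≤-trans (sub i j) (≤-reflexive (+-assoc (k i) (k j) (carry i j)))))
        where
        m≤n+o⇒m∸o≤n : ∀ {m} n o → m ≤ n + o → m ∸ o ≤ n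
        m≤n+o⇒m∸o≤n {m} n o le = ≤-trans (∸-monoˡ-≤ o le) (≤-reflexive (m+n∸n≡m n o))

      forced≤k : ∀ {T} → Correct T → ∀ i → forced top T i ≤ k i
      forced≤k []                    i = z≤n
      forced≤k {(j , _) ∷ T} (refl ∷ ok) i = ⊔-lub (step≤k i j) (forced≤k ok i)

      -- In the bad case, revealing `k j` would sharpen the bound at `s ⊖ j`. In the other case the
      -- negated inequality is itself a lower bound for `k j`, obtained without revealing it.
      Bad : Revealed → Fin m → Fin m → Set
      Bad T j s = k j + carry (s ⊖ j) j + forced top T (s ⊖ j) < top s

      bad? : ∀ T j s → Dec (Bad T j s)
      bad? T j s = _ <? _

      slack : Revealed → Fin m → ℕ
      slack T i = k i ∸ forced top T i

      -- Each bad `s` raises the bound at `s ⊖ j` by at least one. Translation by `j` is a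
      -- bijection, so different `s` raise different coordinates and the gains add up.
      slack-drop : ∀ T j → ∑ (slack ((j , k j) ∷ T)) + ∑ (λ s → ind (bad? T j s)) ≤ ∑ (slack T)
      slack-drop T j = begin
        ∑ (slack T′) + ∑ (λ s → ind (bad? T j s))  ≡⟨ cong (_+ ∑ (λ s → ind (bad? T j s))) (∑-translate j (slack T′)) ⟩
        ∑ (λ s → slack T′ (s ⊖ j)) + ∑ (λ s → ind (bad? T j s)) ≡⟨ S.∑-distrib-+ {m} _ _ ⟨
        ∑ (λ s → slack T′ (s ⊖ j) + ind (bad? T j s))  ≤⟨ ∑-mono pointwise ⟩
        ∑ (λ s → slack T (s ⊖ j))  ≡⟨ ∑-translate j (slack T) ⟨
        ∑ (slack T)  ∎
        where
        open ≤-Reasoning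
        T′ : Revealed
        T′ = (j , k j) ∷ T
        -- The new bound `x` does not pass the true value `y`, so truncation does not swallow the
        -- gain.
        step : ∀ x y b → b < x → x ≤ y → y ∸ (x ⊔ b) + 1 ≤ y ∸ b
        step x (suc y) b b<x x≤y = begin
          suc y ∸ (x ⊔ b) + 1  ≤⟨ +-monoˡ-≤ 1 (∸-monoʳ-≤ (suc y) (≤-trans b<x (m≤m⊔n x b))) ⟩
          y ∸ b + 1  ≡⟨ +-comm (y ∸ b) 1 ⟩
          1 + (y ∸ b)  ≡⟨ +-∸-assoc 1 (≤-pred (≤-trans b<x x≤y)) ⟨
          suc y ∸ b  ∎
        step (suc x) zero b b<x ()
        pointwise : ∀ s → slack T′ (s ⊖ j) + ind (bad? T j s) ≤ slack T (s ⊖ j)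
        pointwise s with bad? T j s
        ... | no _ = ≤-trans (≤-reflexive (+-identityʳ _)) (∸-monoʳ-≤ (k (s ⊖ j)) (m≤n⊔m (top ((s ⊖ j) ⊕ j) ∸ (k j + carry (s ⊖ j) j)) (forced top T (s ⊖ j))))
        ... | yes bad = step _ (k (s ⊖ j)) _ lt (step≤k (s ⊖ j) j)
          where
          lt : forced top T (s ⊖ j) < top ((s ⊖ j) ⊕ j) ∸ (k j + carry (s ⊖ j) j)
          lt = subst (λ x → forced top T (s ⊖ j) < top x ∸ (k j + carry (s ⊖ j) j)) (sym (⊖-⊕ s j))
            (m+n≤o⇒n≤o∸m (k j + carry (s ⊖ j) j) (≤-trans (≤-reflexive (+-suc _ _)) bad))
            where
            m+n≤o⇒n≤o∸m : ∀ m {n o} → m + n ≤ o → n ≤ o ∸ m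
            m+n≤o⇒n≤o∸m m {n} le = ≤-trans (≤-reflexive (sym (m+n∸m≡n m n))) (∸-monoˡ-≤ m le)

      -- The total slack is a potential: revealing a `j` with more than `e` bad residues lowers it
      -- by at least `e`. When `n` reaches 0 the slack is zero, and by `slack-drop` nothing is bad
      -- any more.
      greedy : ∀ e n T → Correct T → ∑ (slack T) ≤ n * e →
        ∃ λ T′ → Correct T′ × length T′ ≤ n + length T × (∀ j → ∑ (λ s → ind (bad? T′ j s)) ≤ e)
      greedy e zero T ok le = T , ok , ≤-refl , λ j →
        ≤-trans (m≤n+m _ (∑ (slack ((j , k j) ∷ T)))) (≤-trans (slack-drop T j) (≤-trans le z≤n))
      greedy e (suc n) T ok le with all? (λ j → ∑ (λ s → ind (bad? T j s)) ≤? e)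
      ... | yes done = T , ok , m≤n+m (length T) (suc n) , done
      ... | no ¬done with ¬∀⟶∃¬ m _ (λ j → ∑ (λ s → ind (bad? T j s)) ≤? e) ¬done
      ...   | j , many with greedy e n ((j , k j) ∷ T) (refl ∷ ok) smaller
        where
        open ≤-Reasoning
        smaller : ∑ (slack ((j , k j) ∷ T)) ≤ n * e
        smaller = +-cancelʳ-≤ e _ _ (begin
          ∑ (slack ((j , k j) ∷ T)) + e  ≤⟨ +-monoʳ-≤ _ (<⇒≤ (≰⇒> many)) ⟩
          ∑ (slack ((j , k j) ∷ T)) + ∑ (λ s → ind (bad? T j s))  ≤⟨ slack-drop T j ⟩
          ∑ (slack T)  ≤⟨ le ⟩
          e + n * e  ≡⟨ +-comm e (n * e) ⟩
          n * e + e  ∎)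
      ...     | T′ , ok′ , len , done = T′ , ok′ , ≤-trans len (≤-reflexive (+-suc n (length T))) , done

      -- Double counting of the bad pairs (j, s): at most `e` for each `j`, hence `m * e` in all,
      -- and some element of the list has no more than the average.
      ∃-few-bad : ∀ e T x xs → Unique (x ∷ xs) → (∀ j → ∑ (λ s → ind (bad? T j s)) ≤ e) →
        ∃ λ s → s ∈ x ∷ xs × length (x ∷ xs) * ∑ (λ j → ind (bad? T j s)) ≤ m * e
      ∃-few-bad e T x xs D! few with ∃-below-average (λ s → ∑ (λ j → ind (bad? T j s))) x xs
      ... | s , s∈ , le = s , s∈ , (begin
        length (x ∷ xs) * y s  ≤⟨ le ⟩
        sum (map y (x ∷ xs))  ≤⟨ sum-unique-≤ D! y ⟩
        ∑ y  ≡⟨ S.∑-comm {m} {m} (λ s j → ind (bad? T j s)) ⟩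
        ∑ (λ j → ∑ (λ s → ind (bad? T j s)))  ≤⟨ ∑-≤-const e few ⟩
        m * e  ∎)
        where
        open ≤-Reasoning
        y : Fin m → ℕ
        y s = ∑ (λ j → ind (bad? T j s))

    -- The container depends on `k` only through these data: the values on D, the revealed values,
    -- the chosen s with its value, and the residues that remain bad for s. Counting certificates
    -- therefore bounds the number of containers.
    record Certificate : Set where
      constructor cert
      field
        peaks    : Revealed
        revealed : Revealed
        apex     : Fin m × ℕ
        excluded : List (Fin m)

    module Box (q : ℕ) (ct : Certificate) where
      open Certificate ct
      s = proj₁ apex
      u = proj₂ apex

      exceptional : List (Fin m)
      exceptional = map proj₁ peaks ++ excluded

      low : Fin m → ℕ
      low = forced (table peaks) revealed

      -- An exceptional coordinate ranges over 0..q. Any other `i` is not bad for `s`, which gives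
      -- the second lower bound, and lies outside D, where Apéry elements are at most that of `s`,
      -- which gives the upper bound.
      lower upper size : Fin m → ℕ
      lower i with occ exceptional i
      ... | zero  = low i ⊔ (u ∸ (carry (s ⊖ i) i + low (s ⊖ i)))
      ... | suc _ = 0
      upper i with occ exceptional i
      ... | zero  = u ∸ carry (s ⊖ i) i
      ... | suc _ = q
      size i = suc (upper i) ∸ lower i

      vectors : List (Vec ℕ m)
      vectors = box lower upper

      lower-ok : ∀ (k : Fin m → ℕ) i → (i ∉ exceptional → low i ≤ k i × u ∸ (carry (s ⊖ i) i + low (s ⊖ i)) ≤ k i) → lower i ≤ k i
      lower-ok k i h with occ exceptional i in eq
      ... | zero  = let p , r = h (occ-≡0 eq) in ⊔-lub p r
      ... | suc _ = z≤n

      upper-ok : ∀ (k : Fin m → ℕ) i → k i ≤ q → (i ∉ exceptional → k i ≤ u ∸ carry (s ⊖ i) i) → k i ≤ upper i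
      upper-ok k i k≤q h with occ exceptional i in eq
      ... | zero  = h (occ-≡0 eq)
      ... | suc _ = k≤q

      module _ (u≤q : u ≤ q) where

        upper≤q : ∀ i → upper i ≤ q
        upper≤q i with occ exceptional i
        ... | zero  = ≤-trans (m∸n≤m u (carry (s ⊖ i) i)) u≤q
        ... | suc _ = ≤-refl

        size≤ : ∀ i → size i ≤ q + 2
        size≤ i = begin
          suc (upper i) ∸ lower i  ≤⟨ m∸n≤m (suc (upper i)) (lower i) ⟩
          suc (upper i)  ≤⟨ s≤s (upper≤q i) ⟩
          1 + q  ≤⟨ n≤1+n _ ⟩
          2 + q  ≡⟨ +-comm 2 q ⟩
          q + 2  ∎
          where open ≤-Reasoning

        -- For an unexceptional pair both upper ends are `u` minus the carry and the lower ends add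
        -- up to at least that, so `interval-pair` applies. Otherwise both sides are at most q + 2,
        -- and one factor `(q + 2) ^ 2` pays for the pair.
        size-pair : ∀ i → size i * size (s ⊖ i) ≤
          pairs (u ∸ carry (s ⊖ i) i) * ((q + 2) ^ 2) ^ (occ exceptional i + occ exceptional (s ⊖ i))
        size-pair i with occ exceptional i + occ exceptional (s ⊖ i) in eq
        ... | suc x = begin
          size i * size (s ⊖ i)  ≤⟨ *-mono-≤ (size≤ i) (size≤ (s ⊖ i)) ⟩
          (q + 2) * (q + 2)  ≡⟨ cong ((q + 2) *_) (*-identityʳ (q + 2)) ⟨
          C  ≡⟨ *-identityʳ C ⟨
          C * 1  ≤⟨ *-monoʳ-≤ C (m^n>0 C {{m^n≢0 (q + 2) 2 {{q+2≢0}}}} x) ⟩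
          C * C ^ x  ≡⟨ *-identityˡ _ ⟨
          1 * C ^ suc x  ≤⟨ *-monoˡ-≤ (C ^ suc x) (pairs>0 (u ∸ carry (s ⊖ i) i)) ⟩
          pairs (u ∸ carry (s ⊖ i) i) * C ^ suc x  ∎
          where
          open ≤-Reasoning
          C : ℕ
          C = (q + 2) ^ 2
          q+2≢0 : NonZero (q + 2)
          q+2≢0 = >-nonZero (≤-trans (s≤s z≤n) (m≤n+m 2 q))
        ... | zero = ≤-trans pair (≤-reflexive (sym (*-identityʳ _)))
          where
          j : Fin m
          j = s ⊖ i
          h : ℕ
          h = u ∸ carry j i
          eqᵢ : occ exceptional i ≡ 0
          eqᵢ = m+n≡0⇒m≡0 _ eq
          eqⱼ : occ exceptional j ≡ 0
          eqⱼ = m+n≡0⇒n≡0 (occ exceptional i) eq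
          plain : ∀ x → occ exceptional x ≡ 0 → lower x ≡ low x ⊔ (u ∸ (carry (s ⊖ x) x + low (s ⊖ x))) × upper x ≡ u ∸ carry (s ⊖ x) x
          plain x eq rewrite eq = refl , refl
          cj : carry (s ⊖ j) j ≡ carry j i
          cj = trans (cong (λ x → carry x j) (⊖-involutive s i)) (carry-comm i j)
          reflected : Fin m → ℕ
          reflected x = u ∸ (carry (s ⊖ x) x + low (s ⊖ x))
          -- The reflected bound at `j` is `h` minus the low bound at `i`, so these two alone
          -- already add up to `h`.
          lowers : h ≤ lower i + lower j
          lowers = begin
            h  ≡⟨ cong (u ∸_) (sym cj) ⟩
            u ∸ carry (s ⊖ j) j  ≤⟨ m≤n+m∸n _ (low i) ⟩
            low i + (u ∸ carry (s ⊖ j) j ∸ low i)  ≡⟨ cong (low i +_) (∸-+-assoc u (carry (s ⊖ j) j) (low i)) ⟩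
            low i + (u ∸ (carry (s ⊖ j) j + low i))  ≡⟨ cong (λ x → low i + (u ∸ (carry (s ⊖ j) j + low x))) (⊖-involutive s i) ⟨
            low i + (u ∸ (carry (s ⊖ j) j + low (s ⊖ j)))  ≤⟨ +-mono-≤ (m≤m⊔n (low i) (reflected i)) (m≤n⊔m (low j) (reflected j)) ⟩
            (low i ⊔ reflected i) + (low j ⊔ reflected j)  ≡⟨ cong₂ _+_ (proj₁ (plain i eqᵢ)) (proj₁ (plain j eqⱼ)) ⟨
            lower i + lower j  ∎
            where open ≤-Reasoning
          pair : size i * size j ≤ pairs h
          pair rewrite proj₂ (plain i eqᵢ) | proj₂ (plain j eqⱼ) | cj = interval-pair h (lower i) (lower j) lowers

  -- Only squares of box sizes are bounded, and no square root is available in ℕ; comparing every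
  -- list with a longest one lets the square pass through the sum.
  length-concatMap-² : {A B : Set} (f : A → List B) (xs : List A) (v : ℕ) →
    (∀ {x} → x ∈ xs → length (f x) * length (f x) ≤ v) →
    length (concatMap f xs) * length (concatMap f xs) ≤ length xs * length xs * v
  length-concatMap-² f []       v _   = z≤n
  length-concatMap-² f (x ∷ xs) v f≤v = begin
    length (concatMap f (x ∷ xs)) * length (concatMap f (x ∷ xs))
      ≤⟨ *-mono-≤ total total ⟩
    (length (x ∷ xs) * l) * (length (x ∷ xs) * l)
      ≡⟨ [m*n]*[o*p]≡[m*o]*[n*p] (length (x ∷ xs)) l (length (x ∷ xs)) l ⟩
    length (x ∷ xs) * length (x ∷ xs) * (l * l)
      ≤⟨ *-monoʳ-≤ (length (x ∷ xs) * length (x ∷ xs)) (argmax-all (length ∘ f) {P = λ x → length (f x) * length (f x) ≤ v} (f≤v (here refl)) (All.tabulate (f≤v ∘ there))) ⟩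
    length (x ∷ xs) * length (x ∷ xs) * v ∎
    where
    open ≤-Reasoning
    l : ℕ
    l = length (f (argmax (length ∘ f) x xs))
    max : ∀ {y} → y ∈ x ∷ xs → length (f y) ≤ l
    max (here refl) = f[⊥]≤f[argmax] {f = length ∘ f} x xs
    max (there y∈)  = All.lookup (f[xs]≤f[argmax] {f = length ∘ f} x xs) y∈
    total : length (concatMap f (x ∷ xs)) ≤ length (x ∷ xs) * l
    total = length-concatMap-≤ f (x ∷ xs) l max

  -- Volume of a container, number of containers, covering

  module UpperBound (m : ℕ) .{{_ : NonZero m}} (q : ℕ) (a : Fin m) where

    open Cyclic m
    open Containers m

    -- The strict comparison puts exactly `toℕ a` residues, 0 included, on the side of `pairs q`, so
    -- that the product of all weights is K.
    weight : Fin m → ℕ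
    weight i with toℕ i <? toℕ a
    ... | yes _ = pairs q
    ... | no _  = pairs (q ∸ 1)

    C : ℕ
    C = (q + 2) ^ 2

    C>0 : 1 ≤ C
    C>0 = ≤-trans (pairs>0 q) (pairs≤square q)

    -- The bounds that hold at every residue because no Apéry element exceeds f + m. They are
    -- imposed on certificates so that every listed container is small, also one that comes from no
    -- semigroup.
    Apex : Fin m × ℕ → Set
    Apex (s , u) = u ≤ q × (toℕ a < toℕ s → u < q)

    apex? : Decidable Apex
    apex? (s , u) with u ≤? q | toℕ a <? toℕ s | u <? q
    ... | no u≰q  | _      | _       = no (u≰q ∘ proj₁)
    ... | yes u≤q | no a≮s | _       = yes (u≤q , λ a<s → contradiction a<s a≮s)
    ... | yes u≤q | yes _  | yes u<q = yes (u≤q , λ _ → u<q)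
    ... | yes _   | yes lt | no u≮q  = no (λ p → u≮q (proj₂ p lt))

    -- For `i` above `a` the argument is at most q - 1 for one of two reasons: `s` lies above `a`,
    -- so u < q; or s ≤ a < i, so the carry is 1. At `i = a` both may fail although the weight is
    -- `pairs (q ∸ 1)`, and a factor `C` compensates.
    pairs≤weight : ∀ s u → Apex (s , u) → ∀ i → pairs (u ∸ carry (s ⊖ i) i) ≤ weight i * C ^ occ (a ∷ []) i
    pairs≤weight s u (u≤q , u<q) i with toℕ i <? toℕ a
    ... | yes i<a = ≤-trans (pairs-mono (≤-trans (m∸n≤m u (carry (s ⊖ i) i)) u≤q)) (m≤m*n (pairs q) _ {{>-nonZero (m^n>0 C {{>-nonZero C>0}} (occ (a ∷ []) i))}})
    ... | no i≮a with i ≟ᶠ a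
    ...   | yes refl = ≤-trans (pairs-mono (≤-trans (m∸n≤m u (carry (s ⊖ i) i)) u≤q))
        (≤-trans (pairs≤square q) (≤-trans (≤-reflexive (sym (*-identityʳ C))) (m≤n*m (C ^ 1) (pairs (q ∸ 1)) {{>-nonZero (pairs>0 (q ∸ 1))}})))
    ...   | no i≢a = ≤-trans (pairs-mono le) (≤-reflexive (sym (*-identityʳ (pairs (q ∸ 1)))))
      where
      a<i : toℕ a < toℕ i
      a<i = ≤∧≢⇒< (≮⇒≥ i≮a) (λ eq → i≢a (sym (toℕ-injective eq)))
      le : u ∸ carry (s ⊖ i) i ≤ q ∸ 1
      le with toℕ a <? toℕ s | carry (s ⊖ i) i in eq | carry≤1 (s ⊖ i) i
      ... | yes a<s | c    | _ = ≤-trans (m∸n≤m u c) (∸-monoˡ-≤ 1 (u<q a<s))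
      ... | no a≮s  | zero | _ = contradiction (<-≤-trans a<i (carry≡0⇒≤ s i eq)) a≮s
      ... | no a≮s  | suc zero | _ = ∸-monoˡ-≤ 1 u≤q
      ... | no _    | suc (suc _) | s≤s ()

    -- Each exceptional entry is charged at its own residue and at the reflected one, and `a` is
    -- charged once by `pairs≤weight`: hence the exponent `l + l + 1`.
    volume : (ct : Certificate) → Apex (Certificate.apex ct) →
      let l = length (Box.exceptional q ct) in
      length (Box.vectors q ct) * length (Box.vectors q ct) ≤ ∏ weight * C ^ (l + l + 1)
    volume ct ap = begin
      length vectors * length vectors  ≡⟨ cong₂ _*_ (length-box lower upper) (length-box lower upper) ⟩
      ∏ size * ∏ size  ≡⟨ ∏-reflect s size ⟩
      ∏ (λ i → size i * size (s ⊖ i))  ≤⟨ ∏-mono pointwise ⟩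
      ∏ (λ i → weight i * C ^ g i)  ≡⟨ P.∑-distrib-+ {m} weight (λ i → C ^ g i) ⟩
      ∏ weight * ∏ (λ i → C ^ g i)  ≡⟨ cong (∏ weight *_) (∏-^ C g) ⟩
      ∏ weight * C ^ ∑ g  ≡⟨ cong (λ x → ∏ weight * C ^ x) ∑g ⟩
      ∏ weight * C ^ (l + l + 1)  ∎
      where
      open ≤-Reasoning
      open Certificate ct
      open Box q ct
      l : ℕ
      l = length exceptional
      g₁ g : Fin m → ℕ
      g₁ i = occ exceptional i + occ exceptional (s ⊖ i)
      g i = g₁ i + occ (a ∷ []) i
      ∑g : ∑ g ≡ l + l + 1
      ∑g = trans (S.∑-distrib-+ {m} g₁ (occ (a ∷ [])))
        (cong₂ _+_ (trans (S.∑-distrib-+ {m} (occ exceptional) (λ i → occ exceptional (s ⊖ i)))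
          (cong₂ _+_ (∑-occ exceptional) (trans (sym (∑-reflect s (occ exceptional))) (∑-occ exceptional)))) (∑-occ (a ∷ [])))
      regroup : ∀ w x y → w * x * y ≡ w * (y * x)
      regroup = solve-∀
      pointwise : ∀ i → size i * size (s ⊖ i) ≤ weight i * C ^ g i
      pointwise i = begin
        size i * size (s ⊖ i)  ≤⟨ size-pair (proj₁ ap) i ⟩
        pairs (u ∸ carry (s ⊖ i) i) * C ^ g₁ i  ≤⟨ *-monoˡ-≤ (C ^ g₁ i) (pairs≤weight s u ap i) ⟩
        weight i * C ^ occ (a ∷ []) i * C ^ g₁ i  ≡⟨ regroup (weight i) (C ^ occ (a ∷ []) i) (C ^ g₁ i) ⟩
        weight i * (C ^ g₁ i * C ^ occ (a ∷ []) i)  ≡⟨ cong (weight i *_) (^-distribˡ-+-* C (g₁ i) (occ (a ∷ []) i)) ⟨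
        weight i * C ^ g i  ∎

    module _ (k : Fin m → ℕ) where

      label : List (Fin m) → Revealed
      label = map (λ s → s , k s)

      table-∈ : ∀ {s} D → s ∈ D → table (label D) s ≡ k s
      table-∈ {s} (s′ ∷ D) s∈ with s ≟ᶠ s′
      ... | yes refl = refl
      table-∈ {s} (s′ ∷ D) (here eq)  | no s≢ = contradiction eq s≢
      table-∈ {s} (s′ ∷ D) (there s∈) | no _  = table-∈ D s∈

      table≤ : ∀ D s → table (label D) s ≤ k s
      table≤ []       s = z≤n
      table≤ (s′ ∷ D) s with s ≟ᶠ s′
      ... | yes refl = ≤-refl
      ... | no _     = table≤ D s

      apery : Fin m → ℕ
      apery i = k i * m + toℕ i

      apery-≤ : ∀ i s → apery i ≤ apery s → k i ≤ k s
      apery-≤ i s le = ≮⇒≥ λ ks<ki → <⇒≱ (begin-strict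
        k s * m + toℕ s  <⟨ +-monoʳ-< (k s * m) (toℕ<n s) ⟩
        k s * m + m  ≡⟨ +-comm (k s * m) m ⟩
        suc (k s) * m  ≤⟨ *-monoˡ-≤ m ks<ki ⟩
        k i * m  ≤⟨ m≤m+n (k i * m) (toℕ i) ⟩
        apery i  ∎) le
        where open ≤-Reasoning

      apery-< : ∀ i s → apery i ≤ apery s → toℕ s < toℕ i → k i < k s
      apery-< i s le s<i = ≰⇒> λ ks≤ki → <⇒≱ (+-mono-≤-< (*-monoˡ-≤ m ks≤ki) s<i) le

      -- The carry is 1 only if `i` exceeds `s` as a number; then the Apéry element of `i` can be
      -- the smaller one only with a strictly smaller coordinate.
      apery-carry : ∀ i s → apery i ≤ apery s → k i ≤ k s ∸ carry (s ⊖ i) i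
      apery-carry i s le with carry (s ⊖ i) i in eq | carry≤1 (s ⊖ i) i
      ... | zero         | _       = apery-≤ i s le
      ... | suc zero     | _       = ∸-monoˡ-≤ 1 (apery-< i s le (carry≡1⇒> s i eq))
      ... | suc (suc _)  | s≤s ()

    alphabet : Revealed
    alphabet = cartesianProduct (allFin m) (upTo (suc q))

    module Covering (e d t y : ℕ) (1≤d : 1 ≤ d) (d≤m : d ≤ m) (qm≤te : m * q ≤ t * e) (me≤dy : m * e ≤ d * y) where

      certificates : List Certificate
      certificates = concatMap (λ D → concatMap (λ T → concatMap (λ p → map (cert D T p) (words y (allFin m)))
        (filter apex? alphabet)) (words t alphabet)) (words d alphabet)

      Z : ℕ
      Z = suc (m * suc q)

      length-alphabet : length alphabet ≡ m * suc q
      length-alphabet = trans (length-cartesianProductWith _,_ (allFin m) (upTo (suc q)))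
        (cong₂ _*_ (length-tabulate {n = m} id) (length-upTo (suc q)))

      length-words-alphabet : ∀ l → length (words l alphabet) ≤ Z ^ l
      length-words-alphabet l = subst (λ z → length (words l alphabet) ≤ suc z ^ l) length-alphabet (length-words l alphabet)

      length-certificates : length certificates ≤ Z ^ (d + (t + (1 + y)))
      length-certificates = begin
        length certificates  ≤⟨ length-concatMap-≤ _ (words d alphabet) (Z ^ (t + (1 + y))) (λ {D} _ →
           ≤-trans (length-concatMap-≤ _ (words t alphabet) (Z ^ (1 + y)) (λ {T} _ →
           ≤-trans (length-concatMap-≤ _ (filter apex? alphabet) (Z ^ y) (λ {p} _ →
             ≤-trans (≤-reflexive (length-map (cert D T p) (words y (allFin m)))) excl))
           (*-monoˡ-≤ (Z ^ y) (≤-trans (length-filter apex? alphabet) (≤-trans (≤-reflexive length-alphabet) (n≤1+n _))))))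
           (≤-trans (*-monoˡ-≤ _ (length-words-alphabet t)) (≤-reflexive (sym (^-distribˡ-+-* Z t (1 + y)))))) ⟩
        length (words d alphabet) * Z ^ (t + (1 + y))  ≤⟨ *-monoˡ-≤ _ (length-words-alphabet d) ⟩
        Z ^ d * Z ^ (t + (1 + y))  ≡⟨ ^-distribˡ-+-* Z d (t + (1 + y)) ⟨
        Z ^ (d + (t + (1 + y)))  ∎
        where
        open ≤-Reasoning
        excl : length (words y (allFin m)) ≤ Z ^ y
        excl = ≤-trans (length-words y (allFin m)) (^-monoˡ-≤ y (s≤s (≤-trans (≤-reflexive (length-tabulate {n = m} id)) (m≤m*n m (suc q)))))

      certificates⁻ : ∀ {ct} → ct ∈ certificates → Apex (Certificate.apex ct) ×
        length (Certificate.peaks ct) ≤ d × length (Certificate.excluded ct) ≤ y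
      certificates⁻ ct∈
        with D , D∈ , ct∈₁ ← ∈-concatMap-find (words d alphabet) ct∈
        with T , _  , ct∈₂ ← ∈-concatMap-find (words t alphabet) ct∈₁
        with p , p∈ , ct∈₃ ← ∈-concatMap-find (filter apex? alphabet) ct∈₂
        with X , X∈ , refl ← ∈-map⁻ (cert D T p) ct∈₃
        = proj₂ (∈-filter⁻ apex? {xs = alphabet} p∈) , ∈-words⁻ d D∈ , ∈-words⁻ y X∈

      certificates⁺ : ∀ D T p X → length D ≤ d → All (_∈ alphabet) D → length T ≤ t → All (_∈ alphabet) T →
        p ∈ alphabet → Apex p → length X ≤ y → cert D T p X ∈ certificates
      certificates⁺ D T p X D≤d D∈ T≤t T∈ p∈ ap X≤y =
        ∈-concatMap⁺ _ (lose (∈-words D≤d D∈) (∈-concatMap⁺ _ (lose (∈-words T≤t T∈)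
          (∈-concatMap⁺ _ (lose (∈-filter⁺ apex? p∈ ap) (∈-map⁺ (cert D T p)
            (∈-words X≤y (All.tabulate (λ {x} _ → ∈-allFin x)))))))))

      -- The largest Apéry elements serve twice: their values drive the greedy sharpening, and
      -- whichever s in D turns out to have few bad residues, its Apéry element dominates all those
      -- outside D.
      covered : (v : Vec ℕ m) → let k = lookup v in
        Subadditive k → (∀ i → k i ≤ q) → (∀ i → toℕ a < toℕ i → k i < q) →
        v ∈ concatMap (Box.vectors q) certificates
      covered v sub k≤q k<q with topSet (apery (lookup v)) d d≤m
      ... | [] , _ , refl , _ = contradiction 1≤d λ ()
      ... | x ∷ xs , D! , refl , peak
        -- Before anything is revealed the slack is the sum of all coordinates, at most m q ≤ t e.
        with greedy e t [] [] (≤-trans (∑-≤-const q (λ i → ≤-trans (m∸n≤m (lookup v i) 0) (k≤q i))) qm≤te)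
        where open Greedy (lookup v) (table (label (lookup v) (x ∷ xs))) sub (table≤ (lookup v) (x ∷ xs))
      ...   | T , T-ok , T≤t , few with Greedy.∃-few-bad (lookup v) (table (label (lookup v) (x ∷ xs))) sub (table≤ (lookup v) (x ∷ xs)) e T x xs D! few
      ...     | s , s∈ , few-bad = ∈-concatMap⁺ (Box.vectors q) (lose ct∈ v∈)
        where
        k : Fin m → ℕ
        k = lookup v
        D : List (Fin m)
        D = x ∷ xs
        open Greedy k (table (label k D)) sub (table≤ k D)
        X : List (Fin m)
        X = filter (λ j → bad? T j s) (allFin m)
        X≤y : length X ≤ y
        X≤y = *-cancelˡ-≤ (length D) (≤-trans (≤-reflexive (cong (length D *_) (length-filter-tabulate (λ j → bad? T j s) id)))
          (≤-trans few-bad me≤dy))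
        ct : Certificate
        ct = cert (label k D) T (s , k s) X
        entry : ∀ i → (i , k i) ∈ alphabet
        entry i = ∈-cartesianProduct⁺ (∈-allFin i) (∈-upTo⁺ (s≤s (k≤q i)))
        ct∈ : ct ∈ certificates
        ct∈ = certificates⁺ (label k D) T (s , k s) X (≤-reflexive (length-map _ D))
          (All.map⁺ (All.tabulate (λ {i} _ → entry i)))
          (≤-trans T≤t (≤-reflexive (+-identityʳ t)))
          (All.map (λ { {j , _} refl → entry j }) T-ok)
          (entry s) (k≤q s , k<q s) X≤y
        open Box q ct using (vectors; exceptional; low; lower-ok; upper-ok)
        ∉D : ∀ {i} → i ∉ exceptional → i ∉ D
        ∉D i∉ i∈ = i∉ (∈-++⁺ˡ (∈-map⁺ proj₁ (∈-map⁺ (λ s → s , k s) i∈)))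
        -- `X` collects all residues that are bad for `s`, and the table has the true value at `s`
        -- because `s` lies in `D`.
        good : ∀ {i} → i ∉ exceptional → k s ≤ k i + (carry (s ⊖ i) i + low (s ⊖ i))
        good {i} i∉ = ≤-trans (≮⇒≥ λ bad → i∉ (∈-++⁺ʳ (map proj₁ (label k D)) (∈-filter⁺ (λ j → bad? T j s) (∈-allFin i)
          (≤-trans bad (≤-reflexive (sym (table-∈ k D s∈))))))) (≤-reflexive (+-assoc (k i) (carry (s ⊖ i) i) (low (s ⊖ i))))
        v∈ : v ∈ vectors
        v∈ = ∈-box⁺
          (λ i → lower-ok k i λ i∉ → forced≤k T-ok i , ≤-trans (∸-monoˡ-≤ (carry (s ⊖ i) i + low (s ⊖ i)) (good i∉)) (≤-reflexive (m+n∸n≡m (k i) (carry (s ⊖ i) i + low (s ⊖ i)))))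
          (λ i → upper-ok k i (k≤q i) λ i∉ → apery-carry k i s (peak s∈ (∉D i∉)))

      upper-bound : (L : List (Vec ℕ m)) → Unique L →
        (∀ {v} → v ∈ L → Subadditive (lookup v) × (∀ i → lookup v i ≤ q) × (∀ i → toℕ a < toℕ i → lookup v i < q)) →
        length L * length L ≤ Z ^ (d + (t + (1 + y))) * Z ^ (d + (t + (1 + y))) * (∏ weight * C ^ ((d + y) + (d + y) + 1))
      upper-bound L L! props = begin
        length L * length L
          ≤⟨ *-mono-≤ cover cover ⟩
        length boxes * length boxes
          ≤⟨ length-concatMap-² (Box.vectors q) certificates _ vol ⟩
        length certificates * length certificates * (∏ weight * C ^ ((d + y) + (d + y) + 1))
          ≤⟨ *-monoˡ-≤ _ (*-mono-≤ length-certificates length-certificates) ⟩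
        Z ^ (d + (t + (1 + y))) * Z ^ (d + (t + (1 + y))) * (∏ weight * C ^ ((d + y) + (d + y) + 1)) ∎
        where
        open ≤-Reasoning
        boxes : List (Vec ℕ m)
        boxes = concatMap (Box.vectors q) certificates
        cover : length L ≤ length boxes
        cover = unique-⊆-length L! λ {v} v∈ → let sub , k≤q , k<q = props v∈ in covered v sub k≤q k<q
        vol : ∀ {ct} → ct ∈ certificates → length (Box.vectors q ct) * length (Box.vectors q ct) ≤ ∏ weight * C ^ ((d + y) + (d + y) + 1)
        vol {ct} ct∈ = let ap , D≤ , X≤ = certificates⁻ ct∈ ; exc = exc≤ D≤ X≤ in
          ≤-trans (volume ct ap) (*-monoʳ-≤ (∏ weight) (^-monoʳ-≤ C {{>-nonZero C>0}} (+-monoˡ-≤ 1 (+-mono-≤ exc exc))))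
          where
          exc≤ : length (Certificate.peaks ct) ≤ d → length (Certificate.excluded ct) ≤ y → length (Box.exceptional q ct) ≤ d + y
          exc≤ D≤ X≤ = ≤-trans (≤-reflexive (trans (length-++ (map proj₁ (Certificate.peaks ct))) (cong (_+ length (Certificate.excluded ct)) (length-map proj₁ (Certificate.peaks ct))))) (+-mono-≤ D≤ X≤)

-- Lower bound: independent choice of large Apéry elements

module LowerBounds where

  open import Data.Nat.Base
  open import Data.Nat.Properties
  open import Data.Nat.DivMod
  open import Data.Nat.Tactic.RingSolver using (solve-∀)
  open import Data.Fin.Base using (Fin; toℕ; fromℕ<)
  open import Data.Fin.Properties using (toℕ-injective; toℕ-fromℕ<; toℕ<n; all?) renaming (_≟_ to _≟ᶠ_)
  open import Data.List.Base using (List; []; _∷_; length; filter)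
  open import Data.List.Membership.Propositional using (_∈_; _∉_)
  open import Data.List.Membership.Propositional.Properties
  open import Data.List.Relation.Unary.Any using (here; there)
  open import Data.List.Relation.Unary.Unique.Propositional using (Unique)
  import Data.List.Relation.Unary.Unique.Propositional.Properties as Unique
  open import Data.Product.Base using (_×_; _,_; proj₁; proj₂)
  open import Data.Sum.Base using (inj₁; inj₂)
  open import Data.Vec.Base using (Vec; lookup)
  open import Function.Base using (_∘_)
  open import Relation.Binary.PropositionalEquality hiding ([_])
  open import Relation.Nullary using (yes; no; contradiction; ¬?; _×-dec_; _→-dec_)
  open import Relation.Unary using (Decidable)
  import Algebra.Properties.CommutativeMonoid.Sum *-1-commutativeMonoid as P
  open FiniteSums
  open Enumeration
  open UpperBounds

  -- For factors differing by at most one, (x + y)² exceeds 4 x y by at most 1, which the division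
  -- by 4 absorbs. This is the case in which `interval-pair` is sharp.
  balanced-product : ∀ h x y → h + 2 ≤ x + y → x ≤ suc y → y ≤ suc x → pairs h ≤ x * y
  balanced-product h x y h+2≤ x≤ y≤ = begin
    ((h + 2) ^ 2) / 4  ≤⟨ /-monoˡ-≤ 4 (^-monoˡ-≤ 2 h+2≤) ⟩
    ((x + y) ^ 2) / 4  ≤⟨ /-monoˡ-≤ 4 (square x y x≤ y≤) ⟩
    (1 + x * y * 4) / 4  ≡⟨ [m+kn]/n≡k ⟩
    x * y  ∎
    where
    open ≤-Reasoning
    [m+kn]/n≡k : (1 + x * y * 4) / 4 ≡ x * y
    [m+kn]/n≡k = trans (+-distrib-/-∣ʳ 1 {x * y * 4} (divides (x * y) refl)) (m*n/n≡m (x * y) 4)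
      where open import Data.Nat.Divisibility using (divides)
    square : ∀ x y → x ≤ suc y → y ≤ suc x → (x + y) ^ 2 ≤ 1 + x * y * 4
    square x y x≤ y≤ with m≤n⇒m<n∨m≡n x≤ | m≤n⇒m<n∨m≡n y≤
    ... | inj₂ refl | _         = ≤-reflexive (eq y)
      where
      eq : ∀ y → (suc y + y) * ((suc y + y) * 1) ≡ 1 + suc y * y * 4
      eq = solve-∀
    ... | inj₁ _    | inj₂ refl = ≤-reflexive (eq x)
      where
      eq : ∀ x → (x + suc x) * ((x + suc x) * 1) ≡ 1 + x * suc x * 4
      eq = solve-∀
    ... | inj₁ (s≤s x≤y) | inj₁ (s≤s y≤x) with ≤-antisym x≤y y≤x
    ...   | refl = ≤-trans (≤-reflexive (eq x)) (n≤1+n _)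
      where
      eq : ∀ x → (x + x) * ((x + x) * 1) ≡ x * x * 4
      eq = solve-∀

  module Kunz (m : ℕ) .{{_ : NonZero m}} (q : ℕ) (a : Fin m) where

    open Cyclic m
    open Containers m using (Subadditive)
    open UpperBound m q a using (weight; C; C>0)

    -- Positivity away from 0 expresses that the multiplicity is m. The last three conditions say
    -- that the largest Apéry element is q m + a = f + m, that is, that the Frobenius number is f.
    IsKunz : (Fin m → ℕ) → Set
    IsKunz k =
      (∀ i → toℕ i ≡ 0 → k i ≡ 0) × (∀ i → toℕ i ≢ 0 → 1 ≤ k i) × Subadditive k ×
      k a ≡ q × (∀ i → k i ≤ q) × (∀ i → toℕ a < toℕ i → k i < q)

    isKunz? : Decidable IsKunz
    isKunz? k =
      all? (λ i → (toℕ i ≟ 0) →-dec (k i ≟ 0)) ×-dec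
      all? (λ i → ¬? (toℕ i ≟ 0) →-dec (1 ≤? k i)) ×-dec
      all? (λ i → all? λ j → k (i ⊕ j) ≤? k i + k j + carry i j) ×-dec
      (k a ≟ q) ×-dec
      all? (λ i → k i ≤? q) ×-dec
      all? (λ i → (toℕ a <? toℕ i) →-dec (k i <? q))

    kunz : List (Vec ℕ m)
    kunz = filter (isKunz? ∘ lookup) (box (λ _ → 0) (λ _ → q))

    kunz-unique : Unique kunz
    kunz-unique = Unique.filter⁺ (isKunz? ∘ lookup) (box-unique _ _)

    ∈-kunz⁺ : ∀ {v} → IsKunz (lookup v) → v ∈ kunz
    ∈-kunz⁺ ok@(_ , _ , _ , _ , k≤q , _) = ∈-filter⁺ (isKunz? ∘ lookup) (∈-box⁺ (λ _ → z≤n) k≤q) ok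

    ∈-kunz⁻ : ∀ {v} → v ∈ kunz → IsKunz (lookup v)
    ∈-kunz⁻ v∈ = proj₂ (∈-filter⁻ (isKunz? ∘ lookup) {xs = box (λ _ → 0) (λ _ → q)} v∈)

    -- Subadditivity is automatic when all nonzero Apéry elements exceed f / 2, because none exceeds f + m.
    module LowerBound (3≤q : 3 ≤ q) (0<a : 0 < toℕ a) where

      f : ℕ
      f = (q ∸ 1) * m + toℕ a

      q≡ : suc (q ∸ 1) ≡ q
      q≡ = m+[n∸m]≡n (≤-trans (s≤s z≤n) 3≤q)

      f+m : f + m ≡ q * m + toℕ a
      f+m = trans (regroup (q ∸ 1) m (toℕ a)) (cong (λ x → x * m + toℕ a) q≡)
        where
        regroup : ∀ p m a → p * m + a + m ≡ suc p * m + a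
        regroup = solve-∀

      -- With q ≥ 3 the factor q - 1 is at least 2. This keeps the subtraction in `half` from being
      -- truncated.
      2m≤f : 2 * m ≤ f
      2m≤f = ≤-trans (*-monoˡ-≤ m (∸-monoˡ-≤ 1 3≤q)) (m≤m+n _ (toℕ a))

      instance
        2m≢0 : NonZero (2 * m)
        2m≢0 = m*n≢0 2 m

      origin : Fin m
      origin = fromℕ< (>-nonZero⁻¹ m)

      toℕ-origin : toℕ origin ≡ 0
      toℕ-origin = toℕ-fromℕ< (>-nonZero⁻¹ m)

      -- The residue of f / 2, the only class that can contain a number n with 2 n = f.
      middle : Fin m
      middle = fromℕ< (m%n<n (f / 2) m)

      -- The largest h with h m + i ≤ f / 2, so `suc (half i)` is the least coordinate whose Apéry
      -- element exceeds f / 2.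
      half : Fin m → ℕ
      half i = (f ∸ 2 * toℕ i) / (2 * m)

      2i≤f : ∀ (i : Fin m) → 2 * toℕ i ≤ f
      2i≤f i = ≤-trans (*-monoʳ-≤ 2 (<⇒≤ (toℕ<n i))) 2m≤f

      half-≤ : ∀ i → 2 * (half i * m + toℕ i) ≤ f
      half-≤ i = begin
        2 * (half i * m + toℕ i)  ≡⟨ regroup (half i) m (toℕ i) ⟩
        half i * (2 * m) + 2 * toℕ i  ≤⟨ +-monoˡ-≤ _ (m/n*n≤m (f ∸ 2 * toℕ i) (2 * m)) ⟩
        f ∸ 2 * toℕ i + 2 * toℕ i  ≡⟨ m∸n+n≡m (2i≤f i) ⟩
        f  ∎
        where
        open ≤-Reasoning
        regroup : ∀ h m i → 2 * (h * m + i) ≡ h * (2 * m) + 2 * i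
        regroup = solve-∀

      half-< : ∀ i → f < 2 * (suc (half i) * m + toℕ i)
      half-< i = begin-strict
        f  ≡⟨ m∸n+n≡m (2i≤f i) ⟨
        x + 2 * toℕ i  ≡⟨ cong (_+ 2 * toℕ i) (m≡m%n+[m/n]*n x (2 * m)) ⟩
        x % (2 * m) + half i * (2 * m) + 2 * toℕ i  <⟨ +-monoˡ-< (2 * toℕ i) (+-monoˡ-< (half i * (2 * m)) (m%n<n x (2 * m))) ⟩
        2 * m + half i * (2 * m) + 2 * toℕ i  ≡⟨ regroup (half i) m (toℕ i) ⟩
        2 * (suc (half i) * m + toℕ i)  ∎
        where
        open ≤-Reasoning
        x : ℕ
        x = f ∸ 2 * toℕ i
        regroup : ∀ h m i → 2 * m + h * (2 * m) + 2 * i ≡ 2 * (suc h * m + i)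
        regroup = solve-∀

      2half<q : ∀ i → 2 * half i < q
      2half<q i = *-cancelʳ-< m (2 * half i) q (begin-strict
        2 * half i * m  ≡⟨ *-assoc 2 (half i) m ⟩
        2 * (half i * m)  ≤⟨ *-monoʳ-≤ 2 (m≤m+n (half i * m) (toℕ i)) ⟩
        2 * (half i * m + toℕ i)  ≤⟨ half-≤ i ⟩
        f  <⟨ +-monoʳ-< ((q ∸ 1) * m) (toℕ<n a) ⟩
        (q ∸ 1) * m + m  ≡⟨ +-comm ((q ∸ 1) * m) m ⟩
        suc (q ∸ 1) * m  ≡⟨ cong (_* m) q≡ ⟩
        q * m  ∎)
        where open ≤-Reasoning

      half<q-1 : ∀ i → suc (half i) ≤ q ∸ 1
      half<q-1 i with half i | 2half<q i
      ... | zero  | _  = ≤-trans (s≤s z≤n) (∸-monoˡ-≤ 1 3≤q)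
      ... | suc h | lt = ∸-monoˡ-≤ 1 (≤-trans (s≤s (s≤s (≤-trans (≤-reflexive (+-comm 1 h)) (+-monoʳ-≤ h (s≤s z≤n))))) lt)

      -- q for residues up to `a` and q - 1 beyond: the largest coordinate whose Apéry element is at
      -- most f + m.
      height : Fin m → ℕ
      height i = q ∸ carry (a ⊖ i) i

      half<height : ∀ i → suc (half i) ≤ height i
      half<height i = ≤-trans (half<q-1 i) (∸-monoʳ-≤ q (carry≤1 (a ⊖ i) i))

      lo hi size : Fin m → ℕ
      lo i with i ≟ᶠ origin | i ≟ᶠ a
      ... | yes _ | _     = 0
      ... | no _  | yes _ = q
      ... | no _  | no _  = suc (half i)
      hi i with i ≟ᶠ origin | i ≟ᶠ a
      ... | yes _ | _     = 0
      ... | no _  | yes _ = q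
      ... | no _  | no _  = height i
      size i = suc (hi i) ∸ lo i

      size>0 : ∀ i → 1 ≤ size i
      size>0 i with i ≟ᶠ origin | i ≟ᶠ a
      ... | yes _ | _     = ≤-refl
      ... | no _  | yes _ = ≤-reflexive (sym (m+n∸n≡m 1 q))
      ... | no _  | no _  = m<n⇒0<n∸m (half<height i)

      size-generic : ∀ i → i ≢ origin → i ≢ a → size i ≡ height i ∸ half i
      size-generic i i≢0 i≢a with i ≟ᶠ origin | i ≟ᶠ a
      ... | yes i≡0 | _       = contradiction i≡0 i≢0
      ... | no _    | yes i≡a = contradiction i≡a i≢a
      ... | no _    | no _    = refl

      ≢0⇒≢origin : ∀ {i} → toℕ i ≢ 0 → i ≢ origin
      ≢0⇒≢origin i≢0 refl = i≢0 toℕ-origin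

      origin-⊕ : ∀ i j → toℕ i ≡ 0 → i ⊕ j ≡ j × carry i j ≡ 0
      origin-⊕ i j eq = ⊕-unique i j j 0 (trans (cong (_+ toℕ j) eq) (sym (+-identityʳ (toℕ j)))) ,
        trans (cong (λ x → (x + toℕ j) / m) eq) (m<n⇒m/n≡0 (toℕ<n j))

      box⊆kunz : ∀ {v} → v ∈ box lo hi → v ∈ kunz
      box⊆kunz {v} v∈ = ∈-kunz⁺ (k-zero , k-pos , k-sub , k-top , k≤q , k<q)
        where
        k : Fin m → ℕ
        k = lookup v
        k-zero : ∀ i → toℕ i ≡ 0 → k i ≡ 0
        k-zero i eq with i ≟ᶠ origin | ∈-box⁻ v∈ i
        ... | yes _  | _ , le = n≤0⇒n≡0 le
        ... | no i≢0 | _      = contradiction (toℕ-injective (trans eq (sym toℕ-origin))) i≢0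
        k-pos : ∀ i → toℕ i ≢ 0 → 1 ≤ k i
        k-pos i i≢0 with i ≟ᶠ origin | i ≟ᶠ a | ∈-box⁻ v∈ i
        ... | yes i≡0 | _     | _      = contradiction i≡0 (≢0⇒≢origin i≢0)
        ... | no _    | yes _ | le , _ = ≤-trans (≤-trans (s≤s z≤n) 3≤q) le
        ... | no _    | no _  | le , _ = ≤-trans (s≤s z≤n) le
        k-top : k a ≡ q
        k-top with a ≟ᶠ origin | a ≟ᶠ a | ∈-box⁻ v∈ a
        ... | yes refl | _      | _        = contradiction 0<a (<⇒≱ (s≤s (≤-reflexive toℕ-origin)))
        ... | no _     | no a≢a | _        = contradiction refl a≢a
        ... | no _     | yes _  | le , le′ = ≤-antisym le′ le
        k≤q : ∀ i → k i ≤ q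
        k≤q i with i ≟ᶠ origin | i ≟ᶠ a | ∈-box⁻ v∈ i
        ... | yes _ | _     | _ , le = ≤-trans le z≤n
        ... | no _  | yes _ | _ , le = le
        ... | no _  | no _  | _ , le = ≤-trans le (m∸n≤m q (carry (a ⊖ i) i))
        k<q : ∀ i → toℕ a < toℕ i → k i < q
        k<q i a<i with i ≟ᶠ origin | i ≟ᶠ a | ∈-box⁻ v∈ i
        ... | yes refl | _        | _ = contradiction a<i (≤⇒≯ (≤-trans (≤-reflexive toℕ-origin) z≤n))
        ... | no _     | yes refl | _ = contradiction a<i (<-irrefl refl)
        ... | no _     | no _     | _ , le with carry (a ⊖ i) i in eq
        ...   | zero  = contradiction (carry≡0⇒≤ a i eq) (<⇒≱ a<i)
        ...   | suc c = ≤-trans (s≤s (≤-trans le (∸-monoʳ-≤ q (s≤s (z≤n {c}))))) (≤-reflexive q≡)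
        w : Fin m → ℕ
        w i = k i * m + toℕ i
        large : ∀ i → toℕ i ≢ 0 → f < 2 * w i
        large i i≢0 with i ≟ᶠ origin | i ≟ᶠ a | ∈-box⁻ v∈ i
        ... | yes i≡0 | _        | _      = contradiction i≡0 (≢0⇒≢origin i≢0)
        ... | no _    | yes refl | le , _ = <-≤-trans (m<m+n f (>-nonZero⁻¹ m)) (≤-trans (≤-reflexive f+m)
                                               (≤-trans (+-monoˡ-≤ (toℕ i) (*-monoˡ-≤ m le)) (m≤m+n (w i) (w i + 0))))
        ... | no _    | no _     | le , _ = <-≤-trans (half-< i) (*-monoʳ-≤ 2 (+-monoˡ-≤ (toℕ i) (*-monoˡ-≤ m le)))
        w≤f+m : ∀ i → w i ≤ f + m
        w≤f+m i with toℕ i ≤? toℕ a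
        ... | yes i≤a = ≤-trans (+-mono-≤ (*-monoˡ-≤ m (k≤q i)) i≤a) (≤-reflexive (sym f+m))
        ... | no i≰a  = begin
          k i * m + toℕ i  ≤⟨ +-monoʳ-≤ (k i * m) (<⇒≤ (toℕ<n i)) ⟩
          k i * m + m  ≡⟨ +-comm (k i * m) m ⟩
          suc (k i) * m  ≤⟨ *-monoˡ-≤ m (k<q i (≰⇒> i≰a)) ⟩
          q * m  ≤⟨ m≤m+n (q * m) (toℕ a) ⟩
          q * m + toℕ a  ≡⟨ f+m ⟨
          f + m  ∎
          where open ≤-Reasoning
        -- A violation would put the Apéry element of `i ⊕ j` at least m above w i + w j > f, hence
        -- above f + m.
        sub-large : ∀ i j → toℕ i ≢ 0 → toℕ j ≢ 0 → k (i ⊕ j) ≤ k i + k j + carry i j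
        sub-large i j i≢0 j≢0 = ≮⇒≥ λ lt → <⇒≱ (begin-strict
          f + m  <⟨ +-monoˡ-< m f<w ⟩
          w i + w j + m  ≡⟨ regroup (k i) (k j) (toℕ i) (toℕ j) m ⟩
          suc (k i + k j) * m + (toℕ i + toℕ j)  ≡⟨ cong (suc (k i + k j) * m +_) (⊕-carry i j) ⟩
          suc (k i + k j) * m + (toℕ (i ⊕ j) + carry i j * m) ≡⟨ regroup′ (k i + k j) (carry i j) (toℕ (i ⊕ j)) m ⟩
          suc (k i + k j + carry i j) * m + toℕ (i ⊕ j)  ≤⟨ +-monoˡ-≤ _ (*-monoˡ-≤ m lt) ⟩
          w (i ⊕ j)  ∎) (w≤f+m (i ⊕ j))
          where
          open ≤-Reasoning
          regroup : ∀ x y i j m → (x * m + i) + (y * m + j) + m ≡ suc (x + y) * m + (i + j)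
          regroup = solve-∀
          regroup′ : ∀ x c l m → suc x * m + (l + c * m) ≡ suc (x + c) * m + l
          regroup′ = solve-∀
          f<w : f < w i + w j
          f<w = *-cancelˡ-< 2 f (w i + w j) (subst₂ _<_ (cong (f +_) (sym (+-identityʳ f))) (sym (*-distribˡ-+ 2 (w i) (w j)))
            (+-mono-< (large i i≢0) (large j j≢0)))
        k-sub : Subadditive k
        k-sub i j with toℕ i ≟ 0 | toℕ j ≟ 0
        ... | no i≢0 | no j≢0 = sub-large i j i≢0 j≢0
        ... | yes i≡0 | _ = ≤-trans (≤-reflexive (cong k (proj₁ (origin-⊕ i j i≡0)))) (≤-trans (m≤n+m (k j) (k i)) (m≤m+n (k i + k j) _))
        ... | no _ | yes j≡0 = ≤-trans (≤-reflexive (cong k (trans (⊕-comm i j) (proj₁ (origin-⊕ j i j≡0))))) (≤-trans (m≤m+n (k i) (k j)) (m≤m+n (k i + k j) _))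

      -- Two residues whose coordinate is prescribed, and the one where the strict inequality behind
      -- `halves` can fail. Each costs one factor `C`.
      special : List (Fin m)
      special = origin ∷ a ∷ middle ∷ []

      -- Both intervals end at `h`; their lengths sum to at least h + 2 and differ by at most one,
      -- so their product reaches the value that the containers allow for the pair.
      generic-pair : ∀ i → i ∉ special → weight i ≤ size i * size (a ⊖ i)
      generic-pair i i∉ = subst (_≤ size i * size j) (sym weight≡) (subst₂ (λ x y → pairs h ≤ x * y)
        (sym (size-generic i i≢0 i≢a)) (sym (trans (size-generic j j≢0 j≢a) (cong (_∸ half j) height-j)))
        (balanced-product h (h ∸ half i) (h ∸ half j) sum≥ (close (half i) (half j) half-j≤) (close (half j) (half i) half-i≤)))
        where
        j : Fin m
        j = a ⊖ i
        c : ℕ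
        c = carry j i
        h : ℕ
        h = height i
        i≢0 : i ≢ origin
        i≢0 eq = i∉ (here eq)
        i≢a : i ≢ a
        i≢a eq = i∉ (there (here eq))
        j≢0 : j ≢ origin
        j≢0 eq = i≢a (trans (sym (proj₁ (origin-⊕ j i (trans (cong toℕ eq) toℕ-origin)))) (⊖-⊕ a i))
        j≢a : j ≢ a
        j≢a eq = i≢0 (trans (sym (⊖-involutive a i)) (trans (cong (a ⊖_) eq)
          (trans (cong (_⊖ a) (sym (proj₁ (origin-⊕ origin a toℕ-origin)))) (⊕-⊖ origin a))))
        height-j : height j ≡ h
        height-j = cong (q ∸_) (trans (cong (λ x → carry x j) (⊖-involutive a i)) (carry-comm i j))
        weight≡ : weight i ≡ pairs h
        weight≡ with toℕ i <? toℕ a | carry (a ⊖ i) i in eq | carry≤1 (a ⊖ i) i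
        ... | yes _   | zero     | _ = refl
        ... | yes i<a | suc zero | _ = contradiction i<a (<-asym (carry≡1⇒> a i eq))
        ... | no i≮a  | zero     | _ = contradiction (≤∧≢⇒< (carry≡0⇒≤ a i eq) (i≢a ∘ toℕ-injective)) i≮a
        ... | no _    | suc zero | _ = refl
        ... | _       | suc (suc _) | s≤s ()
        i+j : toℕ j + toℕ i ≡ toℕ a + c * m
        i+j = trans (⊕-carry j i) (cong (λ x → toℕ x + c * m) (⊖-⊕ a i))
        off-middle : 2 * (half i * m + toℕ i) ≢ f
        off-middle eq = i∉ (there (there (here (toℕ-injective (sym (begin
          toℕ middle  ≡⟨ toℕ-fromℕ< _ ⟩
          (f / 2) % m  ≡⟨ cong (λ x → (x / 2) % m) (sym eq) ⟩
          (2 * x / 2) % m  ≡⟨ cong (λ y → (y / 2) % m) (*-comm 2 x) ⟩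
          (x * 2 / 2) % m  ≡⟨ cong (_% m) (m*n/n≡m x 2) ⟩
          x % m  ≡⟨ cong (_% m) (+-comm (half i * m) (toℕ i)) ⟩
          (toℕ i + half i * m) % m  ≡⟨ [m+kn]%n≡m%n (toℕ i) (half i) m ⟩
          toℕ i % m  ≡⟨ m<n⇒m%n≡m (toℕ<n i) ⟩
          toℕ i  ∎))))))
          where
          open ≡-Reasoning
          x : ℕ
          x = half i * m + toℕ i
        -- Doubling and adding `toℕ a` turns this into a comparison of two numbers at most f / 2
        -- with f. Strictness at `i` alone makes it strict, which is worth one of the two units in
        -- `halves≤`.
        halves : half i + half j + c < q ∸ 1
        halves = *-cancelʳ-< m (half i + half j + c) (q ∸ 1) (+-cancelʳ-< (toℕ a) _ _ (*-cancelˡ-< 2 _ _ (begin-strict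
          2 * ((half i + half j + c) * m + toℕ a)  ≡⟨ regroup (half i) (half j) c m (toℕ a) ⟩
          2 * (half i * m + half j * m + (toℕ a + c * m))  ≡⟨ cong (λ x → 2 * (half i * m + half j * m + x)) (sym i+j) ⟩
          2 * (half i * m + half j * m + (toℕ j + toℕ i))  ≡⟨ regroup′ (half i * m) (half j * m) (toℕ i) (toℕ j) ⟩
          2 * (half i * m + toℕ i) + 2 * (half j * m + toℕ j)  <⟨ +-mono-<-≤ (≤∧≢⇒< (half-≤ i) off-middle) (half-≤ j) ⟩
          f + f  ≡⟨ cong (f +_) (+-identityʳ f) ⟨
          2 * f  ∎)))
          where
          open ≤-Reasoning
          regroup : ∀ x y c m a → 2 * ((x + y + c) * m + a) ≡ 2 * (x * m + y * m + (a + c * m))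
          regroup = solve-∀
          regroup′ : ∀ x y i j → 2 * (x + y + (j + i)) ≡ 2 * (x + i) + 2 * (y + j)
          regroup′ = solve-∀
        halves≤ : half i + half j + 2 ≤ h
        halves≤ = ≤-trans (≤-reflexive (sym (m+n∸n≡m (half i + half j + 2) c))) (∸-monoˡ-≤ c (begin
          half i + half j + 2 + c  ≡⟨ regroup (half i) (half j) c ⟩
          suc (suc (half i + half j + c))  ≤⟨ s≤s halves ⟩
          suc (q ∸ 1)  ≡⟨ q≡ ⟩
          q  ∎))
          where
          open ≤-Reasoning
          regroup : ∀ x y c → x + y + 2 + c ≡ suc (suc (x + y + c))
          regroup = solve-∀
        half-i≤h : half i ≤ h
        half-i≤h = ≤-trans (≤-trans (m≤m+n (half i) (half j)) (m≤m+n _ 2)) halves≤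
        half-j≤h : half j ≤ h
        half-j≤h = ≤-trans (≤-trans (m≤n+m (half j) (half i)) (m≤m+n _ 2)) halves≤
        sum≥ : h + 2 ≤ (h ∸ half i) + (h ∸ half j)
        sum≥ = +-cancelʳ-≤ (half i + half j) _ _ (begin
          h + 2 + (half i + half j)  ≡⟨ regroup h (half i) (half j) ⟩
          h + (half i + half j + 2)  ≤⟨ +-monoʳ-≤ h halves≤ ⟩
          h + h  ≡⟨ cong₂ _+_ (m∸n+n≡m half-i≤h) (m∸n+n≡m half-j≤h) ⟨
          (h ∸ half i + half i) + (h ∸ half j + half j)  ≡⟨ regroup′ (h ∸ half i) (h ∸ half j) (half i) (half j) ⟩
          (h ∸ half i) + (h ∸ half j) + (half i + half j)  ∎)
          where
          open ≤-Reasoning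
          regroup : ∀ h x y → h + 2 + (x + y) ≡ h + (x + y + 2)
          regroup = solve-∀
          regroup′ : ∀ x y u v → (x + u) + (y + v) ≡ x + y + (u + v)
          regroup′ = solve-∀
        -- Residues are less than m, so changing the residue moves the threshold coordinate by at
        -- most one.
        half-≤-suc : ∀ x y → half x ≤ suc (half y)
        half-≤-suc x y = ≤-pred (*-cancelʳ-< m (half x) (2 + half y) (*-cancelˡ-< 2 _ _ (begin-strict
          2 * (half x * m)  ≤⟨ *-monoʳ-≤ 2 (m≤m+n (half x * m) (toℕ x)) ⟩
          2 * (half x * m + toℕ x)  ≤⟨ half-≤ x ⟩
          f  <⟨ half-< y ⟩
          2 * (suc (half y) * m + toℕ y)  ≤⟨ *-monoʳ-≤ 2 (+-monoʳ-≤ (suc (half y) * m) (<⇒≤ (toℕ<n y))) ⟩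
          2 * (suc (half y) * m + m)  ≡⟨ cong (2 *_) (+-comm (suc (half y) * m) m) ⟩
          2 * ((2 + half y) * m)  ∎)))
          where open ≤-Reasoning
        half-i≤ : half i ≤ suc (half j)
        half-i≤ = half-≤-suc i j
        half-j≤ : half j ≤ suc (half i)
        half-j≤ = half-≤-suc j i
        close : ∀ x y → y ≤ suc x → h ∸ x ≤ suc (h ∸ y)
        close x y y≤ = ≤-trans (m≤n+m∸n (h ∸ x) 1) (s≤s (≤-trans (≤-reflexive (trans (∸-+-assoc h x 1) (cong (h ∸_) (+-comm x 1)))) (∸-monoʳ-≤ h y≤)))

      lower-bound : ∏ weight ≤ length kunz * length kunz * C ^ 3
      lower-bound = begin
        ∏ weight  ≤⟨ ∏-mono pointwise ⟩
        ∏ (λ i → size i * size (a ⊖ i) * C ^ occ special i)  ≡⟨ P.∑-distrib-+ {m} _ (λ i → C ^ occ special i) ⟩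
        ∏ (λ i → size i * size (a ⊖ i)) * ∏ (λ i → C ^ occ special i)
          ≡⟨ cong₂ _*_ (sym (∏-reflect a size)) (trans (∏-^ C (occ special)) (cong (C ^_) (∑-occ special))) ⟩
        ∏ size * ∏ size * C ^ 3  ≡⟨ cong (λ x → x * x * C ^ 3) (sym (length-box lo hi)) ⟩
        length (box lo hi) * length (box lo hi) * C ^ 3  ≤⟨ *-monoˡ-≤ (C ^ 3) (*-mono-≤ le le) ⟩
        length kunz * length kunz * C ^ 3  ∎
        where
        open ≤-Reasoning
        le : length (box lo hi) ≤ length kunz
        le = unique-⊆-length (box-unique lo hi) box⊆kunz
        weight≤C : ∀ i → weight i ≤ C
        weight≤C i with toℕ i <? toℕ a
        ... | yes _ = pairs≤square q
        ... | no _  = ≤-trans (pairs-mono (m∸n≤m q 1)) (pairs≤square q)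
        pointwise : ∀ i → weight i ≤ size i * size (a ⊖ i) * C ^ occ special i
        pointwise i with occ special i in eq
        ... | zero  = ≤-trans (generic-pair i (occ-≡0 eq)) (≤-reflexive (sym (*-identityʳ _)))
        ... | suc n = ≤-trans (weight≤C i) (≤-trans (m≤m*n C (C ^ n) {{m^n≢0 C n {{>-nonZero C>0}}}})
          (m≤n*m (C ^ suc n) (size i * size (a ⊖ i)) {{>-nonZero (*-mono-≤ (size>0 i) (size>0 (a ⊖ i)))}}))

-- Bijection between semigroups and Kunz coordinates

module KunzCoordinates where

  open import Defs using (NumericalSemigroup; carrier; IsMultiplicity; IsFrobenius; semigroups; HasCardinality)
  open import Data.Nat.Base
  open import Data.Nat.Properties
  open import Data.Nat.DivMod
  open import Data.Nat.Tactic.RingSolver using (solve-∀)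
  open import Data.Fin.Base using (Fin; toℕ; fromℕ<) renaming (zero to fzero; suc to fsuc)
  open import Data.Fin.Properties using (toℕ-injective; toℕ-fromℕ<; toℕ<n)
  open import Data.List.Base as List using (List; _∷_; length; upTo)
  open import Data.List.Membership.Propositional using (_∈_)
  open import Data.List.Membership.Propositional.Properties using (∈-upTo⁺; ∈-lookup)
  open import Data.List.Relation.Unary.Any using (index)
  open import Data.List.Relation.Unary.Any.Properties using (lookup-index)
  open import Data.List.Relation.Unary.All as All using (All)
  open import Data.List.Relation.Unary.AllPairs using (_∷_)
  open import Data.List.Relation.Unary.Unique.Propositional using (Unique)
  open import Data.Product.Base using (_×_; _,_; proj₁; proj₂; ∃; Σ)
  open import Data.Vec.Base using (Vec; lookup; tabulate)
  open import Data.Vec.Properties using (lookup∘tabulate; tabulate∘lookup; tabulate-cong)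
  open import Function.Base using (_∘_)
  open import Relation.Binary.PropositionalEquality
  open import Relation.Nullary using (yes; no; ¬_; contradiction)
  open import Relation.Unary using (Pred; _≐_)
  open FiniteSums
  open Enumeration using (least)
  open UpperBounds
  open LowerBounds

  lookup-injective : {A : Set} {xs : List A} → Unique xs → ∀ i j → List.lookup xs i ≡ List.lookup xs j → i ≡ j
  lookup-injective (_  ∷ _) fzero    fzero    _  = refl
  lookup-injective {xs = _ ∷ xs} (x∉ ∷ _) fzero    (fsuc j) eq = contradiction eq (All.lookup x∉ (∈-lookup j))
  lookup-injective {xs = _ ∷ xs} (x∉ ∷ _) (fsuc i) fzero    eq = contradiction (sym eq) (All.lookup x∉ (∈-lookup i))
  lookup-injective (_  ∷ u) (fsuc i) (fsuc j) eq = cong fsuc (lookup-injective u i j eq)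

  split-+ : ∀ i j x y m → (i + x * m) + (j + y * m) ≡ (i + j) + (x + y) * m
  split-+ = solve-∀

  absorb-carry : ∀ i c x m → (i + c * m) + x * m ≡ i + (x + c) * m
  absorb-carry = solve-∀

  module Correspondence (m : ℕ) .{{_ : NonZero m}} (q : ℕ) (1≤q : 1 ≤ q) (f : ℕ) (f/m : f / m ≡ q ∸ 1) where

    open Cyclic m
    open Containers m using (Subadditive)

    residue : ℕ → Fin m
    residue n = fromℕ< (m%n<n n m)

    toℕ-residue : ∀ n → toℕ (residue n) ≡ n % m
    toℕ-residue n = toℕ-fromℕ< (m%n<n n m)

    split : ∀ n → n ≡ toℕ (residue n) + n / m * m
    split n = trans (m≡m%n+[m/n]*n n m) (cong (_+ n / m * m) (sym (toℕ-residue n)))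

    split-unique : ∀ n (i : Fin m) d → n ≡ toℕ i + d * m → residue n ≡ i × n / m ≡ d
    split-unique n i d eq = toℕ-injective rem , *-cancelʳ-≡ (n / m) d m (+-cancelˡ-≡ (toℕ i) _ _
        (trans (cong (_+ n / m * m) (sym rem)) (trans (sym (split n)) eq)))
      where
      rem : toℕ (residue n) ≡ toℕ i
      rem = trans (toℕ-residue n) (trans (cong (_% m) eq) (trans ([m+kn]%n≡m%n (toℕ i) d m) (m<n⇒m%n≡m (toℕ<n i))))

    a : Fin m
    a = residue f

    open Kunz m q a

    q≡ : suc (q ∸ 1) ≡ q
    q≡ = m+[n∸m]≡n 1≤q

    f≡ : f ≡ toℕ a + (q ∸ 1) * m
    f≡ = trans (split f) (cong (λ x → toℕ a + x * m) f/m)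

    m≤f+1 : suc f ≤ q * m
    m≤f+1 = ≤-trans (≤-trans (s≤s (≤-reflexive f≡)) (+-monoˡ-≤ ((q ∸ 1) * m) (toℕ<n a))) (≤-reflexive (cong (_* m) q≡))

    module FromKunz (k : Fin m → ℕ) (isKunz : IsKunz k) where

      k-zero : ∀ i → toℕ i ≡ 0 → k i ≡ 0
      k-zero = proj₁ isKunz
      k-pos : ∀ i → toℕ i ≢ 0 → 1 ≤ k i
      k-pos = proj₁ (proj₂ isKunz)
      k-sub : Subadditive k
      k-sub = proj₁ (proj₂ (proj₂ isKunz))
      k-top : k a ≡ q
      k-top = proj₁ (proj₂ (proj₂ (proj₂ isKunz)))
      k≤q : ∀ i → k i ≤ q
      k≤q = proj₁ (proj₂ (proj₂ (proj₂ (proj₂ isKunz))))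
      k<q : ∀ i → toℕ a < toℕ i → k i < q
      k<q = proj₂ (proj₂ (proj₂ (proj₂ (proj₂ isKunz))))

      -- A number belongs when it is at least the Apéry element of its residue class, which is a
      -- comparison of quotients by m.
      member : ℕ → Set
      member n = k (residue n) ≤ n / m

      member-+ : ∀ {x y} → member x → member y → member (x + y)
      member-+ {x} {y} x∈ y∈ = subst₂ (λ i d → k i ≤ d) (sym (proj₁ sp)) (sym (proj₂ sp))
        (≤-trans (k-sub (residue x) (residue y)) (+-monoˡ-≤ (carry (residue x) (residue y)) (+-mono-≤ x∈ y∈)))
        where
        sp : residue (x + y) ≡ residue x ⊕ residue y × (x + y) / m ≡ x / m + y / m + carry (residue x) (residue y)
        sp = split-unique (x + y) (residue x ⊕ residue y) _ (begin
          x + y  ≡⟨ cong₂ _+_ (split x) (split y) ⟩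
          (toℕ (residue x) + x / m * m) + (toℕ (residue y) + y / m * m)  ≡⟨ split-+ (toℕ (residue x)) (toℕ (residue y)) (x / m) (y / m) m ⟩
          (toℕ (residue x) + toℕ (residue y)) + (x / m + y / m) * m  ≡⟨ cong (_+ (x / m + y / m) * m) (⊕-carry (residue x) (residue y)) ⟩
          _ + carry (residue x) (residue y) * m + (x / m + y / m) * m  ≡⟨ absorb-carry _ (carry (residue x) (residue y)) (x / m + y / m) m ⟩
          toℕ (residue x ⊕ residue y) + (x / m + y / m + carry (residue x) (residue y)) * m ∎)
          where open ≡-Reasoning

      large : ∀ n → q * m ≤ n → member n
      large n le = ≤-trans (k≤q (residue n)) (subst (_≤ n / m) (m*n/n≡m q m) (/-monoˡ-≤ m le))

      semigroup : NumericalSemigroup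
      semigroup = record
        { carrier           = member
        ; mem?              = λ n → k (residue n) ≤? n / m
        ; 0-mem             = subst (_≤ 0 / m) (sym (k-zero (residue 0) (trans (toℕ-residue 0) (m*n%n≡0 0 m)))) z≤n
        ; +-closed          = λ {x} {y} → member-+ {x} {y}
        ; finite-complement = upTo (q * m) , λ {n} n∉ → ∈-upTo⁺ (≰⇒> (n∉ ∘ large n))
        }

      multiplicity : IsMultiplicity semigroup m
      multiplicity =
        subst (_≤ m / m) (sym (k-zero (residue m) (trans (toℕ-residue m) (n%n≡0 m)))) z≤n ,
        ≢-nonZero⁻¹ m ,
        λ n n∈ n≢0 → ≮⇒≥ λ n<m → contradiction
          (≤-trans (k-pos (residue n) (n≢0 ∘ trans (sym (trans (toℕ-residue n) (m<n⇒m%n≡m n<m)))))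
                   (≤-trans n∈ (≤-reflexive (m<n⇒m/n≡0 n<m)))) λ ()

      frobenius : IsFrobenius semigroup f
      frobenius = above , λ c c∈ → ≰⇒> λ c≤f → f∉ (subst member (m+[n∸m]≡n c≤f) (c∈ (f ∸ c)))
        where
        f∉ : ¬ member f
        f∉ f∈ = <⇒≱ (≤-trans (s≤s (≤-reflexive f/m)) (≤-reflexive q≡)) (subst (_≤ f / m) k-top f∈)
        -- A number past f but below q m has quotient q - 1 and a residue above `a`, where `k` is
        -- less than q.
        above : ∀ n → member (suc f + n)
        above n with q * m ≤? suc f + n
        ... | yes le = large _ le
        ... | no ≰   = subst₂ (λ i d → k i ≤ d) (sym (proj₁ sp)) (sym (proj₂ sp))
                         (≤-pred (≤-trans (k<q i a<i) (≤-reflexive (sym q≡))))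
          where
          eq : suc f + n ≡ suc (toℕ a) + n + (q ∸ 1) * m
          eq = trans (cong (λ x → suc x + n) f≡) (regroup (toℕ a) ((q ∸ 1) * m) n)
            where
            regroup : ∀ a b n → suc (a + b) + n ≡ suc a + n + b
            regroup = solve-∀
          i<m : suc (toℕ a) + n < m
          i<m = +-cancelʳ-< ((q ∸ 1) * m) _ m (≤-trans (≤-reflexive (cong suc (sym eq))) (≤-trans (≰⇒> ≰) (≤-reflexive (cong (_* m) (sym q≡)))))
          i : Fin m
          i = fromℕ< i<m
          a<i : toℕ a < toℕ i
          a<i = ≤-trans (m≤m+n (suc (toℕ a)) n) (≤-reflexive (sym (toℕ-fromℕ< i<m)))
          sp : residue (suc f + n) ≡ i × (suc f + n) / m ≡ q ∸ 1
          sp = split-unique (suc f + n) i (q ∸ 1) (trans eq (cong (_+ (q ∸ 1) * m) (sym (toℕ-fromℕ< i<m))))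

    Sem : Set₁
    Sem = Σ NumericalSemigroup λ Λ → IsMultiplicity Λ m × IsFrobenius Λ f

    ∣_∣ : Sem → Pred ℕ _
    ∣ Λ ∣ = carrier (proj₁ Λ)

    module ToKunz (Λ : NumericalSemigroup) (mult : IsMultiplicity Λ m) (frob : IsFrobenius Λ f) where
      open NumericalSemigroup Λ using (mem?; 0-mem; +-closed)

      beyond : ∀ n → f < n → carrier Λ n
      beyond n f<n = subst (carrier Λ) (m+[n∸m]≡n f<n) (proj₁ frob (n ∸ suc f))

      -- If f were a member, everything from f on would be, against the minimality of the conductor
      -- f + 1.
      f∉ : ¬ carrier Λ f
      f∉ f∈ = <⇒≱ (n<1+n f) (proj₂ frob f ge)
        where
        ge : ∀ n → carrier Λ (f + n)
        ge zero    = subst (carrier Λ) (sym (+-identityʳ f)) f∈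
        ge (suc n) = subst (carrier Λ) (sym (+-suc f n)) (proj₁ frob n)

      -- The search is bounded by q, since numbers from q m on exceed f and belong to `Λ`.
      apery : ∀ (i : Fin m) → ∃ λ x → carrier Λ (toℕ i + x * m) × (∀ y → carrier Λ (toℕ i + y * m) → x ≤ y)
      apery i = least (λ x → mem? (toℕ i + x * m)) q (beyond _ (≤-trans m≤f+1 (m≤n+m (q * m) (toℕ i))))

      k : Fin m → ℕ
      k = proj₁ ∘ apery

      k-mem : ∀ i → carrier Λ (toℕ i + k i * m)
      k-mem = proj₁ ∘ proj₂ ∘ apery

      k-min : ∀ i y → carrier Λ (toℕ i + y * m) → k i ≤ y
      k-min = proj₂ ∘ proj₂ ∘ apery

      add-m : ∀ x y → carrier Λ x → carrier Λ (x + y * m)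
      add-m x zero    x∈ = subst (carrier Λ) (sym (+-identityʳ x)) x∈
      add-m x (suc y) x∈ = subst (carrier Λ) (+-assoc x m (y * m)) (add-m (x + m) y (+-closed x∈ (proj₁ mult)))

      ∈⇒k≤ : ∀ {n} → carrier Λ n → k (residue n) ≤ n / m
      ∈⇒k≤ {n} n∈ = k-min (residue n) (n / m) (subst (carrier Λ) (split n) n∈)

      k≤⇒∈ : ∀ {n} → k (residue n) ≤ n / m → carrier Λ n
      k≤⇒∈ {n} le = subst (carrier Λ) (begin
          toℕ (residue n) + k (residue n) * m + (n / m ∸ k (residue n)) * m  ≡⟨ regroup (toℕ (residue n)) (k (residue n)) (n / m ∸ k (residue n)) m ⟩
          toℕ (residue n) + (k (residue n) + (n / m ∸ k (residue n))) * m  ≡⟨ cong (λ x → toℕ (residue n) + x * m) (m+[n∸m]≡n le) ⟩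
          toℕ (residue n) + n / m * m  ≡⟨ split n ⟨
          n  ∎)
        (add-m _ (n / m ∸ k (residue n)) (k-mem (residue n)))
        where
        open ≡-Reasoning
        regroup : ∀ i x y m → i + x * m + y * m ≡ i + (x + y) * m
        regroup = solve-∀

      isKunz : IsKunz k
      isKunz = k-zero , k-pos , k-sub , ≤-antisym (k≤q a) q≤ka , k≤q , k<q
        where
        k-zero : ∀ i → toℕ i ≡ 0 → k i ≡ 0
        k-zero i eq = n≤0⇒n≡0 (k-min i 0 (subst (carrier Λ) (sym (trans (+-identityʳ (toℕ i)) eq)) 0-mem))
        k-pos : ∀ i → toℕ i ≢ 0 → 1 ≤ k i
        k-pos i i≢0 with k i | k-mem i
        ... | suc _ | _  = s≤s z≤n
        ... | zero  | i∈ = contradiction (proj₂ (proj₂ mult) (toℕ i) (subst (carrier Λ) (+-identityʳ (toℕ i)) i∈) i≢0) (<⇒≱ (toℕ<n i))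
        k-sub : Subadditive k
        k-sub i j = k-min (i ⊕ j) (k i + k j + carry i j) (subst (carrier Λ) (begin
          (toℕ i + k i * m) + (toℕ j + k j * m)  ≡⟨ split-+ (toℕ i) (toℕ j) (k i) (k j) m ⟩
          (toℕ i + toℕ j) + (k i + k j) * m  ≡⟨ cong (_+ (k i + k j) * m) (⊕-carry i j) ⟩
          (toℕ (i ⊕ j) + carry i j * m) + (k i + k j) * m  ≡⟨ absorb-carry (toℕ (i ⊕ j)) (carry i j) (k i + k j) m ⟩
          toℕ (i ⊕ j) + (k i + k j + carry i j) * m  ∎) (+-closed (k-mem i) (k-mem j)))
          where open ≡-Reasoning
        k≤q : ∀ i → k i ≤ q
        k≤q i = k-min i q (beyond _ (≤-trans m≤f+1 (m≤n+m (q * m) (toℕ i))))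
        k<q : ∀ i → toℕ a < toℕ i → k i < q
        k<q i a<i = ≤-trans (s≤s (k-min i (q ∸ 1) (beyond _ (≤-trans (s≤s (≤-reflexive f≡)) (+-monoˡ-≤ ((q ∸ 1) * m) a<i))))) (≤-reflexive q≡)
        q≤ka : q ≤ k a
        q≤ka = ≤-trans (≤-reflexive (sym (trans (cong suc f/m) q≡))) (≰⇒> (f∉ ∘ k≤⇒∈))

      vector : Vec ℕ m
      vector = tabulate k

      vector∈ : vector ∈ kunz
      vector∈ = ∈-kunz⁺ (IsKunz-cong (λ i → sym (lookup∘tabulate k i)) isKunz)
        where
        IsKunz-cong : ∀ {k k′} → (∀ i → k i ≡ k′ i) → IsKunz k → IsKunz k′
        IsKunz-cong eq (z , p , s , t , le , lt) =
          (λ i h → trans (sym (eq i)) (z i h)) ,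
          (λ i h → subst (1 ≤_) (eq i) (p i h)) ,
          (λ i j → subst₂ _≤_ (eq (i ⊕ j)) (cong₂ (λ x y → x + y + carry i j) (eq i) (eq j)) (s i j)) ,
          trans (sym (eq a)) t ,
          (λ i → subst (_≤ q) (eq i) (le i)) ,
          (λ i h → subst (_< q) (eq i) (lt i h))

    vectorOf : Sem → Vec ℕ m
    vectorOf (Λ , mult , frob) = ToKunz.vector Λ mult frob

    vectorOf∈ : ∀ Λ → vectorOf Λ ∈ kunz
    vectorOf∈ (Λ , mult , frob) = ToKunz.vector∈ Λ mult frob

    semigroupOf : Fin (length kunz) → Sem
    semigroupOf i = semigroup , multiplicity , frobenius
      where open FromKunz (lookup (List.lookup kunz i)) (∈-kunz⁻ (∈-lookup i))

    -- Each coordinate is a minimum over the carrier, hence determined by the underlying set and not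
    -- by the decision procedure or the proofs that come with it.
    vectorOf-cong : ∀ Λ Λ′ → ∣ Λ ∣ ≐ ∣ Λ′ ∣ → vectorOf Λ ≡ vectorOf Λ′
    vectorOf-cong (Λ , mult , frob) (Λ′ , mult′ , frob′) (⊆ , ⊇) = tabulate-cong λ i →
      ≤-antisym (L.k-min i _ (⊇ (L′.k-mem i))) (L′.k-min i _ (⊆ (L.k-mem i)))
      where
      module L = ToKunz Λ mult frob
      module L′ = ToKunz Λ′ mult′ frob′

    vectorOf-semigroupOf : ∀ i → vectorOf (semigroupOf i) ≡ List.lookup kunz i
    vectorOf-semigroupOf i = trans (tabulate-cong λ j → ≤-antisym
        (L.k-min j (k j) (subst₂ (λ r d → k r ≤ d) (sym (proj₁ (at j (k j)))) (sym (proj₂ (at j (k j)))) ≤-refl))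
        (subst₂ (λ r d → k r ≤ d) (proj₁ (at j (L.k j))) (proj₂ (at j (L.k j))) (L.k-mem j)))
      (tabulate∘lookup (List.lookup kunz i))
      where
      k : Fin m → ℕ
      k = lookup (List.lookup kunz i)
      module L = ToKunz (proj₁ (semigroupOf i)) (proj₁ (proj₂ (semigroupOf i))) (proj₂ (proj₂ (semigroupOf i)))
      at : ∀ j x → residue (toℕ j + x * m) ≡ j × (toℕ j + x * m) / m ≡ x
      at j x = split-unique (toℕ j + x * m) j x refl

    -- A semigroup is numbered by the position of its vector in `kunz`; the list has no duplicates,
    -- so equal vectors have equal positions.
    cardinality : HasCardinality (semigroups f m) (length kunz)
    cardinality = record
      { to        = number
      ; from      = semigroupOf
      ; to-cong   = λ {Λ} {Λ′} → number-cong Λ Λ′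
      ; from-cong = λ { refl → (λ x∈ → x∈) , (λ x∈ → x∈) }
      ; inverse   = (λ {i} {Λ} Λ≐ → injective _ _ (trans (lookup-number Λ) (trans (vectorOf-cong Λ (semigroupOf i) Λ≐) (vectorOf-semigroupOf i))))
                  , (λ { {Λ} refl → right Λ })
      }
      where
      number : Sem → Fin (length kunz)
      number Λ = index (vectorOf∈ Λ)
      injective : ∀ i j → List.lookup kunz i ≡ List.lookup kunz j → i ≡ j
      injective = lookup-injective kunz-unique
      lookup-number : ∀ Λ → List.lookup kunz (number Λ) ≡ vectorOf Λ
      lookup-number Λ = sym (lookup-index (vectorOf∈ Λ))
      number-cong : ∀ Λ Λ′ → ∣ Λ ∣ ≐ ∣ Λ′ ∣ → number Λ ≡ number Λ′
      number-cong Λ Λ′ eq = injective _ _ (trans (lookup-number Λ) (trans (vectorOf-cong Λ Λ′ eq) (sym (lookup-number Λ′))))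
      right : ∀ Λ → ∣ semigroupOf (number Λ) ∣ ≐ ∣ Λ ∣
      right Λ@(Λ₀ , mult , frob) = (λ {n} n∈ → L.k≤⇒∈ (subst (_≤ n / m) (coord n) n∈)) , (λ {n} n∈ → subst (_≤ n / m) (sym (coord n)) (L.∈⇒k≤ n∈))
        where
        module L = ToKunz Λ₀ mult frob
        coord : ∀ n → lookup (List.lookup kunz (number Λ)) (residue n) ≡ L.k (residue n)
        coord n = trans (cong (λ v → lookup v (residue n)) (lookup-number Λ)) (lookup∘tabulate L.k (residue n))

-- Choice of the parameters of the container argument

module ParameterChoice where

  open import Data.Nat.Base
  open import Data.Nat.Properties
  open import Data.Nat.DivMod
  open import Data.Nat.Tactic.RingSolver using (solve-∀)
  open import Data.Product.Base using (_×_; _,_; ∃)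
  open import Relation.Binary.PropositionalEquality
  open import Relation.Nullary using (yes; no)
  open Enumeration using (n<K^n)

  -- With u = 2 a the hypothesis gives g + b ≤ 2 (g - u). The product is then at most u (g - u), and
  -- n ≤ 2 ^ n for each factor gives exponents with sum g.
  linear≤2^ : ∀ a b g → 4 * a + b ≤ g → a * (g + b) ≤ 2 ^ g
  linear≤2^ a b g big = begin
    a * (g + b)  ≤⟨ *-monoʳ-≤ a g+b≤ ⟩
    a * (2 * (g ∸ u))  ≡⟨ regroup a (g ∸ u) ⟩
    u * (g ∸ u)  ≤⟨ *-mono-≤ (<⇒≤ (n<K^n ≤-refl u)) (<⇒≤ (n<K^n ≤-refl (g ∸ u))) ⟩
    2 ^ u * 2 ^ (g ∸ u)  ≡⟨ ^-distribˡ-+-* 2 u (g ∸ u) ⟨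
    2 ^ (u + (g ∸ u))  ≡⟨ cong (2 ^_) (m+[n∸m]≡n u≤g) ⟩
    2 ^ g  ∎
    where
    open ≤-Reasoning
    u : ℕ
    u = 2 * a
    regroup : ∀ a x → a * (2 * x) ≡ 2 * a * x
    regroup = solve-∀
    double : ∀ a → 4 * a ≡ 2 * a + 2 * a
    double = solve-∀
    u≤g : u ≤ g
    u≤g = ≤-trans (≤-trans (≤-trans (m≤m+n u u) (≤-reflexive (sym (double a)))) (m≤m+n (4 * a) b)) big
    regroup′ : ∀ g b u → g + b + (u + u) ≡ g + (u + u + b)
    regroup′ = solve-∀
    regroup″ : ∀ x u → (x + u) + (x + u) ≡ 2 * x + (u + u)
    regroup″ = solve-∀
    g+b≤ : g + b ≤ 2 * (g ∸ u)
    g+b≤ = +-cancelʳ-≤ (u + u) _ _ (begin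
      g + b + (u + u)  ≡⟨ regroup′ g b u ⟩
      g + (u + u + b)  ≡⟨ cong (λ x → g + (x + b)) (double a) ⟨
      g + (4 * a + b)  ≤⟨ +-monoʳ-≤ g big ⟩
      g + g  ≡⟨ cong (λ x → x + x) (m∸n+n≡m u≤g) ⟨
      (g ∸ u + u) + (g ∸ u + u)  ≡⟨ regroup″ (g ∸ u) u ⟩
      2 * (g ∸ u) + (u + u)  ∎)

  log₈ : ∀ m → 1 ≤ m → ∃ λ g → 8 ^ g ≤ m × m < 8 ^ suc g
  log₈ 1 _ = 0 , ≤-refl , s≤s (s≤s z≤n)
  log₈ (suc m@(suc _)) _ with log₈ m (s≤s z≤n)
  ... | g , lo , hi with suc m <? 8 ^ suc g
  ...   | yes lt = g , m≤n⇒m≤1+n lo , lt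
  ...   | no ≮   = suc g , ≮⇒≥ ≮ , ≤-<-trans hi (m<n*m (8 ^ suc g) 8 {{m^n≢0 8 (suc g)}} (s≤s (s≤s z≤n)))
    where
    m<n*m : ∀ x y .{{_ : NonZero x}} → 1 < y → x < y * x
    m<n*m x y lt = subst (x <_) (*-comm x y) (m<m*n x y lt)

  ^-distribʳ-* : ∀ n x y → (x * y) ^ n ≡ x ^ n * y ^ n
  ^-distribʳ-* zero    x y = refl
  ^-distribʳ-* (suc n) x y = trans (cong (x * y *_) (^-distribʳ-* n x y)) ([m*n]*[o*p]≡[m*o]*[n*p] x y (x ^ n) (y ^ n))

  record Parameters (q m : ℕ) : Set where
    field
      e d t y : ℕ
      1≤d     : 1 ≤ d
      d≤m     : d ≤ m
      mq≤te   : m * q ≤ t * e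
      me≤dy   : m * e ≤ d * y

    -- The factor by which the square of the count may exceed K: the bound for the number of
    -- certificates, squared, times the price of the exceptional residues.
    overhead : ℕ
    overhead = suc (m * suc q) ^ (d + (t + (1 + y))) * suc (m * suc q) ^ (d + (t + (1 + y))) * ((q + 2) ^ 2) ^ ((d + y) + (d + y) + 1)

  -- With 8 ^ g ≤ m < 8 ^ (g + 1) and e = 2 ^ g, the word lengths d, t and y are O(m / e) over an alphabet of size O(m).
  parameters : ∀ q D → ∃ λ M → ∀ m → 1 ≤ m → M ≤ m → ∃ λ (P : Parameters q m) → Parameters.overhead P ^ D < 4 ^ m
  parameters q D = 8 ^ (4 * A + B) , λ m 1≤m M≤m → choose m 1≤m M≤m (log₈ m 1≤m)
    where
    -- Read off from the factorisation in `exponent≤`; `4 * A + B` is the threshold in `linear≤2^`.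
    A B : ℕ
    A = 3 * (4 * q + 8) * D
    B = q + 3
    choose : ∀ m → 1 ≤ m → 8 ^ (4 * A + B) ≤ m → (∃ λ g → 8 ^ g ≤ m × m < 8 ^ suc g) → ∃ λ (P : Parameters q m) → Parameters.overhead P ^ D < 4 ^ m
    choose m 1≤m M≤m (g , lo , hi) = P , small
      where
      open ≤-Reasoning
      e d μ t y : ℕ
      e = 2 ^ g
      instance
        e≢0 : NonZero e
        e≢0 = m^n≢0 2 g
      d = e * e
      μ = m / e
      -- `μ + 1` rounds m / e up, so that m ≤ (μ + 1) e holds also when e does not divide m.
      t = q * (μ + 1)
      y = μ + 1
      g-large : 4 * A + B ≤ g
      g-large = ≮⇒≥ λ lt → <⇒≱ hi (≤-trans (^-monoʳ-≤ 8 lt) M≤m)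
      e³ : d * e ≡ 8 ^ g
      e³ = trans (cong (_* e) (sym (^-distribʳ-* g 2 2))) (sym (^-distribʳ-* g 4 2))
      1≤d : 1 ≤ d
      1≤d = *-mono-≤ (m^n>0 2 g) (m^n>0 2 g)
      d≤μ : d ≤ μ
      d≤μ = subst (_≤ μ) (m*n/n≡m d e) (/-monoˡ-≤ e (≤-trans (≤-reflexive e³) lo))
      1≤μ : 1 ≤ μ
      1≤μ = ≤-trans 1≤d d≤μ
      m≤ye : m ≤ y * e
      m≤ye = begin
        m  ≡⟨ m≡m%n+[m/n]*n m e ⟩
        m % e + μ * e  ≤⟨ +-monoˡ-≤ (μ * e) (<⇒≤ (m%n<n m e)) ⟩
        e + μ * e  ≡⟨ cong (_* e) (+-comm 1 μ) ⟩
        y * e  ∎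
      P : Parameters q m
      P = record
        { e = e ; d = d ; t = t ; y = y
        ; 1≤d   = 1≤d
        ; d≤m   = ≤-trans (≤-trans (m≤m*n d e) (≤-reflexive e³)) lo
        ; mq≤te = ≤-trans (*-monoˡ-≤ q m≤ye) (≤-reflexive (regroup y e q))
        ; me≤dy = ≤-trans (*-monoˡ-≤ e m≤ye) (≤-reflexive (regroup′ y e))
        }
        where
        regroup : ∀ y e q → y * e * q ≡ q * y * e
        regroup = solve-∀
        regroup′ : ∀ y e → y * e * e ≡ e * e * y
        regroup′ = solve-∀
      Z : ℕ
      Z = suc (m * suc q)
      z : ℕ
      z = 3 * suc g + (q + 2)
      Z≤ : Z ≤ 2 ^ z
      Z≤ = begin
        suc (m * suc q)  ≤⟨ +-monoˡ-≤ (m * suc q) 1≤m ⟩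
        m + m * suc q  ≡⟨ regroup m q ⟩
        m * (q + 2)  ≤⟨ *-mono-≤ (<⇒≤ hi) (<⇒≤ (n<K^n ≤-refl (q + 2))) ⟩
        8 ^ suc g * 2 ^ (q + 2)  ≡⟨ cong (_* 2 ^ (q + 2)) (^-*-assoc 2 3 (suc g)) ⟩
        2 ^ (3 * suc g) * 2 ^ (q + 2)  ≡⟨ ^-distribˡ-+-* 2 (3 * suc g) (q + 2) ⟨
        2 ^ z  ∎
        where
        regroup : ∀ m q → m + m * suc q ≡ m * (q + 2)
        regroup = solve-∀
      C≤ : (q + 2) ^ 2 ≤ 2 ^ ((q + 2) * 2)
      C≤ = ≤-trans (^-monoˡ-≤ 2 (<⇒≤ (n<K^n ≤-refl (q + 2)))) (≤-reflexive (^-*-assoc 2 (q + 2) 2))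
      L l : ℕ
      L = d + (t + (1 + y))
      l = (d + y) + (d + y) + 1
      L≤ : L ≤ (2 * q + 4) * μ
      L≤ = begin
        d + (q * (μ + 1) + (1 + (μ + 1)))  ≤⟨ +-monoˡ-≤ _ d≤μ ⟩
        μ + (q * (μ + 1) + (1 + (μ + 1)))  ≡⟨ regroup μ q ⟩
        (q + 2) * μ + (q + 2) * 1  ≤⟨ +-monoʳ-≤ ((q + 2) * μ) (*-monoʳ-≤ (q + 2) 1≤μ) ⟩
        (q + 2) * μ + (q + 2) * μ  ≡⟨ regroup′ μ q ⟩
        (2 * q + 4) * μ  ∎
        where
        regroup : ∀ μ q → μ + (q * (μ + 1) + (1 + (μ + 1))) ≡ (q + 2) * μ + (q + 2) * 1
        regroup = solve-∀
        regroup′ : ∀ μ q → (q + 2) * μ + (q + 2) * μ ≡ (2 * q + 4) * μ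
        regroup′ = solve-∀
      l≤ : l ≤ 7 * μ
      l≤ = begin
        (d + y) + (d + y) + 1  ≤⟨ +-monoˡ-≤ 1 (+-mono-≤ (+-monoˡ-≤ y d≤μ) (+-monoˡ-≤ y d≤μ)) ⟩
        (μ + (μ + 1)) + (μ + (μ + 1)) + 1  ≡⟨ regroup μ ⟩
        4 * μ + 3 * 1  ≤⟨ +-monoʳ-≤ (4 * μ) (*-monoʳ-≤ 3 1≤μ) ⟩
        4 * μ + 3 * μ  ≡⟨ *-distribʳ-+ μ 4 3 ⟨
        7 * μ  ∎
        where
        regroup : ∀ μ → (μ + (μ + 1)) + (μ + (μ + 1)) + 1 ≡ 4 * μ + 3 * 1
        regroup = solve-∀
      pow : ∀ {x b n n′} → x ≤ 2 ^ b → n ≤ n′ → x ^ n ≤ 2 ^ (b * n′)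
      pow {x} {b} {n} {n′} x≤ n≤ = begin
        x ^ n  ≤⟨ ^-monoˡ-≤ n x≤ ⟩
        (2 ^ b) ^ n  ≤⟨ ^-monoʳ-≤ (2 ^ b) {{m^n≢0 2 b}} n≤ ⟩
        (2 ^ b) ^ n′  ≡⟨ ^-*-assoc 2 b n′ ⟩
        2 ^ (b * n′)  ∎
      exponent : ℕ
      exponent = z * ((2 * q + 4) * μ) + z * ((2 * q + 4) * μ) + (q + 2) * 2 * (7 * μ)
      overhead≤ : Parameters.overhead P ≤ 2 ^ exponent
      overhead≤ = begin
        Z ^ L * Z ^ L * ((q + 2) ^ 2) ^ l
          ≤⟨ *-mono-≤ (*-mono-≤ (pow {b = z} Z≤ L≤) (pow {b = z} Z≤ L≤)) (pow {b = (q + 2) * 2} C≤ l≤) ⟩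
        2 ^ (z * ((2 * q + 4) * μ)) * 2 ^ (z * ((2 * q + 4) * μ)) * 2 ^ ((q + 2) * 2 * (7 * μ))
          ≡⟨ cong (_* 2 ^ ((q + 2) * 2 * (7 * μ))) (^-distribˡ-+-* 2 (z * ((2 * q + 4) * μ)) (z * ((2 * q + 4) * μ))) ⟨
        2 ^ (z * ((2 * q + 4) * μ) + z * ((2 * q + 4) * μ)) * 2 ^ ((q + 2) * 2 * (7 * μ))
          ≡⟨ ^-distribˡ-+-* 2 (z * ((2 * q + 4) * μ) + z * ((2 * q + 4) * μ)) ((q + 2) * 2 * (7 * μ)) ⟨
        2 ^ exponent ∎
      -- The added term completes the part free of g, so that the sum factors as 3 (4 q + 8) (g + q
      -- + 3), times μ and D.
      exponent≤ : exponent * D ≤ A * (g + B) * μ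
      exponent≤ = ≤-trans (m≤m+n _ ((q + 2) * (8 * q + 2) * D * μ)) (≤-reflexive (regroup q g μ D))
        where
        regroup : ∀ q g μ D → ((3 * suc g + (q + 2)) * ((2 * q + 4) * μ) + (3 * suc g + (q + 2)) * ((2 * q + 4) * μ) + (q + 2) * 2 * (7 * μ)) * D
          + (q + 2) * (8 * q + 2) * D * μ ≡ 3 * (4 * q + 8) * D * (g + (q + 3)) * μ
        regroup = solve-∀
      small : Parameters.overhead P ^ D < 4 ^ m
      small = begin-strict
        Parameters.overhead P ^ D  ≤⟨ ^-monoˡ-≤ D overhead≤ ⟩
        (2 ^ exponent) ^ D  ≡⟨ ^-*-assoc 2 exponent D ⟩
        2 ^ (exponent * D)  ≤⟨ ^-monoʳ-≤ 2 exponent≤ ⟩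
        2 ^ (A * (g + B) * μ)  ≤⟨ ^-monoʳ-≤ 2 (*-monoˡ-≤ μ (linear≤2^ A B g g-large)) ⟩
        2 ^ (e * μ)  ≤⟨ ^-monoʳ-≤ 2 (≤-trans (≤-reflexive (*-comm e μ)) (m/n*n≤m m e)) ⟩
        2 ^ m  <⟨ ^-monoʳ-< 2 (s≤s (s≤s z≤n)) (≤-trans (≤-reflexive (+-comm 1 m)) (≤-trans (+-monoʳ-≤ m 1≤m) (≤-reflexive (cong (m +_) (sym (+-identityʳ m)))))) ⟩
        2 ^ (2 * m)  ≡⟨ ^-*-assoc 2 2 m ⟨
        4 ^ m  ∎

-- Powers of rationals: Bernoulli inequalities and density of roots and logarithms

module RationalPowers where

  open import Data.Nat.Base as ℕ using (ℕ; zero; suc; z≤n; s≤s)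
  import Data.Nat.Properties as ℕ
  open import Data.Integer.Base as ℤ using (+_; -[1+_])
  import Data.Integer.Properties as ℤ
  open import Data.Rational.Base
  open import Data.Rational.Properties
  import Data.Rational.Unnormalised.Base as ℚᵘ
  import Data.Rational.Unnormalised.Properties as ℚᵘ
  open import Data.Rational.Solver
  open import Algebra.Definitions.RawSemiring +-*-rawSemiring using (_^_)
  open import Algebra.Bundles using (CommutativeRing)
  open import Algebra.Properties.CommutativeSemiring.Exp (CommutativeRing.commutativeSemiring +-*-commutativeRing) using (^-assocʳ; ^-distrib-*)
  open import Data.Product.Base using (_×_; _,_; proj₁; proj₂; ∃; ∃₂)
  open import Data.Sum.Base using (inj₁; inj₂)
  open import Relation.Binary.PropositionalEquality
  open import Relation.Nullary using (Dec; yes; no; contradiction)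
  open Enumeration using (least; n<K^n)
  open +-*-Solver

  ι : ℕ → ℚ
  ι n = + n / 1

  private
    toℚᵘ-/ : ∀ i d .{{_ : ℕ.NonZero d}} → toℚᵘ (i / d) ℚᵘ.≃ i ℚᵘ./ d
    toℚᵘ-/ i (suc d) = toℚᵘ-fromℚᵘ (ℚᵘ.mkℚᵘ i d)

    toℚᵘ-ι : ∀ n → toℚᵘ (ι n) ℚᵘ.≃ + n ℚᵘ./ 1
    toℚᵘ-ι n = toℚᵘ-/ (+ n) 1

  ι-+ : ∀ m n → ι (m ℕ.+ n) ≡ ι m + ι n
  ι-+ m n = toℚᵘ-injective (begin
    toℚᵘ (ι (m ℕ.+ n))  ≈⟨ toℚᵘ-ι (m ℕ.+ n) ⟩
    + (m ℕ.+ n) ℚᵘ./ 1  ≈⟨ ℚᵘ.*≡* (cong (ℤ._* + 1) (trans (ℤ.pos-+ m n) (cong₂ ℤ._+_ (sym (ℤ.*-identityʳ (+ m))) (sym (ℤ.*-identityʳ (+ n)))))) ⟩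
    (+ m ℚᵘ./ 1) ℚᵘ.+ (+ n ℚᵘ./ 1)  ≈⟨ ℚᵘ.+-cong (toℚᵘ-ι m) (toℚᵘ-ι n) ⟨
    toℚᵘ (ι m) ℚᵘ.+ toℚᵘ (ι n)  ≈⟨ toℚᵘ-homo-+ (ι m) (ι n) ⟨
    toℚᵘ (ι m + ι n)  ∎)
    where open import Relation.Binary.Reasoning.Setoid ℚᵘ.≃-setoid

  ι-* : ∀ m n → ι (m ℕ.* n) ≡ ι m * ι n
  ι-* m n = toℚᵘ-injective (begin
    toℚᵘ (ι (m ℕ.* n))  ≈⟨ toℚᵘ-ι (m ℕ.* n) ⟩
    + (m ℕ.* n) ℚᵘ./ 1  ≈⟨ ℚᵘ.*≡* (cong (ℤ._* + 1) (ℤ.pos-* m n)) ⟩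
    (+ m ℚᵘ./ 1) ℚᵘ.* (+ n ℚᵘ./ 1)  ≈⟨ ℚᵘ.*-cong (toℚᵘ-ι m) (toℚᵘ-ι n) ⟨
    toℚᵘ (ι m) ℚᵘ.* toℚᵘ (ι n)  ≈⟨ toℚᵘ-homo-* (ι m) (ι n) ⟨
    toℚᵘ (ι m * ι n)  ∎)
    where open import Relation.Binary.Reasoning.Setoid ℚᵘ.≃-setoid

  ι-mono-< : ∀ {m n} → m ℕ.< n → ι m < ι n
  ι-mono-< {m} {n} m<n = toℚᵘ-cancel-< (ℚᵘ.<-respˡ-≃ (ℚᵘ.≃-sym (toℚᵘ-ι m)) (ℚᵘ.<-respʳ-≃ (ℚᵘ.≃-sym (toℚᵘ-ι n))
    (ℚᵘ.*<* (subst₂ ℤ._<_ (sym (ℤ.*-identityʳ (+ m))) (sym (ℤ.*-identityʳ (+ n))) (ℤ.+<+ m<n)))))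

  ι-mono-≤ : ∀ {m n} → m ℕ.≤ n → ι m ≤ ι n
  ι-mono-≤ {m} {n} m≤n with ℕ.m≤n⇒m<n∨m≡n m≤n
  ... | inj₁ m<n  = <⇒≤ (ι-mono-< m<n)
  ... | inj₂ refl = ≤-refl

  ι-cancel-< : ∀ {m n} → ι m < ι n → m ℕ.< n
  ι-cancel-< lt = ℕ.≰⇒> λ n≤m → <-irrefl refl (<-≤-trans lt (ι-mono-≤ n≤m))

  ι-cancel-≤ : ∀ {m n} → ι m ≤ ι n → m ℕ.≤ n
  ι-cancel-≤ le = ℕ.≮⇒≥ λ n<m → <-irrefl refl (<-≤-trans (ι-mono-< n<m) le)

  ι-injective : ∀ {m n} → ι m ≡ ι n → m ≡ n
  ι-injective eq = ℕ.≤-antisym (ι-cancel-≤ (≤-reflexive eq)) (ι-cancel-≤ (≤-reflexive (sym eq)))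

  ι-^ : ∀ n k → ι (n ℕ.^ k) ≡ ι n ^ k
  ι-^ n zero    = refl
  ι-^ n (suc k) = trans (ι-* n (n ℕ.^ k)) (cong (ι n *_) (ι-^ n k))

  ι≥0 : ∀ n → 0ℚ ≤ ι n
  ι≥0 n = ι-mono-≤ {0} {n} z≤n

  ι>0 : ∀ n .{{_ : ℕ.NonZero n}} → 0ℚ < ι n
  ι>0 n = ι-mono-< (ℕ.>-nonZero⁻¹ n)

  0<1 : 0ℚ < 1ℚ
  0<1 = ι>0 1

  /-ι : ∀ n d .{{_ : ℕ.NonZero d}} → (+ n / d) * ι d ≡ ι n
  /-ι n d@(suc d-1) = toℚᵘ-injective (begin
    toℚᵘ ((+ n / d) * ι d)  ≈⟨ toℚᵘ-homo-* (+ n / d) (ι d) ⟩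
    toℚᵘ (+ n / d) ℚᵘ.* toℚᵘ (ι d)  ≈⟨ ℚᵘ.*-cong (toℚᵘ-/ (+ n) d) (toℚᵘ-ι d) ⟩
    (+ n ℚᵘ./ d) ℚᵘ.* (+ d ℚᵘ./ 1)  ≈⟨ ℚᵘ.*≡* (trans (ℤ.*-identityʳ (+ n ℤ.* + d)) (cong (λ x → + n ℤ.* + x) (sym (ℕ.*-identityʳ d)))) ⟩
    + n ℚᵘ./ 1  ≈⟨ toℚᵘ-ι n ⟨
    toℚᵘ (ι n)  ∎)
    where open import Relation.Binary.Reasoning.Setoid ℚᵘ.≃-setoid

  ↥≡+⇒ι : ∀ p {n} → ↥ p ≡ + n → p * ι (↧ₙ p) ≡ ι n
  ↥≡+⇒ι p {n} eq = trans (cong (_* ι (↧ₙ p)) (trans (sym (↥p/↧p≡p p)) (cong (λ i → i / ↧ₙ p) eq))) (/-ι n (↧ₙ p))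

  *ˡ-< : ∀ {r x y} → 0ℚ < r → x < y → r * x < r * y
  *ˡ-< {r} 0<r = *-monoʳ-<-pos r {{positive 0<r}}

  *ʳ-< : ∀ {r x y} → 0ℚ < r → x < y → x * r < y * r
  *ʳ-< {r} 0<r = *-monoˡ-<-pos r {{positive 0<r}}

  *ˡ-≤ : ∀ {r x y} → 0ℚ ≤ r → x ≤ y → r * x ≤ r * y
  *ˡ-≤ {r} 0≤r = *-monoˡ-≤-nonNeg r {{nonNegative 0≤r}}

  *ʳ-≤ : ∀ {r x y} → 0ℚ ≤ r → x ≤ y → x * r ≤ y * r
  *ʳ-≤ {r} 0≤r = *-monoʳ-≤-nonNeg r {{nonNegative 0≤r}}

  *-cancel-< : ∀ {r x y} → 0ℚ < r → x * r < y * r → x < y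
  *-cancel-< {r} 0<r = *-cancelʳ-<-nonNeg r {{pos⇒nonNeg r {{positive 0<r}}}}

  *-pos : ∀ {x y} → 0ℚ < x → 0ℚ < y → 0ℚ < x * y
  *-pos {x} {y} 0<x 0<y = subst (_< x * y) (*-zeroʳ x) (*ˡ-< 0<x 0<y)

  *-nonNeg : ∀ {x y} → 0ℚ ≤ x → 0ℚ ≤ y → 0ℚ ≤ x * y
  *-nonNeg {x} {y} 0≤x 0≤y = subst (_≤ x * y) (*-zeroʳ x) (*ˡ-≤ 0≤x 0≤y)

  *-mono-≤ : ∀ {x y u v} → 0ℚ ≤ x → 0ℚ ≤ v → x ≤ y → u ≤ v → x * u ≤ y * v
  *-mono-≤ 0≤x 0≤v x≤y u≤v = ≤-trans (*ˡ-≤ 0≤x u≤v) (*ʳ-≤ 0≤v x≤y)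

  *-mono-< : ∀ {x y u v} → 0ℚ ≤ x → 0ℚ < v → x < y → u < v → x * u < y * v
  *-mono-< 0≤x 0<v x<y u<v = ≤-<-trans (*ˡ-≤ 0≤x (<⇒≤ u<v)) (*ʳ-< 0<v x<y)

  ^-pos : ∀ {x} n → 0ℚ < x → 0ℚ < x ^ n
  ^-pos zero    0<x = 0<1
  ^-pos (suc n) 0<x = *-pos 0<x (^-pos n 0<x)

  ^-nonNeg : ∀ {x} n → 0ℚ ≤ x → 0ℚ ≤ x ^ n
  ^-nonNeg zero    0≤x = <⇒≤ 0<1
  ^-nonNeg (suc n) 0≤x = *-nonNeg 0≤x (^-nonNeg n 0≤x)

  ^-monoˡ-≤ : ∀ {x y} n → 0ℚ ≤ x → x ≤ y → x ^ n ≤ y ^ n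
  ^-monoˡ-≤ zero    0≤x x≤y = ≤-refl
  ^-monoˡ-≤ (suc n) 0≤x x≤y = *-mono-≤ 0≤x (^-nonNeg n (≤-trans 0≤x x≤y)) x≤y (^-monoˡ-≤ n 0≤x x≤y)

  ^-monoˡ-< : ∀ {x y} n .{{_ : ℕ.NonZero n}} → 0ℚ ≤ x → x < y → x ^ n < y ^ n
  ^-monoˡ-< (suc n) 0≤x x<y = ≤-<-trans (*ˡ-≤ 0≤x (^-monoˡ-≤ n 0≤x (<⇒≤ x<y))) (*ʳ-< (^-pos n (≤-<-trans 0≤x x<y)) x<y)

  ^-cancelˡ-< : ∀ {x y} n → 0ℚ ≤ y → x ^ n < y ^ n → x < y
  ^-cancelˡ-< {x} {y} n 0≤y lt with x <? y
  ... | yes x<y = x<y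
  ... | no x≮y  = contradiction (<-≤-trans lt (^-monoˡ-≤ n 0≤y (≮⇒≥ x≮y))) (<-irrefl refl)

  1≤^ : ∀ {x} n → 1ℚ ≤ x → 1ℚ ≤ x ^ n
  1≤^ zero    1≤x = ≤-refl
  1≤^ (suc n) 1≤x = *-mono-≤ (<⇒≤ 0<1) (≤-trans (<⇒≤ 0<1) (1≤^ n 1≤x)) 1≤x (1≤^ n 1≤x)

  -- x < y ^ (n / d) does not depend on the fraction representing the exponent.
  ^-cross : ∀ {x y} n d n′ d′ → .{{_ : ℕ.NonZero d′}} → n ℕ.* d′ ≡ n′ ℕ.* d → 0ℚ ≤ x → 0ℚ ≤ y →
    x ^ d < y ^ n → x ^ d′ < y ^ n′
  ^-cross {x} {y} n d n′ d′ eq 0≤x 0≤y lt = ^-cancelˡ-< d (^-nonNeg n′ 0≤y) (begin-strict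
    (x ^ d′) ^ d  ≡⟨ ^-assocʳ x d′ d ⟩
    x ^ (d′ ℕ.* d)  ≡⟨ cong (x ^_) (ℕ.*-comm d′ d) ⟩
    x ^ (d ℕ.* d′)  ≡⟨ ^-assocʳ x d d′ ⟨
    (x ^ d) ^ d′  <⟨ ^-monoˡ-< d′ (^-nonNeg d 0≤x) lt ⟩
    (y ^ n) ^ d′  ≡⟨ ^-assocʳ y n d′ ⟩
    y ^ (n ℕ.* d′)  ≡⟨ cong (y ^_) eq ⟩
    y ^ (n′ ℕ.* d)  ≡⟨ ^-assocʳ y n′ d ⟨
    (y ^ n′) ^ d  ∎)
    where open ≤-Reasoning

  abstract
    archimedean : ∀ x → ∃ λ n → x < ι n
    archimedean (mkℚ -[1+ n ] d-1 c) = 0 , negative⁻¹ (mkℚ -[1+ n ] d-1 c)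
    archimedean x@(mkℚ (+ n) d-1 c) = suc n , *-cancel-< (ι>0 (suc d-1)) (begin-strict
      x * ι (suc d-1)  ≡⟨ ↥≡+⇒ι x refl ⟩
      ι n  <⟨ ι-mono-< (ℕ.n<1+n n) ⟩
      ι (suc n)  ≤⟨ ι-mono-≤ (ℕ.m≤m*n (suc n) (suc d-1)) ⟩
      ι (suc n ℕ.* suc d-1)  ≡⟨ ι-* (suc n) (suc d-1) ⟩
      ι (suc n) * ι (suc d-1)  ∎)
      where open ≤-Reasoning

    archimedean-* : ∀ x {y} → 0ℚ < y → ∃ λ n → x < ι n * y
    archimedean-* x {y} 0<y = let n , lt = archimedean (x * y⁻¹) in n , (begin-strict
      x  ≡⟨ *-identityʳ x ⟨
      x * 1ℚ  ≡⟨ cong (x *_) (*-inverseˡ y) ⟨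
      x * (y⁻¹ * y)  ≡⟨ *-assoc x y⁻¹ y ⟨
      x * y⁻¹ * y  <⟨ *ʳ-< 0<y lt ⟩
      ι n * y  ∎)
      where
      open ≤-Reasoning
      instance
        y≢0 : NonZero y
        y≢0 = >-nonZero 0<y
      y⁻¹ : ℚ
      y⁻¹ = 1/ y

  ι-suc : ∀ n → ι (suc n) ≡ 1ℚ + ι n
  ι-suc n = ι-+ 1 n

  p<q⇒0<q-p : ∀ {p q} → p < q → 0ℚ < q - p
  p<q⇒0<q-p {p} {q} p<q = subst (_< q - p) (+-inverseʳ p) (+-monoˡ-< (- p) p<q)

  0≤p*p : ∀ p → 0ℚ ≤ p * p
  0≤p*p p with ≤-total 0ℚ p
  ... | inj₁ 0≤p = *-nonNeg 0≤p 0≤p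
  ... | inj₂ p≤0 = subst (_≤ p * p) (*-zeroʳ p) (*-monoˡ-≤-nonPos p {{nonPositive p≤0}} p≤0)

  p≤p+q : ∀ {p q} → 0ℚ ≤ q → p ≤ p + q
  p≤p+q {p} {q} 0≤q = subst (_≤ p + q) (+-identityʳ p) (+-monoʳ-≤ p 0≤q)

  bernoulli : ∀ δ → 0ℚ ≤ δ → δ ≤ 1ℚ → ∀ k → 1ℚ - ι k * δ ≤ (1ℚ - δ) ^ k
  bernoulli δ 0≤δ δ≤1 zero    = ≤-reflexive (trans (cong (λ x → 1ℚ - x) (*-zeroˡ δ)) (+-identityʳ 1ℚ))
  bernoulli δ 0≤δ δ≤1 (suc k) = begin
    1ℚ - ι (suc k) * δ  ≤⟨ p≤p+q (*-nonNeg (ι≥0 k) (0≤p*p δ)) ⟩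
    1ℚ - ι (suc k) * δ + ι k * (δ * δ)  ≡⟨ cong (λ x → 1ℚ - x * δ + ι k * (δ * δ)) (ι-suc k) ⟩
    1ℚ - (1ℚ + ι k) * δ + ι k * (δ * δ)  ≡⟨ solve 2 (λ x d → con 1ℚ :- (con 1ℚ :+ x) :* d :+ x :* (d :* d) := (con 1ℚ :- d) :* (con 1ℚ :- x :* d)) refl (ι k) δ ⟩
    (1ℚ - δ) * (1ℚ - ι k * δ)  ≤⟨ *ˡ-≤ (subst (_≤ 1ℚ - δ) (+-inverseʳ δ) (+-monoˡ-≤ (- δ) δ≤1)) (bernoulli δ 0≤δ δ≤1 k) ⟩
    (1ℚ - δ) * (1ℚ - δ) ^ k  ∎
    where open ≤-Reasoning

  -- Induction with (1 - δ) (1 + (i + 1) δ) ≤ 1 + i δ. The powers decay at least like 1 / (1 + i δ),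
  -- which reduces their vanishing to the archimedean property.
  decay : ∀ δ → 0ℚ ≤ δ → δ ≤ 1ℚ → ∀ i → (1ℚ - δ) ^ i * (1ℚ + ι i * δ) ≤ 1ℚ
  decay δ 0≤δ δ≤1 zero    = ≤-reflexive (trans (*-identityˡ _) (trans (cong (λ x → 1ℚ + x) (*-zeroˡ δ)) (+-identityʳ 1ℚ)))
  decay δ 0≤δ δ≤1 (suc i) = begin
    σ * σ ^ i * (1ℚ + ι (suc i) * δ)  ≡⟨ solve 3 (λ x y z → x :* y :* z := y :* (x :* z)) refl σ (σ ^ i) (1ℚ + ι (suc i) * δ) ⟩
    σ ^ i * (σ * (1ℚ + ι (suc i) * δ))  ≤⟨ *ˡ-≤ (^-nonNeg i 0≤σ) (begin
      σ * (1ℚ + ι (suc i) * δ)  ≤⟨ p≤p+q (*-nonNeg (ι≥0 (suc i)) (0≤p*p δ)) ⟩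
      σ * (1ℚ + ι (suc i) * δ) + ι (suc i) * (δ * δ)
        ≡⟨ cong (λ x → σ * (1ℚ + x * δ) + x * (δ * δ)) (ι-suc i) ⟩
      σ * (1ℚ + (1ℚ + ι i) * δ) + (1ℚ + ι i) * (δ * δ)
        ≡⟨ solve 2 (λ x d → (con 1ℚ :- d) :* (con 1ℚ :+ (con 1ℚ :+ x) :* d) :+ (con 1ℚ :+ x) :* (d :* d) := con 1ℚ :+ x :* d) refl (ι i) δ ⟩
      1ℚ + ι i * δ  ∎) ⟩
    σ ^ i * (1ℚ + ι i * δ)  ≤⟨ decay δ 0≤δ δ≤1 i ⟩
    1ℚ  ∎
    where
    open ≤-Reasoning
    σ : ℚ
    σ = 1ℚ - δ
    0≤σ : 0ℚ ≤ σ
    0≤σ = subst (_≤ σ) (+-inverseʳ δ) (+-monoˡ-≤ (- δ) δ≤1)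

  abstract
    powers-vanish : ∀ δ → 0ℚ < δ → δ < 1ℚ → ∀ x {y} → 0ℚ < y → ∃ λ i → x * (1ℚ - δ) ^ i < y
    powers-vanish δ 0<δ δ<1 x {y} 0<y = let i , lt = archimedean-* x (*-pos 0<δ 0<y) in i , (begin-strict
      x * σ ^ i  <⟨ *ʳ-< (^-pos i (p<q⇒0<q-p δ<1)) lt ⟩
      ι i * (δ * y) * σ ^ i  ≡⟨ solve 4 (λ a b c d → a :* (b :* c) :* d := a :* b :* (c :* d)) refl (ι i) δ y (σ ^ i) ⟩
      ι i * δ * (y * σ ^ i)  ≤⟨ *ʳ-≤ (*-nonNeg (<⇒≤ 0<y) (^-nonNeg i (<⇒≤ (p<q⇒0<q-p δ<1))))
                                                (subst (_≤ 1ℚ + ι i * δ) (+-identityˡ (ι i * δ)) (+-monoˡ-≤ (ι i * δ) (<⇒≤ 0<1))) ⟩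
      (1ℚ + ι i * δ) * (y * σ ^ i)  ≡⟨ solve 3 (λ a b c → a :* (b :* c) := b :* (c :* a)) refl (1ℚ + ι i * δ) y (σ ^ i) ⟩
      y * (σ ^ i * (1ℚ + ι i * δ))  ≤⟨ *ˡ-≤ (<⇒≤ 0<y) (decay δ (<⇒≤ 0<δ) (<⇒≤ δ<1) i) ⟩
      y * 1ℚ  ≡⟨ *-identityʳ y ⟩
      y  ∎)
      where
      open ≤-Reasoning
      σ : ℚ
      σ = 1ℚ - δ

  x≤x^k : ∀ {x} k .{{_ : ℕ.NonZero k}} → 1ℚ ≤ x → x ≤ x ^ k
  x≤x^k {x} (suc k) 1≤x = subst (_≤ x * x ^ k) (*-identityʳ x) (*ˡ-≤ (≤-trans (<⇒≤ 0<1) 1≤x) (1≤^ k 1≤x))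

  ^≤1 : ∀ {x} k → 0ℚ ≤ x → x ≤ 1ℚ → x ^ k ≤ 1ℚ
  ^≤1 zero    0≤x x≤1 = ≤-refl
  ^≤1 (suc k) 0≤x x≤1 = *-mono-≤ 0≤x (<⇒≤ 0<1) x≤1 (^≤1 k 0≤x x≤1)

  x^k≤x : ∀ {x} k .{{_ : ℕ.NonZero k}} → 0ℚ ≤ x → x ≤ 1ℚ → x ^ k ≤ x
  x^k≤x {x} (suc k) 0≤x x≤1 = subst (x * x ^ k ≤_) (*-identityʳ x) (*ˡ-≤ 0≤x (^≤1 k 0≤x x≤1))

  abstract
    small : ∀ {v} → 0ℚ < v → ∃ λ y → 0ℚ < y × y ≤ 1ℚ × y ≤ v
    small {v} 0<v with ≤-total v 1ℚ
    ... | inj₁ v≤1 = v , 0<v , v≤1 , ≤-refl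
    ... | inj₂ 1≤v = 1ℚ , 0<1 , ≤-refl , 1≤v

  -- Walk down a geometric progression whose ratio is so close to 1 that it cannot jump over (u , v).
  abstract
    root-dense : ∀ {u v} k .{{_ : ℕ.NonZero k}} → 0ℚ ≤ u → u < v → ∃ λ t → 0ℚ < t × u < t ^ k × t ^ k < v
    root-dense {u} {v} k 0≤u u<v = go (least P? i₀ P-i₀)
      where
      open ≤-Reasoning
      0<v : 0ℚ < v
      0<v = ≤-<-trans 0≤u u<v
      -- By Bernoulli, one step of ratio 1 - 1 / D multiplies the k-th power by at least 1 - k / D.
      -- Starting at `v` or above, it then lands above `u`.
      fine : ∃ λ D → ι k * v < ι D * (v - u)
      fine = archimedean-* (ι k * v) (p<q⇒0<q-p u<v)
      D : ℕ
      -- At least 2, so that δ = 1 / D is less than 1.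
      D = suc (suc (proj₁ fine))
      δ σ : ℚ
      δ = + 1 / D
      σ = 1ℚ - δ
      δD : δ * ι D ≡ 1ℚ
      δD = /-ι 1 D
      0<δ : 0ℚ < δ
      0<δ = *-cancel-< (ι>0 D) (subst₂ _<_ (sym (*-zeroˡ (ι D))) (sym δD) 0<1)
      δ<1 : δ < 1ℚ
      δ<1 = *-cancel-< (ι>0 D) (subst₂ _<_ (sym δD) (sym (*-identityˡ (ι D))) (ι-mono-< {1} {D} (s≤s (s≤s z≤n))))
      0<σ : 0ℚ < σ
      0<σ = p<q⇒0<q-p δ<1
      Dηδ : ι D * (v - u) * δ ≡ v - u
      Dηδ = trans (solve 3 (λ a b c → a :* b :* c := c :* a :* b) refl (ι D) (v - u) δ)
                  (trans (cong (_* (v - u)) δD) (*-identityˡ (v - u)))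
      u<σᵏv : u < σ ^ k * v
      u<σᵏv = begin-strict
        u  ≡⟨ solve 2 (λ u v → u := v :- (v :- u)) refl u v ⟩
        v - (v - u)  ≡⟨ cong (λ x → v - x) Dηδ ⟨
        v - ι D * (v - u) * δ  <⟨ +-monoʳ-< v (neg-antimono-< (*ʳ-< 0<δ (<-≤-trans (proj₂ fine) (*ʳ-≤ (<⇒≤ (p<q⇒0<q-p u<v)) (ι-mono-≤ {proj₁ fine} {D} (ℕ.≤-trans (ℕ.n≤1+n _) (ℕ.n≤1+n _))))))) ⟩
        v - ι k * v * δ  ≡⟨ solve 3 (λ k v d → v :- k :* v :* d := (con 1ℚ :- k :* d) :* v) refl (ι k) v δ ⟩
        (1ℚ - ι k * δ) * v  ≤⟨ *ʳ-≤ (<⇒≤ 0<v) (bernoulli δ (<⇒≤ 0<δ) (<⇒≤ δ<1) k) ⟩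
        σ ^ k * v  ∎
      initial : ∃ λ n → v < ι n
      initial = archimedean v
      s : ℚ
      s = ι (suc (proj₁ initial))
      1≤s : 1ℚ ≤ s
      1≤s = ι-mono-≤ {1} {suc (proj₁ initial)} (s≤s z≤n)
      v<s : v < s
      v<s = <-≤-trans (proj₂ initial) (ι-mono-≤ (ℕ.n≤1+n (proj₁ initial)))
      P : ℕ → Set
      P i = (s * σ ^ i) ^ k < v
      P? : ∀ i → Dec (P i)
      P? i = (s * σ ^ i) ^ k <? v
      sσ>0 : ∀ i → 0ℚ < s * σ ^ i
      sσ>0 i = *-pos (<-≤-trans 0<1 1≤s) (^-pos i 0<σ)
      target : ∃ λ y → 0ℚ < y × y ≤ 1ℚ × y ≤ v
      target = small 0<v
      final : ∃ λ i → s * σ ^ i < proj₁ target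
      final = powers-vanish δ 0<δ δ<1 s (proj₁ (proj₂ target))
      i₀ : ℕ
      i₀ = proj₁ final
      P-i₀ : P i₀
      P-i₀ = let y , 0<y , y≤1 , y≤v = target in
        <-≤-trans (^-monoˡ-< k (<⇒≤ (sσ>0 i₀)) (proj₂ final)) (≤-trans (x^k≤x k (<⇒≤ 0<y) y≤1) y≤v)
      go : (∃ λ i → P i × (∀ j → P j → i ℕ.≤ j)) → ∃ λ t → 0ℚ < t × u < t ^ k × t ^ k < v
      -- The progression starts at s > v with s ≥ 1, so already s ^ k is above `v` and the least
      -- index is positive.
      go (zero  , p , _)   = contradiction (<-≤-trans v<s (≤-trans (x≤x^k k 1≤s) (≤-reflexive (cong (_^ k) (sym (*-identityʳ s)))))) (<-asym p)
      go (suc i , p , min) = s * σ ^ suc i , sσ>0 (suc i) , (begin-strict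
        u  <⟨ u<σᵏv ⟩
        σ ^ k * v  ≤⟨ *ˡ-≤ (^-nonNeg k (<⇒≤ 0<σ)) (≮⇒≥ (λ pᵢ → ℕ.<⇒≱ (ℕ.n<1+n i) (min i pᵢ))) ⟩
        σ ^ k * (s * σ ^ i) ^ k  ≡⟨ ^-distrib-* σ (s * σ ^ i) k ⟨
        (σ * (s * σ ^ i)) ^ k  ≡⟨ cong (_^ k) (solve 3 (λ a b c → a :* (b :* c) := b :* (a :* c)) refl σ s (σ ^ i)) ⟩
        (s * σ ^ suc i) ^ k  ∎) , p

  -- Bernoulli's inequality for 1 + η / u, multiplied by u ^ (d + 1) to avoid the division.
  power-growth : ∀ {u} η → 0ℚ ≤ u → 0ℚ ≤ η → ∀ d → u ^ d * (u + ι d * η) ≤ u * (u + η) ^ d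
  power-growth {u} η 0≤u 0≤η zero    = ≤-reflexive (trans (cong (λ x → 1ℚ * (u + x)) (*-zeroˡ η)) (solve 1 (λ u → con 1ℚ :* (u :+ con 0ℚ) := u :* con 1ℚ) refl u))
  power-growth {u} η 0≤u 0≤η (suc d) = begin
    u * u ^ d * (u + ι (suc d) * η)  ≡⟨ cong (λ x → u * u ^ d * (u + x * η)) (ι-suc d) ⟩
    u * u ^ d * (u + (1ℚ + ι d) * η)  ≤⟨ p≤p+q (*-nonNeg (^-nonNeg d 0≤u) (*-nonNeg (ι≥0 d) (0≤p*p η))) ⟩
    u * u ^ d * (u + (1ℚ + ι d) * η) + u ^ d * (ι d * (η * η))
      ≡⟨ solve 4 (λ u w x e → u :* w :* (u :+ (con 1ℚ :+ x) :* e) :+ w :* (x :* (e :* e)) := (u :+ e) :* (w :* (u :+ x :* e))) refl u (u ^ d) (ι d) η ⟩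
    (u + η) * (u ^ d * (u + ι d * η))  ≤⟨ *ˡ-≤ (≤-trans 0≤u (p≤p+q 0≤η)) (power-growth η 0≤u 0≤η d) ⟩
    (u + η) * (u * (u + η) ^ d)  ≡⟨ solve 3 (λ a b c → a :* (b :* c) := b :* (a :* c)) refl (u + η) u ((u + η) ^ d) ⟩
    u * ((u + η) * (u + η) ^ d)  ∎
    where open ≤-Reasoning

  abstract
    -- Once (v / u) ^ d exceeds K, consecutive powers of K cannot jump over the interval from u ^ d
    -- to v ^ d, so the first power past u ^ d falls inside. The fraction n / d then lies between
    -- the logarithms of u and v.
    log-dense : ∀ {K u v} → 2 ℕ.≤ K → 1ℚ ≤ u → u < v →
      ∃₂ λ n d → ℕ.NonZero n × ℕ.NonZero d × u ^ d < ι (K ℕ.^ n) × ι (K ℕ.^ n) < v ^ d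
    log-dense {K} {u} {v} 2≤K 1≤u u<v = go (least (λ n → u ^ d <? ι (K ℕ.^ n)) (proj₁ big)
        (<-≤-trans (proj₂ big) (ι-mono-≤ (ℕ.<⇒≤ (n<K^n 2≤K (proj₁ big))))))
      where
      open ≤-Reasoning
      0<u : 0ℚ < u
      0<u = <-≤-trans 0<1 1≤u
      η : ℚ
      η = v - u
      u+η : u + η ≡ v
      u+η = solve 2 (λ u v → u :+ (v :- u) := v) refl u v
      0<η : 0ℚ < η
      0<η = p<q⇒0<q-p u<v
      enough : ∃ λ d → ι K * u < ι d * η
      enough = archimedean-* (ι K * u) 0<η
      d : ℕ
      d = suc (proj₁ enough)
      Kuᵈ<vᵈ : ι K * u ^ d < v ^ d
      Kuᵈ<vᵈ = *-cancel-< 0<u (begin-strict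
        ι K * u ^ d * u  ≡⟨ solve 3 (λ a b c → a :* b :* c := b :* (a :* c)) refl (ι K) (u ^ d) u ⟩
        u ^ d * (ι K * u)  <⟨ *ˡ-< (^-pos d 0<u) (proj₂ enough) ⟩
        u ^ d * (ι (proj₁ enough) * η) ≤⟨ *ˡ-≤ (^-nonNeg d (<⇒≤ 0<u)) (≤-trans (*ʳ-≤ (<⇒≤ 0<η) (ι-mono-≤ (ℕ.n≤1+n (proj₁ enough))))
                                           (subst (_≤ u + ι d * η) (+-identityˡ (ι d * η)) (+-monoˡ-≤ (ι d * η) (<⇒≤ 0<u)))) ⟩
        u ^ d * (u + ι d * η)  ≤⟨ power-growth η (<⇒≤ 0<u) (<⇒≤ 0<η) d ⟩
        u * (u + η) ^ d  ≡⟨ cong (λ x → u * x ^ d) u+η ⟩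
        u * v ^ d  ≡⟨ *-comm u (v ^ d) ⟩
        v ^ d * u  ∎)
      big : ∃ λ M → u ^ d < ι M
      big = archimedean (u ^ d)
      go : (∃ λ n → u ^ d < ι (K ℕ.^ n) × (∀ j → u ^ d < ι (K ℕ.^ j) → n ℕ.≤ j)) →
        ∃₂ λ n d → ℕ.NonZero n × ℕ.NonZero d × u ^ d < ι (K ℕ.^ n) × ι (K ℕ.^ n) < v ^ d
      go (zero  , lt , _)   = contradiction (<-≤-trans lt (1≤^ d 1≤u)) (<-irrefl refl)
      go (suc n , lt , min) = suc n , d , _ , _ , lt , (begin-strict
        ι (K ℕ.* K ℕ.^ n)  ≡⟨ ι-* K (K ℕ.^ n) ⟩
        ι K * ι (K ℕ.^ n)  ≤⟨ *ˡ-≤ (ι≥0 K) (≮⇒≥ (λ lt′ → ℕ.<⇒≱ (ℕ.n<1+n n) (min n lt′))) ⟩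
        ι K * u ^ d  <⟨ Kuᵈ<vᵈ ⟩
        v ^ d  ∎)

-- Cuts that are roots of integers: rational powers and products

module Roots where

  open import Defs
  open import Data.Nat.Base as ℕ using (ℕ; zero; suc; z≤n; s≤s)
  import Data.Nat.Properties as ℕ
  open import Data.Integer.Base using (+_; -[1+_])
  open import Data.Rational.Base
  open import Data.Rational.Properties
  open import Data.Rational.Solver
  open import Algebra.Definitions.RawSemiring +-*-rawSemiring using (_^_)
  open import Algebra.Bundles using (CommutativeRing)
  open import Algebra.Properties.CommutativeSemiring.Exp (CommutativeRing.commutativeSemiring +-*-commutativeRing) using (^-assocʳ; ^-distrib-*)
  open import Data.Product.Base using (_×_; _,_; proj₁; ∃)
  open import Data.Sum.Base using (inj₁; inj₂)
  open import Relation.Binary.PropositionalEquality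
  open import Relation.Unary using (_∈_)
  open import Relation.Nullary using (¬_; contradiction)
  open RationalPowers
  open +-*-Solver

  cross-multiply : ∀ r n d n′ d′ → r * ι d ≡ ι n → r * ι d′ ≡ ι n′ → n ℕ.* d′ ≡ n′ ℕ.* d
  cross-multiply r n d n′ d′ eq eq′ = ι-injective (begin
    ι (n ℕ.* d′)  ≡⟨ ι-* n d′ ⟩
    ι n * ι d′  ≡⟨ cong (_* ι d′) eq ⟨
    r * ι d * ι d′  ≡⟨ solve 3 (λ a b c → a :* b :* c := a :* c :* b) refl r (ι d) (ι d′) ⟩
    r * ι d′ * ι d  ≡⟨ cong (_* ι d) eq′ ⟩
    ι n′ * ι d  ≡⟨ ι-* n′ d ⟨
    ι (n′ ℕ.* d)  ∎)
    where open ≡-Reasoning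

  negative-*ι : ∀ r d .{{_ : ℕ.NonZero d}} → r < 0ℚ → r * ι d < 0ℚ
  negative-*ι r d r<0 = subst (r * ι d <_) (*-zeroˡ (ι d)) (*ʳ-< (ι>0 d) r<0)

  not-negative : ∀ r n d .{{_ : ℕ.NonZero d}} → r * ι d ≡ ι n → ¬ r < 0ℚ
  not-negative r n d eq r<0 = <-irrefl refl (≤-<-trans (ι≥0 n) (subst (_< 0ℚ) eq (negative-*ι r d r<0)))

  module _ {p t : ℚ} (0<p : 0ℚ < p) (0<t : 0ℚ < t) where

    -- `BelowPow` reads the exponent in lowest terms; these conversions admit any fraction of the
    -- same value, such as one with denominator m.
    BelowPow⁺ : ∀ r n d .{{_ : ℕ.NonZero d}} → r * ι d ≡ ι n → p ^ d < t ^ n → BelowPow p t r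
    BelowPow⁺ r@(mkℚ (+ n′) d-1 _)    n d eq = ^-cross n d n′ (suc d-1) (cross-multiply r n d n′ (suc d-1) eq (↥≡+⇒ι r refl)) (<⇒≤ 0<p) (<⇒≤ 0<t)
    BelowPow⁺ r@(mkℚ -[1+ _ ] _ _) n d eq = contradiction (negative⁻¹ r) (not-negative r n d eq)

    BelowPow⁻ : ∀ r n d .{{_ : ℕ.NonZero d}} → r * ι d ≡ ι n → BelowPow p t r → p ^ d < t ^ n
    BelowPow⁻ r@(mkℚ (+ n′) d-1 _)    n d eq = ^-cross n′ (suc d-1) n d (cross-multiply r n′ (suc d-1) n d (↥≡+⇒ι r refl) eq) (<⇒≤ 0<p) (<⇒≤ 0<t)
    BelowPow⁻ r@(mkℚ -[1+ _ ] _ _) n d eq = contradiction (negative⁻¹ r) (not-negative r n d eq)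

    -- ^-cross with the roles of numerators and denominators exchanged handles the opposite inequality.
    AbovePow⁺ : ∀ r n d .{{_ : ℕ.NonZero n}} .{{_ : ℕ.NonZero d}} → r * ι d ≡ ι n → t ^ n < p ^ d → AbovePow p t r
    AbovePow⁺ r@(mkℚ (+ zero) d-1 _)  n d eq = contradiction (subst₂ _<_ refl (trans (sym eq) (trans (cong (_* ι d) (↥p≡0⇒p≡0 r refl)) (*-zeroˡ (ι d)))) (ι>0 n)) (<-irrefl refl)
    AbovePow⁺ r@(mkℚ (+ suc n′) d-1 _)  n d eq = ^-cross d n (suc d-1) (suc n′)
      (trans (ℕ.*-comm d (suc n′)) (trans (sym (cross-multiply r n d (suc n′) (suc d-1) eq (↥≡+⇒ι r refl))) (ℕ.*-comm n (suc d-1)))) (<⇒≤ 0<t) (<⇒≤ 0<p)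
    AbovePow⁺ r@(mkℚ -[1+ _ ] _ _) n d eq = contradiction (negative⁻¹ r) (not-negative r n d eq)

    AbovePow⁻ : ∀ r n d .{{_ : ℕ.NonZero n}} .{{_ : ℕ.NonZero d}} → r * ι d ≡ ι n → AbovePow p t r → t ^ n < p ^ d
    AbovePow⁻ r@(mkℚ (+ n′) d-1 _)  n d eq = ^-cross (suc d-1) n′ d n
      (trans (ℕ.*-comm (suc d-1) n) (trans (cross-multiply r n d n′ (suc d-1) eq (↥≡+⇒ι r refl)) (ℕ.*-comm n′ d))) (<⇒≤ 0<t) (<⇒≤ 0<p)
    AbovePow⁻ r@(mkℚ -[1+ _ ] _ _) n d eq = contradiction (negative⁻¹ r) (not-negative r n d eq)

  -- x is the positive real number with x ^ k = X, as far as positive rationals can tell.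
  record IsRoot (x : Cut) (k X : ℕ) : Set where
    field
      below⁺ : ∀ {p} → 0ℚ < p → p ^ k < ι X → p ∈ below x
      below⁻ : ∀ {p} → 0ℚ < p → p ∈ below x → p ^ k < ι X
      above⁺ : ∀ {p} → 0ℚ < p → ι X < p ^ k → p ∈ above x
      above⁻ : ∀ {p} → p ∈ above x → 0ℚ < p × ι X < p ^ k

  ^-swap : ∀ x m n → (x ^ m) ^ n ≡ (x ^ n) ^ m
  ^-swap x m n = trans (^-assocʳ x m n) (trans (cong (x ^_) (ℕ.*-comm m n)) (sym (^-assocʳ x n m)))

  √-root : ∀ n → IsRoot (√ n) 2 n
  √-root n = record
    { below⁺ = λ {p} 0<p lt → inj₂ (subst (_< ι n) (square p) lt)
    ; below⁻ = λ {p} 0<p → λ { (inj₁ p<0) → contradiction p<0 (<-asym 0<p) ; (inj₂ lt) → subst (_< ι n) (sym (square p)) lt }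
    ; above⁺ = λ {p} 0<p lt → 0<p , subst (ι n <_) (square p) lt
    ; above⁻ = λ {p} → λ { (0<p , lt) → 0<p , subst (ι n <_) (sym (square p)) lt }
    }
    where
    square : ∀ p → p ^ 2 ≡ p * p
    square p = cong (p *_) (*-identityʳ p)

  module _ {x : Cut} {k X : ℕ} {{_ : ℕ.NonZero k}} {{_ : ℕ.NonZero X}} (x-root : IsRoot x k X) where
    open IsRoot x-root

    ∃-below : ∃ λ t → 0ℚ < t × t ∈ below x
    ∃-below = let t , 0<t , _ , lt = root-dense k ≤-refl (ι>0 X) in t , 0<t , below⁺ 0<t lt

    ∃-above : ∃ λ t → 0ℚ < t × t ∈ above x
    ∃-above = ι (suc X) , ι>0 (suc X) , above⁺ (ι>0 (suc X))
      (<-≤-trans (ι-mono-< (ℕ.n<1+n X)) (x≤x^k k (ι-mono-≤ {1} {suc X} (s≤s z≤n))))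

    below<above : ∀ {t t′} → 0ℚ < t → t ∈ below x → t′ ∈ above x → t < t′
    below<above 0<t t∈ t′∈ = let 0<t′ , lt = above⁻ t′∈ in ^-cancelˡ-< k (<⇒≤ 0<t′) (<-trans (below⁻ 0<t t∈) lt)

    -- Kept apart from `^ℚ-root` because it also covers the exponent 0.
    ^ℚ-below⁻ : ∀ r n d .{{_ : ℕ.NonZero d}} → r * ι d ≡ ι n → ∀ {p} → 0ℚ < p → p ∈ below (x ^ℚ r) → p ^ (k ℕ.* d) < ι (X ℕ.^ n)
    ^ℚ-below⁻ r n d eq 0<p (inj₁ p≤0) = contradiction (<-≤-trans 0<p p≤0) (<-irrefl refl)
    ^ℚ-below⁻ r n d eq {p} 0<p (inj₂ (t , t′ , 0<t , t∈ , t′∈ , bp , bp′)) = begin-strict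
      p ^ (k ℕ.* d)  ≡⟨ ^-assocʳ p k d ⟨
      (p ^ k) ^ d  ≡⟨ ^-swap p k d ⟩
      (p ^ d) ^ k  <⟨ ^-monoˡ-< k (^-nonNeg d (<⇒≤ 0<p)) (BelowPow⁻ 0<p 0<t r n d eq bp) ⟩
      (t ^ n) ^ k  ≡⟨ ^-swap t n k ⟩
      (t ^ k) ^ n  ≤⟨ ^-monoˡ-≤ n (^-nonNeg k (<⇒≤ 0<t)) (<⇒≤ (below⁻ 0<t t∈)) ⟩
      ι X ^ n  ≡⟨ ι-^ X n ⟨
      ι (X ℕ.^ n)  ∎
      where open ≤-Reasoning

    module _ (r : ℚ) (n d : ℕ) {{_ : ℕ.NonZero n}} {{_ : ℕ.NonZero d}} (eq : r * ι d ≡ ι n) where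

      private instance
        kn≢0 : ℕ.NonZero (k ℕ.* n)
        kn≢0 = ℕ.m*n≢0 k n

      private
        root-<ʳ : ∀ {p t} → 0ℚ < p → t ^ (k ℕ.* n) < p ^ (k ℕ.* d) → t ^ n < p ^ d
        root-<ʳ {p} {t} 0<p lt = ^-cancelˡ-< k (^-nonNeg d (<⇒≤ 0<p))
          (subst₂ _<_ (trans (sym (^-assocʳ t k n)) (^-swap t k n)) (trans (sym (^-assocʳ p k d)) (^-swap p k d)) lt)

        root-<ˡ : ∀ {p t} → 0ℚ < t → p ^ (k ℕ.* d) < t ^ (k ℕ.* n) → p ^ d < t ^ n
        root-<ˡ {p} {t} 0<t lt = ^-cancelˡ-< k (^-nonNeg n (<⇒≤ 0<t))
          (subst₂ _<_ (trans (sym (^-assocʳ p k d)) (^-swap p k d)) (trans (sym (^-assocʳ t k n)) (^-swap t k n)) lt)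

      -- From x ^ k = X and r = n / d follows (x ^ r) ^ (k d) = X ^ n. Density of (k n)-th powers
      -- supplies a rational t with t ^ r strictly between p and x ^ r; the other end of the bracket
      -- around x is arbitrary, by monotonicity.
      ^ℚ-root : IsRoot (x ^ℚ r) (k ℕ.* d) (X ℕ.^ n)
      ^ℚ-root = record { below⁺ = b⁺ ; below⁻ = ^ℚ-below⁻ r n d eq ; above⁺ = a⁺ ; above⁻ = a⁻ }
        where
        open ≤-Reasoning
        b⁺ : ∀ {p} → 0ℚ < p → p ^ (k ℕ.* d) < ι (X ℕ.^ n) → p ∈ below (x ^ℚ r)
        b⁺ {p} 0<p lt =
          let t , 0<t , lt₁ , lt₂ = root-dense (k ℕ.* n) (^-nonNeg (k ℕ.* d) (<⇒≤ 0<p)) lt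
              t′ , 0<t′ , t′∈ = ∃-above
              t∈ = below⁺ 0<t (^-cancelˡ-< n (ι≥0 X) (subst₂ _<_ (sym (^-assocʳ t k n)) (ι-^ X n) lt₂))
              pd<tn = root-<ˡ 0<t lt₁
          in inj₂ (t , t′ , 0<t , t∈ , t′∈ , BelowPow⁺ 0<p 0<t r n d eq pd<tn ,
               BelowPow⁺ 0<p 0<t′ r n d eq (<-≤-trans pd<tn (^-monoˡ-≤ n (<⇒≤ 0<t) (<⇒≤ (below<above 0<t t∈ t′∈)))))
        a⁺ : ∀ {p} → 0ℚ < p → ι (X ℕ.^ n) < p ^ (k ℕ.* d) → p ∈ above (x ^ℚ r)
        a⁺ {p} 0<p lt =
          let t′ , 0<t′ , lt₁ , lt₂ = root-dense (k ℕ.* n) (ι≥0 (X ℕ.^ n)) lt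
              t , 0<t , t∈ = ∃-below
              t′∈ = above⁺ 0<t′ (^-cancelˡ-< n (^-nonNeg k (<⇒≤ 0<t′)) (subst₂ _<_ (ι-^ X n) (sym (^-assocʳ t′ k n)) lt₁))
              tn<pd = root-<ʳ 0<p lt₂
          in 0<p , t , t′ , 0<t , t∈ , t′∈ ,
               AbovePow⁺ 0<p 0<t r n d eq (≤-<-trans (^-monoˡ-≤ n (<⇒≤ 0<t) (<⇒≤ (below<above 0<t t∈ t′∈))) tn<pd) ,
               AbovePow⁺ 0<p 0<t′ r n d eq tn<pd
        a⁻ : ∀ {p} → p ∈ above (x ^ℚ r) → 0ℚ < p × ι (X ℕ.^ n) < p ^ (k ℕ.* d)
        a⁻ {p} (0<p , t , t′ , 0<t , t∈ , t′∈ , ap , ap′) = 0<p , (let 0<t′ , lt = above⁻ t′∈ in begin-strict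
          ι (X ℕ.^ n)  ≡⟨ ι-^ X n ⟩
          ι X ^ n  <⟨ ^-monoˡ-< n (ι≥0 X) lt ⟩
          (t′ ^ k) ^ n  ≡⟨ ^-swap t′ k n ⟩
          (t′ ^ n) ^ k  <⟨ ^-monoˡ-< k (^-nonNeg n (<⇒≤ 0<t′)) (AbovePow⁻ 0<p 0<t′ r n d eq ap′) ⟩
          (p ^ d) ^ k  ≡⟨ ^-swap p d k ⟩
          (p ^ k) ^ d  ≡⟨ ^-assocʳ p k d ⟩
          p ^ (k ℕ.* d)  ∎)

  module _ {x y : Cut} {k X Y : ℕ} {{_ : ℕ.NonZero k}} {{_ : ℕ.NonZero X}} {{_ : ℕ.NonZero Y}}
           (x-root : IsRoot x k X) (y-root : IsRoot y k Y) where
    private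
      module x = IsRoot x-root
      module y = IsRoot y-root

    -- For p below the product, `s` is chosen with s ^ k between p ^ k / Y and X. The k-th power of
    -- p / s is then less than Y, which leaves room for `t`. The side above is symmetric.
    *ᵣ-root : IsRoot (x *ᵣ y) k (X ℕ.* Y)
    *ᵣ-root = record { below⁺ = b⁺ ; below⁻ = b⁻ ; above⁺ = a⁺ ; above⁻ = a⁻ }
      where
      open ≤-Reasoning
      w : ℚ
      w = + 1 / Y
      wY : w * ι Y ≡ 1ℚ
      wY = /-ι 1 Y
      0<w : 0ℚ < w
      0<w = *-cancel-< (ι>0 Y) (subst₂ _<_ (sym (*-zeroˡ (ι Y))) (sym wY) 0<1)
      XYw : ι (X ℕ.* Y) * w ≡ ι X
      XYw = trans (cong (_* w) (ι-* X Y)) (trans (solve 3 (λ a b c → a :* b :* c := a :* (c :* b)) refl (ι X) (ι Y) w) (trans (cong (ι X *_) wY) (*-identityʳ (ι X))))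
      unw : ∀ z → z * w * ι Y ≡ z
      unw z = trans (*-assoc z w (ι Y)) (trans (cong (z *_) wY) (*-identityʳ z))

      module Quotient {p s : ℚ} (0<p : 0ℚ < p) (0<s : 0ℚ < s) where
        instance
          s≢0 : NonZero s
          s≢0 = >-nonZero 0<s
        z : ℚ
        z = p * 1/ s
        zs : z * s ≡ p
        zs = trans (*-assoc p (1/ s) s) (trans (cong (p *_) (*-inverseˡ s)) (*-identityʳ p))
        0<z : 0ℚ < z
        0<z = *-cancel-< 0<s (subst₂ _<_ (sym (*-zeroˡ s)) (sym zs) 0<p)
        zᵏsᵏ : z ^ k * s ^ k ≡ p ^ k
        zᵏsᵏ = trans (sym (^-distrib-* z s k)) (cong (_^ k) zs)

      b⁺ : ∀ {p} → 0ℚ < p → p ^ k < ι (X ℕ.* Y) → p ∈ below (x *ᵣ y)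
      b⁺ {p} 0<p lt =
        let s , 0<s , lt₁ , lt₂ = root-dense k (*-nonNeg (^-nonNeg k (<⇒≤ 0<p)) (<⇒≤ 0<w)) (subst (p ^ k * w <_) XYw (*ʳ-< 0<w lt))
            open Quotient 0<p 0<s
            t , 0<t , lt₃ , lt₄ = root-dense k (^-nonNeg k (<⇒≤ 0<z)) (*-cancel-< (^-pos k 0<s)
              (subst₂ _<_ (trans (unw (p ^ k)) (sym zᵏsᵏ)) (*-comm (s ^ k) (ι Y)) (*ʳ-< (ι>0 Y) lt₁)))
            s∈ = x.below⁺ 0<s lt₂
            t∈ = y.below⁺ 0<t lt₄
            s′ , 0<s′ , s′∈ = ∃-above x-root
            t′ , 0<t′ , t′∈ = ∃-above y-root
            s<s′ = below<above x-root 0<s s∈ s′∈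
            t<t′ = below<above y-root 0<t t∈ t′∈
            p<st = subst₂ _<_ (trans (*-comm s z) zs) refl (*ˡ-< 0<s (^-cancelˡ-< k (<⇒≤ 0<t) lt₃))
        in s , s′ , t , t′ , s∈ , s′∈ , t∈ , t′∈ , p<st , <-trans p<st (*ˡ-< 0<s t<t′) , <-trans p<st (*ʳ-< 0<t s<s′) ,
             <-trans p<st (*-mono-< (<⇒≤ 0<s) 0<t′ s<s′ t<t′)

      b⁻ : ∀ {p} → 0ℚ < p → p ∈ below (x *ᵣ y) → p ^ k < ι (X ℕ.* Y)
      b⁻ {p} 0<p (s , s′ , t , t′ , s∈ , s′∈ , t∈ , t′∈ , st , st′ , s′t , s′t′) = begin-strict
        p ^ k  <⟨ ^-monoˡ-< k (<⇒≤ 0<p) st ⟩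
        (s * t) ^ k  ≡⟨ ^-distrib-* s t k ⟩
        s ^ k * t ^ k  <⟨ *-mono-< (^-nonNeg k (<⇒≤ 0<s)) (ι>0 Y) (x.below⁻ 0<s s∈) (y.below⁻ 0<t t∈) ⟩
        ι X * ι Y  ≡⟨ ι-* X Y ⟨
        ι (X ℕ.* Y)  ∎
        where
        0<s′ : 0ℚ < s′
        0<s′ = proj₁ (x.above⁻ s′∈)
        0<t′ : 0ℚ < t′
        0<t′ = proj₁ (y.above⁻ t′∈)
        -- The lower ends of the brackets may a priori be negative; the mixed products exceed p > 0
        -- and the upper ends are positive, which excludes this.
        0<s : 0ℚ < s
        0<s = *-cancel-< 0<t′ (subst (_< s * t′) (sym (*-zeroˡ t′)) (<-trans 0<p st′))
        0<t : 0ℚ < t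
        0<t = *-cancel-< 0<s′ (subst₂ _<_ (sym (*-zeroˡ s′)) (*-comm s′ t) (<-trans 0<p s′t))

      a⁺ : ∀ {p} → 0ℚ < p → ι (X ℕ.* Y) < p ^ k → p ∈ above (x *ᵣ y)
      a⁺ {p} 0<p lt =
        let s′ , 0<s′ , lt₁ , lt₂ = root-dense k (ι≥0 X) (subst (_< p ^ k * w) XYw (*ʳ-< 0<w lt))
            open Quotient 0<p 0<s′
            t′ , 0<t′ , lt₃ , lt₄ = root-dense k (ι≥0 Y) (*-cancel-< (^-pos k 0<s′)
              (subst₂ _<_ (*-comm (s′ ^ k) (ι Y)) (trans (unw (p ^ k)) (sym zᵏsᵏ)) (*ʳ-< (ι>0 Y) lt₂)))
            s′∈ = x.above⁺ 0<s′ lt₁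
            t′∈ = y.above⁺ 0<t′ lt₃
            s , 0<s , s∈ = ∃-below x-root
            t , 0<t , t∈ = ∃-below y-root
            s<s′ = below<above x-root 0<s s∈ s′∈
            t<t′ = below<above y-root 0<t t∈ t′∈
            s′t′<p = subst₂ _<_ refl (trans (*-comm s′ z) zs) (*ˡ-< 0<s′ (^-cancelˡ-< k (<⇒≤ 0<z) lt₄))
        in s , s′ , t , t′ , s∈ , s′∈ , t∈ , t′∈ , <-trans (*-mono-< (<⇒≤ 0<s) 0<t′ s<s′ t<t′) s′t′<p ,
             <-trans (*ʳ-< 0<t′ s<s′) s′t′<p , <-trans (*ˡ-< 0<s′ t<t′) s′t′<p , s′t′<p

      a⁻ : ∀ {p} → p ∈ above (x *ᵣ y) → 0ℚ < p × ι (X ℕ.* Y) < p ^ k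
      a⁻ {p} (s , s′ , t , t′ , s∈ , s′∈ , t∈ , t′∈ , st , st′ , s′t , s′t′) =
        let 0<s′ , lt = x.above⁻ s′∈
            0<t′ , lt′ = y.above⁻ t′∈
        in <-trans (*-pos 0<s′ 0<t′) s′t′ , (begin-strict
          ι (X ℕ.* Y)  ≡⟨ ι-* X Y ⟩
          ι X * ι Y  <⟨ *-mono-< (ι≥0 X) (^-pos k 0<t′) lt lt′ ⟩
          s′ ^ k * t′ ^ k  ≡⟨ ^-distrib-* s′ t′ k ⟨
          (s′ * t′) ^ k  <⟨ ^-monoˡ-< k (<⇒≤ (*-pos 0<s′ 0<t′)) s′t′ ⟩
          p ^ k  ∎)

-- Logarithms of integers as real numbers, and shifts of cuts

module Logarithms where

  open import Defs
  open import Data.Nat.Base as ℕ using (ℕ; suc; z≤n; s≤s)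
  import Data.Nat.Properties as ℕ
  open import Data.Integer.Base using (+_; -[1+_])
  open import Data.Rational.Base
  open import Data.Rational.Properties
  open import Data.Rational.Solver
  open import Data.Product.Base using (_×_; _,_; ∃; ∃₂)
  open import Data.Sum.Base using (_⊎_; inj₁; inj₂)
  open import Relation.Binary.PropositionalEquality
  open import Function.Bundles using (mk⇔; Equivalence)
  open import Relation.Unary using (_∈_)
  open import Relation.Nullary using (Dec; yes; no; ¬_; contradiction)
  open Roots
  open RationalPowers
  open Enumeration using (n<K^n)
  open +-*-Solver

  ^-cancelʳ-<ᴺ : ∀ {K} a b → 1 ℕ.≤ K → K ℕ.^ a ℕ.< K ℕ.^ b → a ℕ.< b
  ^-cancelʳ-<ᴺ {K} a b 1≤K lt = ℕ.≰⇒> λ b≤a → ℕ.<⇒≱ lt (ℕ.^-monoʳ-≤ K {{ℕ.>-nonZero 1≤K}} b≤a)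

  ^-cancelˡ-<ᴺ : ∀ {x y} n → x ℕ.^ n ℕ.< y ℕ.^ n → x ℕ.< y
  ^-cancelˡ-<ᴺ n lt = ℕ.≰⇒> λ y≤x → ℕ.<⇒≱ lt (ℕ.^-monoˡ-≤ n y≤x)

  ^-swapᴺ : ∀ x m n → (x ℕ.^ m) ℕ.^ n ≡ (x ℕ.^ n) ℕ.^ m
  ^-swapᴺ x m n = trans (ℕ.^-*-assoc x m n) (trans (cong (x ℕ.^_) (ℕ.*-comm m n)) (sym (ℕ.^-*-assoc x n m)))

  ι-<-*⁺ : ∀ {r n d n′ d′} → ι n < r * ι d → r * ι d′ ≤ ι n′ → .{{_ : ℕ.NonZero d}} .{{_ : ℕ.NonZero d′}} → n ℕ.* d′ ℕ.< n′ ℕ.* d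
  ι-<-*⁺ {r} {n} {d} {n′} {d′} lt le = ι-cancel-< (begin-strict
    ι (n ℕ.* d′)  ≡⟨ ι-* n d′ ⟩
    ι n * ι d′  <⟨ *ʳ-< (ι>0 d′) lt ⟩
    r * ι d * ι d′  ≡⟨ solve 3 (λ a b c → a :* b :* c := a :* c :* b) refl r (ι d) (ι d′) ⟩
    r * ι d′ * ι d  ≤⟨ *ʳ-≤ (ι≥0 d) le ⟩
    ι n′ * ι d  ≡⟨ ι-* n′ d ⟨
    ι (n′ ℕ.* d)  ∎)
    where open ≤-Reasoning

  ι-<-*⁻ : ∀ {r n d n′ d′} → r * ι d < ι n → ι n′ ≤ r * ι d′ → .{{_ : ℕ.NonZero d}} .{{_ : ℕ.NonZero d′}} → n′ ℕ.* d ℕ.< n ℕ.* d′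
  ι-<-*⁻ {r} {n} {d} {n′} {d′} lt le = ι-cancel-< (begin-strict
    ι (n′ ℕ.* d)  ≡⟨ ι-* n′ d ⟩
    ι n′ * ι d  ≤⟨ *ʳ-≤ (ι≥0 d) le ⟩
    r * ι d′ * ι d  ≡⟨ solve 3 (λ a b c → a :* b :* c := a :* c :* b) refl r (ι d′) (ι d) ⟩
    r * ι d * ι d′  <⟨ *ʳ-< (ι>0 d′) lt ⟩
    ι n * ι d′  ≡⟨ ι-* n d′ ⟨
    ι (n ℕ.* d′)  ∎)
    where open ≤-Reasoning

  nonNegative-fraction : ∀ r → 0ℚ ≤ r → ∃₂ λ n d → r * ι (suc d) ≡ ι n
  nonNegative-fraction r@(mkℚ (+ n) d-1 _)    _   = n , d-1 , ↥≡+⇒ι r refl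
  nonNegative-fraction r@(mkℚ -[1+ _ ] _ _) 0≤r = contradiction (<-≤-trans (negative⁻¹ r) 0≤r) (<-irrefl refl)

  -- The cut of log X to the base K; it is nonnegative because X ≥ 1.
  log : ℕ → ℕ → Cut
  log K X = mkCut
    (λ p → p < 0ℚ ⊎ ∃₂ λ n d → p * ι (suc d) < ι n × K ℕ.^ n ℕ.< X ℕ.^ suc d)
    (λ p → ∃₂ λ n d → ι n < p * ι (suc d) × X ℕ.^ suc d ℕ.< K ℕ.^ n)

  module Log {K X : ℕ} (2≤K : 2 ℕ.≤ K) (1≤X : 1 ℕ.≤ X) where

    1≤K : 1 ℕ.≤ K
    1≤K = ℕ.≤-trans (s≤s z≤n) 2≤K

    below-≥ : ∀ {r n d} → r * ι (suc d) ≡ ι n → r ∈ below (log K X) → ¬ X ℕ.^ suc d ℕ.≤ K ℕ.^ n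
    below-≥ {r} {n} {d} eq (inj₁ r<0) _ = not-negative r n (suc d) eq r<0
    below-≥ {r} {n} {d} eq (inj₂ (n′ , d′ , lt , lt′)) ge = ℕ.<-asym (ι-<-*⁻ {r} {n′} {suc d′} {n} {suc d} lt (≤-reflexive (sym eq)))
      (^-cancelʳ-<ᴺ (n′ ℕ.* suc d) (n ℕ.* suc d′) 1≤K (begin-strict
        K ℕ.^ (n′ ℕ.* suc d)  ≡⟨ ℕ.^-*-assoc K n′ (suc d) ⟨
        (K ℕ.^ n′) ℕ.^ suc d  <⟨ ℕ.^-monoˡ-< (suc d) lt′ ⟩
        (X ℕ.^ suc d′) ℕ.^ suc d  ≡⟨ ^-swapᴺ X (suc d′) (suc d) ⟩
        (X ℕ.^ suc d) ℕ.^ suc d′  ≤⟨ ℕ.^-monoˡ-≤ (suc d′) ge ⟩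
        (K ℕ.^ n) ℕ.^ suc d′  ≡⟨ ℕ.^-*-assoc K n (suc d′) ⟩
        K ℕ.^ (n ℕ.* suc d′)  ∎))
      where open ℕ.≤-Reasoning

    beyond : ∀ {n d n′ d′} → n ℕ.* suc d′ ℕ.< n′ ℕ.* suc d → X ℕ.^ suc d ℕ.≤ K ℕ.^ n → X ℕ.^ suc d′ ℕ.< K ℕ.^ n′
    beyond {n} {d} {n′} {d′} lt le = ^-cancelˡ-<ᴺ (suc d) (begin-strict
      (X ℕ.^ suc d′) ℕ.^ suc d  ≡⟨ ^-swapᴺ X (suc d′) (suc d) ⟩
      (X ℕ.^ suc d) ℕ.^ suc d′  ≤⟨ ℕ.^-monoˡ-≤ (suc d′) le ⟩
      (K ℕ.^ n) ℕ.^ suc d′  ≡⟨ ℕ.^-*-assoc K n (suc d′) ⟩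
      K ℕ.^ (n ℕ.* suc d′)  <⟨ ℕ.^-monoʳ-< K 2≤K lt ⟩
      K ℕ.^ (n′ ℕ.* suc d)  ≡⟨ ℕ.^-*-assoc K n′ (suc d) ⟨
      (K ℕ.^ n′) ℕ.^ suc d  ∎)
      where open ℕ.≤-Reasoning

    above-fraction : ∀ {r} → r ∈ above (log K X) → ∃₂ λ n d → r * ι (suc d) ≡ ι n × X ℕ.^ suc d ℕ.< K ℕ.^ n
    above-fraction {r} (n′ , d′ , lt , lt′) =
      let n , d , eq = nonNegative-fraction r (<⇒≤ 0<r) in n , d , eq ,
        beyond {n′} {d′} {n} {d} (ι-<-*⁺ {r} {n′} {suc d′} {n} {suc d} lt (≤-reflexive eq)) (ℕ.<⇒≤ lt′)
      where
      0<r : 0ℚ < r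
      0<r = *-cancel-< (ι>0 (suc d′)) (subst (_< r * ι (suc d′)) (sym (*-zeroˡ (ι (suc d′)))) (≤-<-trans (ι≥0 n′) lt))

    down : ∀ {p p′} → p < p′ → p′ ∈ below (log K X) → p ∈ below (log K X)
    down p<p′ (inj₁ p′<0)               = inj₁ (<-trans p<p′ p′<0)
    down p<p′ (inj₂ (n , d , lt , lt′)) = inj₂ (n , d , <-trans (*ʳ-< (ι>0 (suc d)) p<p′) lt , lt′)

    up : ∀ {p p′} → p′ < p → p′ ∈ above (log K X) → p ∈ above (log K X)
    up p′<p (n , d , lt , lt′) = n , d , <-trans lt (*ʳ-< (ι>0 (suc d)) p′<p) , lt′

    below-open : ∀ {p} → p ∈ below (log K X) → ∃ λ p′ → p < p′ × p′ ∈ below (log K X)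
    below-open (inj₁ p<0) = let z , p<z , z<0 = <-dense p<0 in z , p<z , inj₁ z<0
    below-open {p} (inj₂ (n , d , lt , lt′)) =
      let z , p<z , z<y = <-dense {p} {+ n / suc d} (*-cancel-< (ι>0 (suc d)) (subst (p * ι (suc d) <_) (sym (/-ι n (suc d))) lt))
      in z , p<z , inj₂ (n , d , subst (z * ι (suc d) <_) (/-ι n (suc d)) (*ʳ-< (ι>0 (suc d)) z<y) , lt′)

    above-open : ∀ {p} → p ∈ above (log K X) → ∃ λ p′ → p′ < p × p′ ∈ above (log K X)
    above-open {p} (n , d , lt , lt′) =
      let z , y<z , z<p = <-dense {+ n / suc d} {p} (*-cancel-< (ι>0 (suc d)) (subst (_< p * ι (suc d)) (sym (/-ι n (suc d))) lt))
      in z , z<p , n , d , subst (_< z * ι (suc d)) (/-ι n (suc d)) (*ʳ-< (ι>0 (suc d)) y<z) , lt′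

    ∈-above : ∀ n → X ℕ.< K ℕ.^ n → ι (suc n) ∈ above (log K X)
    ∈-above n lt = n , 0 , subst (ι n <_) (sym (*-identityʳ (ι (suc n)))) (ι-mono-< (ℕ.n<1+n n)) , subst (ℕ._< K ℕ.^ n) (sym (ℕ.*-identityʳ X)) lt

    log-isReal : IsReal (log K X)
    log-isReal = record
      { below-inhabited = - 1ℚ , inj₁ (negative⁻¹ (- 1ℚ))
      ; above-inhabited = ι (suc X) , ∈-above X (n<K^n 2≤K X)
      ; below-rounded   = λ p → mk⇔ below-open (λ (p′ , p<p′ , p′∈) → down p<p′ p′∈)
      ; above-rounded   = λ p → mk⇔ above-open (λ (p′ , p′<p , p′∈) → up p′<p p′∈)
      ; disjoint        = λ p (p∈ , p∈′) → let n , d , eq , lt = above-fraction {p} p∈′ in below-≥ {p} {n} {d} eq p∈ (ℕ.<⇒≤ lt)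
      ; located         = located
      }
      where
      -- Two rationals r < r′ are inserted. The powers are compared at r; if this only shows that
      -- the logarithm is at most r, possibly with equality, then r′ is strictly above it.
      located : ∀ {p p′} → p < p′ → p ∈ below (log K X) ⊎ p′ ∈ above (log K X)
      located {p} {p′} p<p′ = decide (p <? 0ℚ)
        where
        between : 0ℚ ≤ p → (∃ λ r → p < r × r < p′) → p ∈ below (log K X) ⊎ p′ ∈ above (log K X)
        between 0≤p (r , p<r , r<p′) = compare (<-dense r<p′)
          where
          compare : (∃ λ r′ → r < r′ × r′ < p′) → p ∈ below (log K X) ⊎ p′ ∈ above (log K X)
          compare (r′ , r<r′ , r′<p′) = fractions (nonNegative-fraction r 0≤r) (nonNegative-fraction r′ (≤-trans 0≤r (<⇒≤ r<r′)))
            where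
            0≤r : 0ℚ ≤ r
            0≤r = ≤-trans 0≤p (<⇒≤ p<r)
            fractions : (∃₂ λ n d → r * ι (suc d) ≡ ι n) → (∃₂ λ n d → r′ * ι (suc d) ≡ ι n) →
              p ∈ below (log K X) ⊎ p′ ∈ above (log K X)
            fractions (n , d , eq) (n′ , d′ , eq′) = side (K ℕ.^ n ℕ.<? X ℕ.^ suc d)
              where
              side : Dec (K ℕ.^ n ℕ.< X ℕ.^ suc d) → p ∈ below (log K X) ⊎ p′ ∈ above (log K X)
              side (yes lt) = inj₁ (inj₂ (n , d , subst (p * ι (suc d) <_) eq (*ʳ-< (ι>0 (suc d)) p<r) , lt))
              side (no ≮)   = inj₂ (n′ , d′ , subst (_< p′ * ι (suc d′)) eq′ (*ʳ-< (ι>0 (suc d′)) r′<p′) ,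
                beyond {n} {d} {n′} {d′} (ι-<-*⁺ {r′} {n} {suc d} {n′} {suc d′} (subst (_< r′ * ι (suc d)) eq (*ʳ-< (ι>0 (suc d)) r<r′)) (≤-reflexive eq′)) (ℕ.≮⇒≥ ≮))
        decide : Dec (p < 0ℚ) → p ∈ below (log K X) ⊎ p′ ∈ above (log K X)
        decide (yes p<0) = inj₁ (inj₁ p<0)
        decide (no p≮0)  = between (≮⇒≥ p≮0) (<-dense p<p′)

  -- The cut of x - a.
  shift : ℚ → Cut → Cut
  shift a x = mkCut (λ p → p + a ∈ below x) (λ p → p + a ∈ above x)

  p-a+a : ∀ p a → p - a + a ≡ p
  p-a+a = solve 2 (λ p a → p :- a :+ a := p) refl

  shift-isReal : ∀ a {x} → IsReal x → IsReal (shift a x)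
  shift-isReal a {x} real = record
    { below-inhabited = let p , p∈ = below-inhabited in p - a , subst (_∈ below x) (sym (p-a+a p a)) p∈
    ; above-inhabited = let p , p∈ = above-inhabited in p - a , subst (_∈ above x) (sym (p-a+a p a)) p∈
    ; below-rounded   = λ p → mk⇔ (b⁺ p) (b⁻ p)
    ; above-rounded   = λ p → mk⇔ (a⁺ p) (a⁻ p)
    ; disjoint        = λ p → disjoint (p + a)
    ; located         = λ {p} {p′} p<p′ → located {p + a} {p′ + a} (+-monoˡ-< a p<p′)
    }
    where
    open IsReal real
    p+a-a : ∀ p → p + a - a ≡ p
    p+a-a p = solve 2 (λ p a → p :+ a :- a := p) refl p a
    b⁺ : ∀ p → p + a ∈ below x → ∃ λ p′ → p < p′ × p′ + a ∈ below x
    b⁺ p p∈ = let z , lt , z∈ = Equivalence.to (below-rounded (p + a)) p∈ in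
      z - a , subst (_< z - a) (p+a-a p) (+-monoˡ-< (- a) lt) , subst (_∈ below x) (sym (p-a+a z a)) z∈
    b⁻ : ∀ p → (∃ λ p′ → p < p′ × p′ + a ∈ below x) → p + a ∈ below x
    b⁻ p (p′ , p<p′ , p′∈) = Equivalence.from (below-rounded (p + a)) (p′ + a , +-monoˡ-< a p<p′ , p′∈)
    a⁺ : ∀ p → p + a ∈ above x → ∃ λ p′ → p′ < p × p′ + a ∈ above x
    a⁺ p p∈ = let z , lt , z∈ = Equivalence.to (above-rounded (p + a)) p∈ in
      z - a , subst (z - a <_) (p+a-a p) (+-monoˡ-< (- a) lt) , subst (_∈ above x) (sym (p-a+a z a)) z∈
    a⁻ : ∀ p → (∃ λ p′ → p′ < p × p′ + a ∈ above x) → p + a ∈ above x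
    a⁻ p (p′ , p′<p , p′∈) = Equivalence.from (above-rounded (p + a)) (p′ + a , +-monoˡ-< a p′<p , p′∈)

  fromℚ+shift : ∀ a {x} → IsReal x → fromℚ a +ᵣ shift a x ≃ᵣ x
  fromℚ+shift a {x} real p = mk⇔ b⁻ b⁺ , mk⇔ a⁻ a⁺
    where
    open IsReal real
    add : ∀ z w → w - (z - a) + (z - a) ≡ w
    add z w = solve 3 (λ z w a → w :- (z :- a) :+ (z :- a) := w) refl z w a
    diff : ∀ z w → w - (z - a) ≡ w - z + a
    diff z w = solve 3 (λ z w a → w :- (z :- a) := w :- z :+ a) refl z w a
    b⁻ : p ∈ below (fromℚ a +ᵣ shift a x) → p ∈ below x
    b⁻ (s , t , s<a , t∈ , p<) = Equivalence.from (below-rounded p) (t + a , <-trans p< (subst (s + t <_) (+-comm a t) (+-monoˡ-< t s<a)) , t∈)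
    -- With p < w < z and z still below x, the part z - a is below x - a, and the remaining w - (z -
    -- a) is less than a because w < z.
    b⁺ : p ∈ below x → p ∈ below (fromℚ a +ᵣ shift a x)
    b⁺ p∈ =
      let z , p<z , z∈ = Equivalence.to (below-rounded p) p∈
          w , p<w , w<z = <-dense p<z
      in w - (z - a) , z - a ,
         subst₂ _<_ (sym (diff z w)) (trans (cong (_+ a) (+-inverseʳ z)) (+-identityˡ a)) (+-monoˡ-< a (+-monoˡ-< (- z) w<z)) ,
         subst (_∈ below x) (sym (p-a+a z a)) z∈ , subst (p <_) (sym (add z w)) p<w
    a⁻ : p ∈ above (fromℚ a +ᵣ shift a x) → p ∈ above x
    a⁻ (s , t , a<s , t∈ , <p) = Equivalence.from (above-rounded p) (t + a , <-trans (subst (_< s + t) (+-comm a t) (+-monoˡ-< t a<s)) <p , t∈)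
    a⁺ : p ∈ above x → p ∈ above (fromℚ a +ᵣ shift a x)
    a⁺ p∈ =
      let z , z<p , z∈ = Equivalence.to (above-rounded p) p∈
          w , z<w , w<p = <-dense z<p
      in w - (z - a) , z - a ,
         subst₂ _<_ (trans (cong (_+ a) (+-inverseʳ z)) (+-identityˡ a)) (sym (diff z w)) (+-monoˡ-< a (+-monoˡ-< (- z) z<w)) ,
         subst (_∈ above x) (sym (p-a+a z a)) z∈ , subst (_< p) (sym (add z w)) w<p

-- Raising a root of an integer to a logarithm

module RealPowers where

  open import Defs
  open import Data.Nat.Base as ℕ using (ℕ; zero; suc)
  import Data.Nat.Properties as ℕ
  open import Data.Integer.Base using (+_; -[1+_])
  open import Data.Rational.Base
  open import Data.Rational.Properties
  open import Data.Rational.Solver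
  open import Algebra.Definitions.RawSemiring +-*-rawSemiring using (_^_)
  open import Algebra.Bundles using (CommutativeRing)
  open import Algebra.Properties.CommutativeSemiring.Exp (CommutativeRing.commutativeSemiring +-*-commutativeRing) using (^-assocʳ)
  open import Data.Product.Base using (_×_; _,_; proj₁; proj₂; ∃; ∃₂)
  open import Data.Sum.Base using (inj₁; inj₂)
  open import Data.Nat.Coprimality using (1-coprimeTo)
  open import Relation.Binary.PropositionalEquality
  open import Function.Bundles using (mk⇔; Equivalence)
  open import Relation.Unary using (_∈_)
  open import Relation.Nullary using (Dec; yes; no; ¬_; contradiction)
  open Logarithms
  open Roots
  open RationalPowers
  open Enumeration using (n<K^n)
  open +-*-Solver

  module _ {G y : Cut} {k K N : ℕ} {{_ : ℕ.NonZero k}} {{_ : ℕ.NonZero K}} (G-root : IsRoot G k K)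
           (2≤K : 2 ℕ.≤ K) (1≤N : 1 ℕ.≤ N) (y≃log : y ≃ᵣ log K (N ℕ.^ k)) where

    private
      module G = IsRoot G-root

      1≤ι : ∀ {n} → 1 ℕ.≤ n → 1ℚ ≤ ι n
      1≤ι {n} = ι-mono-≤ {1} {n}

      0<ιN : 0ℚ < ι N
      0<ιN = <-≤-trans 0<1 (1≤ι 1≤N)

      X : ℕ
      X = N ℕ.^ k

      1≤X : 1 ℕ.≤ X
      1≤X = ℕ.m^n>0 N {{ℕ.>-nonZero 1≤N}} k

      open Log 2≤K 1≤X

      to-below : ∀ {r} → r ∈ below y → r ∈ below (log K X)
      to-below {r} = Equivalence.to (proj₁ (y≃log r))
      from-below : ∀ {r} → r ∈ below (log K X) → r ∈ below y
      from-below {r} = Equivalence.from (proj₁ (y≃log r))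
      to-above : ∀ {r} → r ∈ above y → r ∈ above (log K X)
      to-above {r} = Equivalence.to (proj₂ (y≃log r))
      from-above : ∀ {r} → r ∈ above (log K X) → r ∈ above y
      from-above {r} = Equivalence.from (proj₂ (y≃log r))

      ιX^ : ∀ d → ι (X ℕ.^ d) ≡ ι N ^ (k ℕ.* d)
      ιX^ d = trans (cong ι (ℕ.^-*-assoc N k d)) (ι-^ N (k ℕ.* d))

      -- Two fractions inserted between successive rationals, so that the exponent is strictly below log K X.
      Approach : ℚ → ℚ → ℚ → Set
      Approach u v w = ∃₂ λ n d → ∃₂ λ n′ d′ →
        u ^ (k ℕ.* suc d) < ι (K ℕ.^ suc n) × ι (K ℕ.^ suc n) < v ^ (k ℕ.* suc d) ×
        v ^ (k ℕ.* suc d′) < ι (K ℕ.^ suc n′) × ι (K ℕ.^ suc n′) < w ^ (k ℕ.* suc d′) ×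
        suc n ℕ.* suc d′ ℕ.< suc n′ ℕ.* suc d

      approach : ∀ {u v w} → 1ℚ ≤ u → u < v → v < w → Approach u v w
      approach {u} {v} {w} 1≤u u<v v<w = join
        (log-dense {K} 2≤K (1≤^ k 1≤u) (^-monoˡ-< k 0≤u u<v))
        (log-dense {K} 2≤K (1≤^ k (≤-trans 1≤u (<⇒≤ u<v))) (^-monoˡ-< k (≤-trans 0≤u (<⇒≤ u<v)) v<w))
        where
        0≤u : 0ℚ ≤ u
        0≤u = ≤-trans (<⇒≤ 0<1) 1≤u
        0≤v : 0ℚ ≤ v
        0≤v = ≤-trans 0≤u (<⇒≤ u<v)
        join : _ → _ → _
        join (suc n , suc d , _ , _ , a₁ , a₂) (suc n′ , suc d′ , _ , _ , b₁ , b₂) =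
          n , d , n′ , d′ , flat u a₁ , flat′ v a₂ , flat v b₁ , flat′ w b₂ ,
          ^-cancelʳ-<ᴺ (suc n ℕ.* suc d′) (suc n′ ℕ.* suc d) 1≤K (ι-cancel-< (begin-strict
            ι (K ℕ.^ (suc n ℕ.* suc d′))  ≡⟨ cong ι (ℕ.^-*-assoc K (suc n) (suc d′)) ⟨
            ι ((K ℕ.^ suc n) ℕ.^ suc d′)  ≡⟨ ι-^ (K ℕ.^ suc n) (suc d′) ⟩
            ι (K ℕ.^ suc n) ^ suc d′  <⟨ ^-monoˡ-< (suc d′) (ι≥0 (K ℕ.^ suc n)) a₂ ⟩
            ((v ^ k) ^ suc d) ^ suc d′  ≡⟨ ^-swap (v ^ k) (suc d) (suc d′) ⟩
            ((v ^ k) ^ suc d′) ^ suc d  <⟨ ^-monoˡ-< (suc d) (^-nonNeg (suc d′) (^-nonNeg k 0≤v)) b₁ ⟩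
            ι (K ℕ.^ suc n′) ^ suc d  ≡⟨ ι-^ (K ℕ.^ suc n′) (suc d) ⟨
            ι ((K ℕ.^ suc n′) ℕ.^ suc d)  ≡⟨ cong ι (ℕ.^-*-assoc K (suc n′) (suc d)) ⟩
            ι (K ℕ.^ (suc n′ ℕ.* suc d))  ∎))
          where
          open ≤-Reasoning
          flat : ∀ x {d z} → (x ^ k) ^ d < z → x ^ (k ℕ.* d) < z
          flat x {d} = subst (_< _) (^-assocʳ x k d)
          flat′ : ∀ x {d z} → z < (x ^ k) ^ d → z < x ^ (k ℕ.* d)
          flat′ x {d} = subst (_ <_) (^-assocʳ x k d)

      /-<-ι : ∀ n d n′ d′ → n ℕ.* suc d′ ℕ.< n′ ℕ.* suc d → (+ n / suc d) * ι (suc d′) < ι n′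
      /-<-ι n d n′ d′ lt = *-cancel-< (ι>0 (suc d)) (begin-strict
        (+ n / suc d) * ι (suc d′) * ι (suc d)  ≡⟨ solve 3 (λ a b c → a :* b :* c := a :* c :* b) refl (+ n / suc d) (ι (suc d′)) (ι (suc d)) ⟩
        (+ n / suc d) * ι (suc d) * ι (suc d′)  ≡⟨ cong (_* ι (suc d′)) (/-ι n (suc d)) ⟩
        ι n * ι (suc d′)  ≡⟨ ι-* n (suc d′) ⟨
        ι (n ℕ.* suc d′)  <⟨ ι-mono-< lt ⟩
        ι (n′ ℕ.* suc d)  ≡⟨ ι-* n′ (suc d) ⟩
        ι n′ * ι (suc d)  ∎)
        where open ≤-Reasoning

      ι-</ : ∀ n d n′ d′ → n′ ℕ.* suc d ℕ.< n ℕ.* suc d′ → ι n′ < (+ n / suc d) * ι (suc d′)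
      ι-</ n d n′ d′ lt = *-cancel-< (ι>0 (suc d)) (begin-strict
        ι n′ * ι (suc d)  ≡⟨ ι-* n′ (suc d) ⟨
        ι (n′ ℕ.* suc d)  <⟨ ι-mono-< lt ⟩
        ι (n ℕ.* suc d′)  ≡⟨ ι-* n (suc d′) ⟩
        ι n * ι (suc d′)  ≡⟨ cong (_* ι (suc d′)) (/-ι n (suc d)) ⟨
        (+ n / suc d) * ι (suc d) * ι (suc d′)  ≡⟨ solve 3 (λ a b c → a :* b :* c := a :* c :* b) refl (+ n / suc d) (ι (suc d)) (ι (suc d′)) ⟩
        (+ n / suc d) * ι (suc d′) * ι (suc d)  ∎)
        where open ≤-Reasoning

      -- An exponent above y that serves for every p, since X < K ^ X bounds the logarithm by X.
      large : ℚ
      large = ι (suc X)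

      large∈ : large ∈ above y
      large∈ = from-above (∈-above X (n<K^n 2≤K X))

      below-large : ∀ {p} → 0ℚ < p → p < ι N → p ∈ below (G ^ℚ large)
      below-large {p} 0<p p<N = IsRoot.below⁺ (^ℚ-root G-root large (suc X) 1 (*-identityʳ large)) 0<p (begin-strict
        p ^ (k ℕ.* 1)  ≡⟨ cong (p ^_) (ℕ.*-identityʳ k) ⟩
        p ^ k  <⟨ ^-monoˡ-< k (<⇒≤ 0<p) p<N ⟩
        ι N ^ k  ≡⟨ ι-^ N k ⟨
        ι X  <⟨ ι-mono-< (ℕ.<-trans (ℕ.n<1+n X) (n<K^n 2≤K (suc X))) ⟩
        ι (K ℕ.^ suc X)  ∎)
        where open ≤-Reasoning

      -- For N = 1 the logarithm is 0 and only negative exponents lie below it.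
      negative-exponent : ∀ d → mkℚ -[1+ 0 ] d (1-coprimeTo (suc d)) ∈ below y
      negative-exponent d = from-below (inj₁ (negative⁻¹ (mkℚ -[1+ 0 ] d (1-coprimeTo (suc d)))))

      shrink : ∀ {p t} i → 0ℚ ≤ p → p ≤ 1ℚ → 0ℚ ≤ t → p ^ suc i * t ^ 1 ≤ t * p ^ i
      shrink {p} {t} i 0≤p p≤1 0≤t = begin
        p * p ^ i * (t * 1ℚ)  ≡⟨ solve 3 (λ a b c → a :* b :* (c :* con 1ℚ) := a :* (c :* b)) refl p (p ^ i) t ⟩
        p * (t * p ^ i)  ≤⟨ *ʳ-≤ (*-nonNeg 0≤t (^-nonNeg i 0≤p)) p≤1 ⟩
        1ℚ * (t * p ^ i)  ≡⟨ *-identityˡ (t * p ^ i) ⟩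
        t * p ^ i  ∎
        where open ≤-Reasoning

      powers-vanish′ : ∀ {p} t → 0ℚ < p → p < 1ℚ → ∃ λ i → t * p ^ i < 1ℚ
      powers-vanish′ {p} t 0<p p<1 =
        proj₁ vanish , subst (λ x → t * x ^ proj₁ vanish < 1ℚ) 1-[1-p] (proj₂ vanish)
        where
        1-[1-p] : 1ℚ - (1ℚ - p) ≡ p
        1-[1-p] = solve 1 (λ p → con 1ℚ :- (con 1ℚ :- p) := p) refl p
        1-p<1 : 1ℚ - p < 1ℚ
        1-p<1 = subst (1ℚ - p <_) (+-identityʳ 1ℚ) (+-monoʳ-< 1ℚ (neg-antimono-< 0<p))
        vanish : ∃ λ i → t * (1ℚ - (1ℚ - p)) ^ i < 1ℚ
        vanish = powers-vanish (1ℚ - p) (p<q⇒0<q-p p<1) 1-p<1 t 0<1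

      -1/_ : ℕ → ℚ
      -1/ d = mkℚ -[1+ 0 ] d (1-coprimeTo (suc d))

      -- G ^ (-1 / (d + 1)) tends to 1 and so passes p; equivalently p ^ (d + 1) times G falls below
      -- 1, which is checked at a rational t′ above G.
      below-negative : ∀ {p} → 0ℚ < p → p < 1ℚ → ∃ λ d → p ∈ below (G ^ℚ (-1/ d))
      below-negative {p} 0<p p<1 = build (∃-below G-root) (∃-above G-root)
        where
        build : (∃ λ t → 0ℚ < t × t ∈ below G) → (∃ λ t → 0ℚ < t × t ∈ above G) → ∃ λ d → p ∈ below (G ^ℚ (-1/ d))
        build (t , 0<t , t∈) (t′ , 0<t′ , t′∈) = i , inj₂ (t , t′ , 0<t , t∈ , t′∈ , bound , bound′)
          where
          vanish : ∃ λ i → t′ * p ^ i < 1ℚ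
          vanish = powers-vanish′ {p} t′ 0<p p<1
          i : ℕ
          i = proj₁ vanish
          bound : p ^ suc i * t ^ 1 < 1ℚ
          bound = ≤-<-trans (shrink {p} {t} i (<⇒≤ 0<p) (<⇒≤ p<1) (<⇒≤ 0<t))
            (<-trans (*ʳ-< (^-pos i 0<p) (below<above G-root 0<t t∈ t′∈)) (proj₂ vanish))
          bound′ : p ^ suc i * t′ ^ 1 < 1ℚ
          bound′ = ≤-<-trans (shrink {p} {t′} i (<⇒≤ 0<p) (<⇒≤ p<1) (<⇒≤ 0<t′)) (proj₂ vanish)

      below⇒-≤0 : ∀ p → p ≤ 0ℚ → p ∈ below (G ^ᵣ y)
      below⇒-≤0 p p≤0 = -1/ 0 , large , negative-exponent 0 , large∈ , inj₁ p≤0 , inj₁ p≤0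

      below⇒-<1 : ∀ p → 0ℚ < p → p < ι N → p < 1ℚ → p ∈ below (G ^ᵣ y)
      below⇒-<1 p 0<p p<N p<1 = -1/ proj₁ found , large , negative-exponent (proj₁ found) , large∈ , proj₂ found , below-large 0<p p<N
        where
        found : ∃ λ d → p ∈ below (G ^ℚ (-1/ d))
        found = below-negative 0<p p<1

      below⇒-≥1 : ∀ p → 0ℚ < p → p < ι N → 1ℚ ≤ p → p ∈ below (G ^ᵣ y)
      below⇒-≥1 p 0<p p<N 1≤p = build (<-dense p<N)
        where
        build : (∃ λ v → p < v × v < ι N) → p ∈ below (G ^ᵣ y)
        build (v , p<v , v<N) = build′ (approach 1≤p p<v v<N)
          where
          build′ : Approach p v (ι N) → p ∈ below (G ^ᵣ y)
          -- The fraction between p and v is the exponent; the larger fraction between v and N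
          -- witnesses that it lies strictly below y.
          build′ (n , d , n′ , d′ , a₁ , _ , _ , b₂ , lt) = + suc n / suc d , large ,
            from-below {+ suc n / suc d} (inj₂ (suc n′ , d′ , /-<-ι (suc n) d (suc n′) d′ lt , ι-cancel-< (subst (ι (K ℕ.^ suc n′) <_) (sym (ιX^ (suc d′))) b₂))) ,
            large∈ ,
            IsRoot.below⁺ (^ℚ-root G-root (+ suc n / suc d) (suc n) (suc d) (/-ι (suc n) (suc d))) 0<p a₁ ,
            below-large 0<p p<N

      below⇒ : ∀ p → p < ι N → p ∈ below (G ^ᵣ y)
      below⇒ p p<N = decide (p ≤? 0ℚ) (p <? 1ℚ)
        where
        decide : Dec (p ≤ 0ℚ) → Dec (p < 1ℚ) → p ∈ below (G ^ᵣ y)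
        decide (yes p≤0) _         = below⇒-≤0 p p≤0
        decide (no p≰0)  (yes p<1) = below⇒-<1 p (≰⇒> p≰0) p<N p<1
        decide (no p≰0)  (no p≮1)  = below⇒-≥1 p (≰⇒> p≰0) p<N (≮⇒≥ p≮1)

      module AtLeast {p : ℚ} (N≤p : ι N ≤ p) where
        open ≤-Reasoning

        0<p : 0ℚ < p
        0<p = <-≤-trans 0<ιN N≤p

        1≤p : 1ℚ ≤ p
        1≤p = ≤-trans (1≤ι 1≤N) N≤p

        -- For r = n / d ≥ 0, p below G ^ r would give X ^ d ≤ p ^ (k d) < K ^ n, so r would not be
        -- below the logarithm. For r < 0, rationals above G are at least 1, so the power is at most
        -- 1 while p ≥ N ≥ 1.
        not-below : ∀ r → r ∈ below (log K X) → ¬ p ∈ below (G ^ℚ r)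
        not-below r@(mkℚ (+ n) d-1 _) r∈ p∈ = below-≥ {r} {n} {d-1} (↥≡+⇒ι r refl) r∈ (ℕ.<⇒≤ (ι-cancel-< (begin-strict
          ι (X ℕ.^ suc d-1)  ≡⟨ ιX^ (suc d-1) ⟩
          ι N ^ (k ℕ.* suc d-1)  ≤⟨ ^-monoˡ-≤ (k ℕ.* suc d-1) (ι≥0 N) N≤p ⟩
          p ^ (k ℕ.* suc d-1)  <⟨ ^ℚ-below⁻ G-root r n (suc d-1) (↥≡+⇒ι r refl) 0<p p∈ ⟩
          ι (K ℕ.^ n)  ∎)))
        not-below (mkℚ -[1+ n ] d-1 _) _ (inj₁ p≤0) = <-irrefl refl (<-≤-trans 0<p p≤0)
        not-below (mkℚ -[1+ n ] d-1 _) _ (inj₂ (t , t′ , 0<t , t∈ , t′∈ , _ , lt)) =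
          <-irrefl refl (≤-<-trans (*-mono-≤ (<⇒≤ 0<1) (^-nonNeg (suc n) (<⇒≤ 0<t′)) (1≤^ (suc d-1) 1≤p) (1≤^ (suc n) 1≤t′)) lt)
          where
          0<t′ : 0ℚ < t′
          0<t′ = proj₁ (G.above⁻ t′∈)
          1≤t′ : 1ℚ ≤ t′
          1≤t′ = <⇒≤ (^-cancelˡ-< k (<⇒≤ 0<t′) (≤-<-trans (^≤1 k (<⇒≤ 0<1) ≤-refl) (≤-<-trans (1≤ι 1≤K) (proj₂ (G.above⁻ t′∈)))))

      below⇐ : ∀ p → p ∈ below (G ^ᵣ y) → p < ι N
      below⇐ p (r , _ , r∈ , _ , p∈ , _) = ≰⇒> λ N≤p → AtLeast.not-below N≤p r (to-below {r} r∈) p∈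

      above⇒ : ∀ p → ι N < p → p ∈ above (G ^ᵣ y)
      above⇒ p N<p =
        let v , N<v , v<p = <-dense N<p
            n′ , d′ , n , d , b₁ , _ , _ , a₂ , lt = approach (1≤ι 1≤N) N<v v<p
            t′ , 0<t′ , t′∈ = ∃-above G-root
        -- The lower exponent is -1: since K ≥ 2 gives G > 1, its power is below 1 ≤ N < p.
        in mkℚ -[1+ 0 ] 0 (1-coprimeTo 1) , + suc n / suc d , negative-exponent 0 ,
           from-above (suc n′ , d′ , ι-</ (suc n) d (suc n′) d′ lt , ι-cancel-< (subst (_< ι (K ℕ.^ suc n′)) (sym (ιX^ (suc d′))) b₁)) ,
           (0<p , 1ℚ , t′ , 0<1 , 1∈ , t′∈ , product ≤-refl , product (<⇒≤ (below<above G-root 0<1 1∈ t′∈))) ,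
           IsRoot.above⁺ (^ℚ-root G-root (+ suc n / suc d) (suc n) (suc d) (/-ι (suc n) (suc d))) 0<p a₂
        where
        open ≤-Reasoning
        0<p : 0ℚ < p
        0<p = <-trans 0<ιN N<p
        1∈ : 1ℚ ∈ below G
        1∈ = G.below⁺ 0<1 (≤-<-trans (^≤1 k (<⇒≤ 0<1) ≤-refl) (ι-mono-< {1} {K} 2≤K))
        product : ∀ {t} → 1ℚ ≤ t → 1ℚ < p ^ 1 * t ^ 1
        product {t} 1≤t = begin-strict
          1ℚ  ≤⟨ 1≤ι 1≤N ⟩
          ι N  <⟨ N<p ⟩
          p  ≡⟨ *-identityʳ p ⟨
          p * 1ℚ  ≤⟨ *ˡ-≤ (<⇒≤ 0<p) 1≤t ⟩
          p * t  ≡⟨ solve 2 (λ p t → p :* t := (p :* con 1ℚ) :* (t :* con 1ℚ)) refl p t ⟩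
          p ^ 1 * t ^ 1  ∎

      above⇐ : ∀ p → p ∈ above (G ^ᵣ y) → ι N < p
      above⇐ p (_ , r′ , _ , r′∈ , _ , p∈) = bound (above-fraction {r′} (to-above {r′} r′∈))
        where
        open ≤-Reasoning
        bound : (∃₂ λ n d → r′ * ι (suc d) ≡ ι n × X ℕ.^ suc d ℕ.< K ℕ.^ n) → ι N < p
        bound (zero  , d , _  , lt) = contradiction (ℕ.m^n>0 X {{ℕ.>-nonZero 1≤X}} (suc d)) (ℕ.<⇒≱ lt)
        bound (suc n , d , eq , lt) = ^-cancelˡ-< (k ℕ.* suc d) (<⇒≤ (proj₁ p∈)) (begin-strict
          ι N ^ (k ℕ.* suc d)  ≡⟨ ιX^ (suc d) ⟨
          ι (X ℕ.^ suc d)  <⟨ ι-mono-< lt ⟩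
          ι (K ℕ.^ suc n)  <⟨ proj₂ (IsRoot.above⁻ (^ℚ-root G-root r′ (suc n) (suc d) eq) p∈) ⟩
          p ^ (k ℕ.* suc d)  ∎)

    -- From G ^ k = K, log_K (N ^ k) = k log_K N = log_G N.
    root-^-log : fromℕ N ≃ᵣ G ^ᵣ y
    root-^-log p = mk⇔ (below⇒ p) (below⇐ p) , mk⇔ (above⇒ p) (above⇐ p)

-- The count, its error term and the final estimates

open import Defs
open import Data.Nat.Base as ℕ using (ℕ; zero; suc; _≤_; z≤n; s≤s; NonZero)
import Data.Nat.Properties as ℕ
import Data.Nat.DivMod as ℕ
open import Data.Fin.Base using (Fin; toℕ; fromℕ<)
open import Data.Fin.Properties using (toℕ-fromℕ<)
open import Data.Integer.Base using (+_)
open import Data.List.Base using (length)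
open import Data.Product.Base using (Σ; _×_; _,_; proj₁; proj₂; ∃)
open import Data.Sum.Base using (inj₂)
open import Data.Rational.Base using (ℚ; 0ℚ; 1ℚ; _<_; _+_; _*_; _-_; -_; _/_)
import Data.Rational.Properties as ℚ
open import Data.Rational.Solver
open import Relation.Binary.PropositionalEquality
open import Relation.Nullary using (yes; no; contradiction)
open import Relation.Unary using (_∈_)
open FiniteSums using (∏)
open UpperBounds using (pairs; pairs-mono; pairs>0; ∏-threshold; module UpperBound)
open LowerBounds using (module Kunz)
open KunzCoordinates using (module Correspondence)
open ParameterChoice
open RationalPowers
open Enumeration using (n<K^n)
open Roots
open Logarithms
open RealPowers
open +-*-Solver

-- In the admissible range this is the residue of f modulo m, and α = offset / m.
offset : ℕ → ℕ → ℕ → ℕ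
offset q f m = f ℕ.∸ (q ℕ.∸ 1) ℕ.* m

-- growth q f m ^ (2 m)
base : ℕ → ℕ → ℕ → ℕ
base q f m = pairs q ℕ.^ offset q f m ℕ.* pairs (q ℕ.∸ 1) ℕ.^ (m ℕ.∸ offset q f m)

count : ℕ → ℕ → ℕ → ℕ
count q f zero        = 0
count q f m@(suc _) = length (Kunz.kunz m q (fromℕ< (ℕ.m%n<n f m)))

-- log_growth N − m; the two maxima only matter outside the admissible range.
error : ℕ → ℕ → ℕ → ℝ
error q f m = mkℝ
  (shift (ι m) (log (2 ℕ.⊔ base q f m) ((1 ℕ.⊔ count q f m) ℕ.^ (2 ℕ.* m))))
  (shift-isReal (ι m) (Log.log-isReal (ℕ.m≤m⊔n 2 (base q f m)) (ℕ.m^n>0 (1 ℕ.⊔ count q f m) {{ℕ.>-nonZero (ℕ.m≤m⊔n 1 (count q f m))}} (2 ℕ.* m))))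

module Admitted (q : ℕ) (3≤q : 3 ≤ q) (f m-1 : ℕ) (adm : Admissible q f (suc m-1)) where

  m r K N C : ℕ
  m = suc m-1
  r = offset q f m
  K = base q f m
  N = count q f m
  C = (q ℕ.+ 2) ℕ.^ 2

  1≤q : 1 ≤ q
  1≤q = ℕ.≤-trans (s≤s z≤n) 3≤q

  f≡ : r ℕ.+ (q ℕ.∸ 1) ℕ.* m ≡ f
  f≡ = ℕ.m∸n+n≡m (ℕ.<⇒≤ (proj₁ adm))

  0<r : 0 ℕ.< r
  0<r = ℕ.m<n⇒0<n∸m (proj₁ adm)

  r<m : r ℕ.< m
  r<m = ℕ.+-cancelʳ-< ((q ℕ.∸ 1) ℕ.* m) r m (begin-strict
    r ℕ.+ (q ℕ.∸ 1) ℕ.* m  ≡⟨ f≡ ⟩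
    f  <⟨ proj₂ adm ⟩
    q ℕ.* m  ≡⟨ cong (ℕ._* m) (ℕ.m+[n∸m]≡n 1≤q) ⟨
    m ℕ.+ (q ℕ.∸ 1) ℕ.* m  ∎)
    where open ℕ.≤-Reasoning

  f%m : f ℕ.% m ≡ r
  f%m = trans (cong (ℕ._% m) (sym f≡)) (trans (ℕ.[m+kn]%n≡m%n r (q ℕ.∸ 1) m) (ℕ.m<n⇒m%n≡m r<m))

  f/m : f ℕ./ m ≡ q ℕ.∸ 1
  f/m = ℕ.*-cancelʳ-≡ (f ℕ./ m) (q ℕ.∸ 1) m (ℕ.+-cancelˡ-≡ r _ _
    (trans (cong (ℕ._+ f ℕ./ m ℕ.* m) (sym f%m)) (trans (sym (ℕ.m≡m%n+[m/n]*n f m)) (sym f≡))))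

  a : Fin m
  a = fromℕ< (ℕ.m%n<n f m)

  toℕ-a : toℕ a ≡ r
  toℕ-a = trans (toℕ-fromℕ< (ℕ.m%n<n f m)) f%m

  cardinality : HasCardinality (semigroups f m) N
  cardinality = Correspondence.cardinality m q 1≤q f f/m

  open UpperBound m q a using (weight; module Covering)

  ∏weight : ∏ weight ≡ K
  ∏weight = ∏-threshold m r (pairs q) (pairs (q ℕ.∸ 1)) weight (ℕ.<⇒≤ r<m) low high
    where
    low : ∀ i → toℕ i ℕ.< r → weight i ≡ pairs q
    low i lt with toℕ i ℕ.<? toℕ a
    ... | yes _ = refl
    ... | no ≮  = contradiction (subst (toℕ i ℕ.<_) (sym toℕ-a) lt) ≮
    high : ∀ i → r ≤ toℕ i → weight i ≡ pairs (q ℕ.∸ 1)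
    high i le with toℕ i ℕ.<? toℕ a
    ... | yes lt = contradiction le (ℕ.<⇒≱ (subst (toℕ i ℕ.<_) toℕ-a lt))
    ... | no _   = refl

  -- Both q and q - 1 are at least 2, and `pairs 2` is 4. This exponential growth of K makes the
  -- constant `C ^ 3` and the overhead negligible.
  4^m≤K : 4 ℕ.^ m ≤ K
  4^m≤K = begin
    4 ℕ.^ m  ≡⟨ cong (4 ℕ.^_) (ℕ.m+[n∸m]≡n (ℕ.<⇒≤ r<m)) ⟨
    4 ℕ.^ (r ℕ.+ (m ℕ.∸ r))  ≡⟨ ℕ.^-distribˡ-+-* 4 r (m ℕ.∸ r) ⟩
    4 ℕ.^ r ℕ.* 4 ℕ.^ (m ℕ.∸ r)  ≤⟨ ℕ.*-mono-≤ (ℕ.^-monoˡ-≤ r (pairs-mono {2} {q} (ℕ.≤-trans (ℕ.n≤1+n 2) 3≤q)))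
                                                              (ℕ.^-monoˡ-≤ (m ℕ.∸ r) (pairs-mono {2} {q ℕ.∸ 1} (ℕ.∸-monoˡ-≤ 1 3≤q))) ⟩
    K  ∎
    where open ℕ.≤-Reasoning

  m<K : m ℕ.< K
  m<K = ℕ.<-≤-trans (n<K^n (s≤s (s≤s z≤n)) m) 4^m≤K

  2≤K : 2 ≤ K
  2≤K = ℕ.≤-trans (s≤s (s≤s z≤n)) m<K

  instance
    K≢0 : NonZero K
    K≢0 = ℕ.>-nonZero (ℕ.≤-trans (s≤s z≤n) 2≤K)

  K≤NNC³ : K ≤ N ℕ.* N ℕ.* C ℕ.^ 3
  K≤NNC³ = ℕ.≤-trans (ℕ.≤-reflexive (sym ∏weight))
    (Kunz.LowerBound.lower-bound m q a 3≤q (subst (0 ℕ.<_) (sym toℕ-a) 0<r))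

  1≤N : 1 ≤ N
  1≤N = nonzero N K≤NNC³
    where
    nonzero : ∀ n → K ≤ n ℕ.* n ℕ.* C ℕ.^ 3 → 1 ≤ n
    nonzero zero    le = contradiction (ℕ.≤-trans 2≤K le) λ ()
    nonzero (suc n) le = s≤s z≤n

  NN≤overhead*K : (P : Parameters q m) → N ℕ.* N ≤ Parameters.overhead P ℕ.* K
  NN≤overhead*K P = begin
    N ℕ.* N  ≤⟨ upper-bound kunz kunz-unique (λ v∈ → let _ , _ , sub , _ , k≤q , k<q = ∈-kunz⁻ v∈ in sub , k≤q , k<q) ⟩
    Z^L ℕ.* (∏ weight ℕ.* C^l)  ≡⟨ cong (λ x → Z^L ℕ.* (x ℕ.* C^l)) ∏weight ⟩
    Z^L ℕ.* (K ℕ.* C^l)  ≡⟨ cong (Z^L ℕ.*_) (ℕ.*-comm K C^l) ⟩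
    Z^L ℕ.* (C^l ℕ.* K)  ≡⟨ ℕ.*-assoc Z^L C^l K ⟨
    overhead ℕ.* K  ∎
    where
    open ℕ.≤-Reasoning
    open Parameters P
    open Covering e d t y 1≤d d≤m mq≤te me≤dy using (upper-bound)
    open Kunz m q a using (kunz; kunz-unique; ∈-kunz⁻)
    Z^L C^l : ℕ
    Z^L = suc (m ℕ.* suc q) ℕ.^ (d ℕ.+ (t ℕ.+ (1 ℕ.+ y))) ℕ.* suc (m ℕ.* suc q) ℕ.^ (d ℕ.+ (t ℕ.+ (1 ℕ.+ y)))
    C^l = C ℕ.^ ((d ℕ.+ y) ℕ.+ (d ℕ.+ y) ℕ.+ 1)

  -- In the (D + 1)-th power of `K≤NNC³` the constant is at most m < K, so it costs less than one
  -- factor K.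
  lower-estimate : ∀ D → (C ℕ.^ 3) ℕ.^ suc D ≤ m → K ℕ.^ D ℕ.< (N ℕ.* N) ℕ.^ suc D
  lower-estimate D le = ℕ.*-cancelˡ-< K _ _ (begin-strict
    K ℕ.^ suc D  ≤⟨ ℕ.^-monoˡ-≤ (suc D) K≤NNC³ ⟩
    (N ℕ.* N ℕ.* C ℕ.^ 3) ℕ.^ suc D  ≡⟨ ^-distribʳ-* (suc D) (N ℕ.* N) (C ℕ.^ 3) ⟩
    (N ℕ.* N) ℕ.^ suc D ℕ.* (C ℕ.^ 3) ℕ.^ suc D  <⟨ ℕ.*-monoʳ-< ((N ℕ.* N) ℕ.^ suc D) {{NN^≢0}} (ℕ.≤-<-trans le m<K) ⟩
    (N ℕ.* N) ℕ.^ suc D ℕ.* K  ≡⟨ ℕ.*-comm ((N ℕ.* N) ℕ.^ suc D) K ⟩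
    K ℕ.* (N ℕ.* N) ℕ.^ suc D  ∎)
    where
    open ℕ.≤-Reasoning
    NN^≢0 : NonZero ((N ℕ.* N) ℕ.^ suc D)
    NN^≢0 = ℕ.m^n≢0 (N ℕ.* N) (suc D) {{ℕ.>-nonZero (ℕ.*-mono-≤ 1≤N 1≤N)}}

  -- The D-th power of the overhead is less than 4 ^ m ≤ K, so again less than one factor K is lost.
  upper-estimate : ∀ D (P : Parameters q m) → Parameters.overhead P ℕ.^ D ℕ.< 4 ℕ.^ m → (N ℕ.* N) ℕ.^ D ℕ.< K ℕ.^ suc D
  upper-estimate D P lt = begin-strict
    (N ℕ.* N) ℕ.^ D  ≤⟨ ℕ.^-monoˡ-≤ D (NN≤overhead*K P) ⟩
    (overhead ℕ.* K) ℕ.^ D  ≡⟨ ^-distribʳ-* D overhead K ⟩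
    overhead ℕ.^ D ℕ.* K ℕ.^ D  <⟨ ℕ.*-monoˡ-< (K ℕ.^ D) {{ℕ.m^n≢0 K D}} (ℕ.<-≤-trans lt 4^m≤K) ⟩
    K ℕ.* K ℕ.^ D  ∎
    where
    open ℕ.≤-Reasoning
    open Parameters P

  αm : α q f m * ι m ≡ ι r
  αm = begin
    (+ f / m - ι (q ℕ.∸ 1)) * ι m  ≡⟨ solve 3 (λ x y z → (x :- y) :* z := x :* z :- y :* z) refl (+ f / m) (ι (q ℕ.∸ 1)) (ι m) ⟩
    (+ f / m) * ι m - ι (q ℕ.∸ 1) * ι m  ≡⟨ cong₂ _-_ (/-ι f m) (sym (ι-* (q ℕ.∸ 1) m)) ⟩
    ι f - ι ((q ℕ.∸ 1) ℕ.* m)  ≡⟨ cong (λ x → ι x - ι ((q ℕ.∸ 1) ℕ.* m)) (sym f≡) ⟩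
    ι (r ℕ.+ (q ℕ.∸ 1) ℕ.* m) - ι ((q ℕ.∸ 1) ℕ.* m) ≡⟨ cong (_- ι ((q ℕ.∸ 1) ℕ.* m)) (ι-+ r ((q ℕ.∸ 1) ℕ.* m)) ⟩
    ι r + ι ((q ℕ.∸ 1) ℕ.* m) - ι ((q ℕ.∸ 1) ℕ.* m) ≡⟨ solve 2 (λ x y → x :+ y :- y := x) refl (ι r) (ι ((q ℕ.∸ 1) ℕ.* m)) ⟩
    ι r  ∎
    where open ≡-Reasoning

  [1-α]m : (1ℚ - α q f m) * ι m ≡ ι (m ℕ.∸ r)
  [1-α]m = begin
    (1ℚ - α q f m) * ι m  ≡⟨ solve 2 (λ x z → (con 1ℚ :- x) :* z := z :- x :* z) refl (α q f m) (ι m) ⟩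
    ι m - α q f m * ι m  ≡⟨ cong (λ x → ι m - x) αm ⟩
    ι m - ι r  ≡⟨ cong (λ x → ι x - ι r) (sym (ℕ.m∸n+n≡m (ℕ.<⇒≤ r<m))) ⟩
    ι (m ℕ.∸ r ℕ.+ r) - ι r  ≡⟨ cong (_- ι r) (ι-+ (m ℕ.∸ r) r) ⟩
    ι (m ℕ.∸ r) + ι r - ι r  ≡⟨ solve 2 (λ x y → x :+ y :- y := x) refl (ι (m ℕ.∸ r)) (ι r) ⟩
    ι (m ℕ.∸ r)  ∎
    where open ≡-Reasoning

  -- c_q and c_{q-1} are square roots of integers, and α = r / m and 1 - α = (m - r) / m share the
  -- denominator m; so both factors are roots of the same order 2 m.
  growth-root : IsRoot (growth q f m) (2 ℕ.* m) K
  growth-root = *ᵣ-root {{_}} {{ℕ.m^n≢0 (pairs q) r}} {{ℕ.m^n≢0 (pairs (q ℕ.∸ 1)) (m ℕ.∸ r)}}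
    (^ℚ-root (√-root (pairs q)) (α q f m) r m αm)
    (^ℚ-root (√-root (pairs (q ℕ.∸ 1))) (1ℚ - α q f m) (m ℕ.∸ r) m [1-α]m)
    where
    instance
      A≢0 : NonZero (pairs q)
      A≢0 = ℕ.>-nonZero (pairs>0 q)
      B≢0 : NonZero (pairs (q ℕ.∸ 1))
      B≢0 = ℕ.>-nonZero (pairs>0 (q ℕ.∸ 1))
      r≢0 : NonZero r
      r≢0 = ℕ.>-nonZero 0<r
      m-r≢0 : NonZero (m ℕ.∸ r)
      m-r≢0 = ℕ.>-nonZero (ℕ.m<n⇒0<n∸m r<m)

  X : ℕ
  X = N ℕ.^ (2 ℕ.* m)

  1≤X : 1 ≤ X
  1≤X = ℕ.m^n>0 N {{ℕ.>-nonZero 1≤N}} (2 ℕ.* m)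

  error≡ : cut (error q f m) ≡ shift (ι m) (log K X)
  error≡ = cong₂ (λ x y → shift (ι m) (log x (y ℕ.^ (2 ℕ.* m)))) (ℕ.m≤n⇒m⊔n≡n 2≤K) (ℕ.m≤n⇒m⊔n≡n 1≤N)

  count≃growth : fromℕ N ≃ᵣ growth q f m ^ᵣ (fromℕ m +ᵣ cut (error q f m))
  count≃growth = root-^-log growth-root 2≤K 1≤N
    (subst (λ E → fromℕ m +ᵣ E ≃ᵣ log K X) (sym error≡) (fromℚ+shift (ι m) (Log.log-isReal 2≤K 1≤X)))

  X^ : ∀ D → X ℕ.^ D ≡ ((N ℕ.* N) ℕ.^ D) ℕ.^ m
  X^ D = begin
    (N ℕ.^ (2 ℕ.* m)) ℕ.^ D  ≡⟨ cong (ℕ._^ D) (ℕ.^-*-assoc N 2 m) ⟨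
    ((N ℕ.^ 2) ℕ.^ m) ℕ.^ D  ≡⟨ cong (λ x → (x ℕ.^ m) ℕ.^ D) (cong (N ℕ.*_) (ℕ.*-identityʳ N)) ⟩
    ((N ℕ.* N) ℕ.^ m) ℕ.^ D  ≡⟨ ^-swapᴺ (N ℕ.* N) m D ⟩
    ((N ℕ.* N) ℕ.^ D) ℕ.^ m  ∎
    where open ≡-Reasoning

  K^ : ∀ D → K ℕ.^ (m ℕ.* D) ≡ (K ℕ.^ D) ℕ.^ m
  K^ D = trans (cong (K ℕ.^_) (ℕ.*-comm m D)) (sym (ℕ.^-*-assoc K D m))

  -- E = log_K (N ^ (2 m)) - m, so E / m = log_K (N²) - 1. The hypotheses place log_K (N²) between D
  -- / (D + 1) and (D + 2) / (D + 1), hence within 1 / (D + 1) < ε of 1.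
  small-error : ∀ {ε} D → 1ℚ < ι (suc D) * ε → K ℕ.^ D ℕ.< (N ℕ.* N) ℕ.^ suc D → (N ℕ.* N) ℕ.^ suc D ℕ.< K ℕ.^ suc (suc D) →
    ∣ cut (error q f m) ÷ᵣ m ∣< ε
  small-error {ε} D 1<Dε lo hi = subst (λ E → ∣ E ÷ᵣ m ∣< ε) (sym error≡) (lower , upper)
    where
    open ℚ.≤-Reasoning
    lower : (- ε) * ι m + ι m ∈ below (log K X)
    lower = inj₂ (m ℕ.* D , D , (begin-strict
      ((- ε) * ι m + ι m) * ι (suc D)  ≡⟨ solve 3 (λ e m d → ((:- e) :* m :+ m) :* d := m :* d :- m :* (d :* e)) refl ε (ι m) (ι (suc D)) ⟩
      ι m * ι (suc D) - ι m * (ι (suc D) * ε)  <⟨ ℚ.+-monoʳ-< (ι m * ι (suc D)) (ℚ.neg-antimono-< (*ˡ-< (ι>0 m) 1<Dε)) ⟩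
      ι m * ι (suc D) - ι m * 1ℚ  ≡⟨ cong (λ x → ι m * x - ι m * 1ℚ) (ι-suc D) ⟩
      ι m * (1ℚ + ι D) - ι m * 1ℚ  ≡⟨ solve 2 (λ m d → m :* (con 1ℚ :+ d) :- m :* con 1ℚ := m :* d) refl (ι m) (ι D) ⟩
      ι m * ι D  ≡⟨ ι-* m D ⟨
      ι (m ℕ.* D)  ∎) ,
      subst₂ ℕ._<_ (sym (K^ D)) (sym (X^ (suc D))) (ℕ.^-monoˡ-< m lo))
    upper : ε * ι m + ι m ∈ above (log K X)
    upper = m ℕ.* suc (suc D) , D , (begin-strict
      ι (m ℕ.* suc (suc D))  ≡⟨ ι-* m (suc (suc D)) ⟩
      ι m * ι (suc (suc D))  ≡⟨ cong (ι m *_) (ι-suc (suc D)) ⟩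
      ι m * (1ℚ + ι (suc D))  <⟨ *ˡ-< (ι>0 m) (ℚ.+-monoˡ-< (ι (suc D)) 1<Dε) ⟩
      ι m * (ι (suc D) * ε + ι (suc D))  ≡⟨ solve 3 (λ e m d → m :* (d :* e :+ d) := (e :* m :+ m) :* d) refl ε (ι m) (ι (suc D)) ⟩
      (ε * ι m + ι m) * ι (suc D)  ∎) ,
      subst₂ ℕ._<_ (sym (X^ (suc D))) (sym (K^ (suc (suc D)))) (ℕ.^-monoˡ-< m hi)

not-admissible : ∀ q f → Admissible q f 0 → ∀ {ℓ} {A : Set ℓ} → A
not-admissible q f (_ , lt) = contradiction (subst (f ℕ.<_) (ℕ.*-zeroʳ q) lt) λ ()

theorem1p3 : (q : ℕ) → 3 ≤ q →
    Σ (ℕ → ℕ → ℕ) λ N → Σ (ℕ → ℕ → ℝ) λ E →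
    ((f m : ℕ) .{{_ : NonZero f}} .{{_ : NonZero m}} → Admissible q f m →
    HasCardinality (semigroups f m) (N f m) ×
    fromℕ (N f m) ≃ᵣ growth q f m ^ᵣ (fromℕ m +ᵣ cut (E f m))) ×
    ((ε : ℚ) → 0ℚ < ε → ∃ λ (M : ℕ) →
    (f m : ℕ) .{{_ : NonZero f}} .{{_ : NonZero m}} → Admissible q f m →
    M ≤ m → ∣ cut (E f m) ÷ᵣ m ∣< ε)
theorem1p3 q 3≤q = count q , error q , exact , asymptotic
  where
  exact : (f m : ℕ) .{{_ : NonZero f}} .{{_ : NonZero m}} → Admissible q f m →
    HasCardinality (semigroups f m) (count q f m) ×
    fromℕ (count q f m) ≃ᵣ growth q f m ^ᵣ (fromℕ m +ᵣ cut (error q f m))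
  exact f zero    adm = not-admissible q f adm
  exact f (suc m) adm = cardinality , count≃growth
    where open Admitted q 3≤q f m adm

  asymptotic : (ε : ℚ) → 0ℚ < ε → ∃ λ (M : ℕ) →
    (f m : ℕ) .{{_ : NonZero f}} .{{_ : NonZero m}} → Admissible q f m →
    M ≤ m → ∣ cut (error q f m) ÷ᵣ m ∣< ε
  asymptotic ε 0<ε = M₁ ℕ.+ M₂ , estimate
    where
    fine : ∃ λ D → 1ℚ < ι D * ε
    fine = archimedean-* 1ℚ 0<ε
    D : ℕ
    D = proj₁ fine
    1<Dε : 1ℚ < ι (suc D) * ε
    1<Dε = ℚ.<-≤-trans (proj₂ fine) (*ʳ-≤ (ℚ.<⇒≤ 0<ε) (ι-mono-≤ (ℕ.n≤1+n D)))
    -- `M₁` is the constant that m must reach in `lower-estimate`; `M₂` is the threshold from which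
    -- the overhead is small enough for `upper-estimate`.
    M₁ M₂ : ℕ
    M₁ = (((q ℕ.+ 2) ℕ.^ 2) ℕ.^ 3) ℕ.^ suc D
    M₂ = proj₁ (parameters q (suc D))
    estimate : (f m : ℕ) .{{_ : NonZero f}} .{{_ : NonZero m}} → Admissible q f m →
      M₁ ℕ.+ M₂ ≤ m → ∣ cut (error q f m) ÷ᵣ m ∣< ε
    estimate f zero    adm _  = not-admissible q f adm
    estimate f (suc m) adm le = small-error D 1<Dε
        (lower-estimate D (ℕ.≤-trans (ℕ.m≤m+n M₁ M₂) le))
        (upper-estimate (suc D) (proj₁ chosen) (proj₂ chosen))
      where
      open Admitted q 3≤q f m adm hiding (m)
      chosen : ∃ λ (P : Parameters q (suc m)) → Parameters.overhead P ℕ.^ suc D ℕ.< 4 ℕ.^ suc m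
      chosen = proj₂ (parameters q (suc D)) (suc m) (s≤s z≤n) (ℕ.≤-trans (ℕ.m≤n+m M₂ M₁) le)
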